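{- Let $\Phi$ be a root system of type $\mathrm A_n$ or $\mathrm D_n$ with simple system $\Pi$. If $\alpha\in\Pi$ is a leaf of the Dynkin diagram of $\Phi$, then $$h_\Phi\, n-h_{\Phi_\alpha}(n-1)=2\,\frac{|W_\alpha|}{|W_{\widetilde N[\alpha]}|}.$$
   Context: $h_\Psi$ denotes the Coxeter number of the irreducible root system $\Psi$. $\Phi_\alpha$ is the root subsystem generated by $\Pi\setminus\{\alpha\}$ (irreducible of rank $n-1$ since $\alpha$ is a leaf; for $n=1$ it is empty and the term $h_{\Phi_\alpha}(n-1)$ is read as $0$). For $X\subseteq\Pi$, $W_X$ is the subgroup of the Weyl group generated by the reflections $s_\beta$ with $\beta\in\Pi\setminus X$; $W_\alpha=W_{\{\alpha\}}$. $\widetilde N[\alpha]=\{\varepsilon\in\Pi:(\varepsilon,\alpha)\ne0\}$, i.e. $\alpha$ together with its neighbours in the Dynkin diagram. -}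

module Defs where

open import Algebra.Bundles using (CommutativeMonoid; CommutativeRing; Group)
open import Algebra.Module.Bundles using (LeftModule)
open import Data.Bool.Base using (Bool; if_then_else_; _∧_; _∨_)
open import Data.Fin.Base as Fin using (Fin; toℕ; punchIn)
open import Data.Fin.Permutation using (Permutation′; _⟨$⟩ʳ_)
open import Data.Integer.Base as ℤ using (ℤ; +_; -[1+_]; 0ℤ; -1ℤ)
open import Data.Nat.Base as ℕ using (ℕ; zero; suc; _≡ᵇ_; _<ᵇ_)
open import Data.Product.Base using (Σ; Σ-syntax; ∃; _×_; _,_; proj₁; proj₂)
open import Data.Sum.Base using (_⊎_; inj₁; inj₂)
open import Data.Vec.Functional as Vector using (Vector; insertAt; removeAt)
import Data.Vec.Functional.Properties as Vector
open import Function.Base using (_∘_)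
open import Function.Bundles using (Inverse)
open import Level using (Level; _⊔_) renaming (suc to lsuc)
open import Relation.Binary.Bundles using (Setoid)
open import Relation.Binary.Core using (Rel)
import Relation.Binary.Construct.On as On
open import Relation.Binary.PropositionalEquality as ≡ using (_≡_; _≢_)
import Relation.Binary.Reasoning.Setoid as ≈-Reasoning
open import Relation.Binary.Structures using (IsStrictTotalOrder)
open import Relation.Nullary.Negation using (¬_; contradiction)
open import Relation.Unary using (Pred; _∈_; _∉_)

import Algebra.Definitions.RawMonoid as RawMonoidDefs
import Algebra.Properties.AbelianGroup as AbelianGroupProps
import Algebra.Properties.CommutativeSemigroup as CommSemigroupProps
import Algebra.Properties.CommutativeMonoid.Sum as SumProps
import Algebra.Properties.Ring as RingProps

private variable
  c ℓ₁ ℓ₂ v ℓv p q : Level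

-- Stands in for the real numbers, which are (classically) an instance.
record OrderedField c ℓ₁ ℓ₂ : Set (lsuc (c ⊔ ℓ₁ ⊔ ℓ₂)) where
  infix 4 _<_
  infix 8 _⁻¹
  field
    commutativeRing : CommutativeRing c ℓ₁
  open CommutativeRing commutativeRing public
  field
    _<_                : Rel Carrier ℓ₂
    isStrictTotalOrder : IsStrictTotalOrder _≈_ _<_
    +-monoˡ-<          : ∀ z {x y} → x < y → x + z < y + z
    *-pos              : ∀ {x y} → 0# < x → 0# < y → 0# < x * y
    0<1                : 0# < 1#
    -- The value of 0# ⁻¹ is unspecified.
    _⁻¹                : Carrier → Carrier
    ⁻¹-inverseʳ        : ∀ {x} → x ≉ 0# → x * x ⁻¹ ≈ 1#

  open IsStrictTotalOrder isStrictTotalOrder public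
    using (compare)
    renaming (trans to <-trans; irrefl to <-irrefl; <-resp-≈ to <-resp-≈)

  2# : Carrier
  2# = 1# + 1#

  open RawMonoidDefs +-rawMonoid using () renaming (_×_ to _ℕ×_)

  fromℤ : ℤ → Carrier
  fromℤ (+ n)    = n ℕ× 1#
  fromℤ -[1+ n ] = - (suc n ℕ× 1#)

  0<suc : ∀ n → 0# < suc n ℕ× 1#
  0<suc zero    = proj₁ <-resp-≈ (sym (+-identityʳ 1#)) 0<1
  0<suc (suc n) = <-trans (0<suc n)
    (proj₂ <-resp-≈ (+-identityˡ _) (+-monoˡ-< (suc n ℕ× 1#) 0<1))

  fromℤ≈0⇒≡0 : ∀ k → fromℤ k ≈ 0# → k ≡ 0ℤ
  fromℤ≈0⇒≡0 (+ zero)  _  = ≡.refl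
  fromℤ≈0⇒≡0 (+ suc n) eq = contradiction (0<suc n) (<-irrefl (sym eq))
  fromℤ≈0⇒≡0 -[1+ n ]  eq = contradiction (0<suc n) (<-irrefl (sym n≈0))
    where
    open RingProps ring using (-‿involutive; -0#≈0#)
    n≈0 : suc n ℕ× 1# ≈ 0#
    n≈0 = trans (sym (-‿involutive _)) (trans (-‿cong eq) -0#≈0#)

record EuclideanSpace (K : OrderedField c ℓ₁ ℓ₂) v ℓv
                      : Set (c ⊔ ℓ₁ ⊔ ℓ₂ ⊔ lsuc (v ⊔ ℓv)) where
  private module K = OrderedField K
  field
    leftModule : LeftModule K.ring v ℓv
  open LeftModule leftModule public
  open RawMonoidDefs +ᴹ-rawMonoid public using () renaming (sum to sumᴹ)

  _∙ₗ_ : ∀ {n} → (Fin n → K.Carrier) → (Fin n → Carrierᴹ) → Carrierᴹ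
  a ∙ₗ e = sumᴹ (λ i → a i *ₗ e i)

  field
    finiteDimensional : Σ[ d ∈ ℕ ] Σ[ e ∈ (Fin d → Carrierᴹ) ]
                          (∀ x → ∃ λ a → x ≈ᴹ a ∙ₗ e)
    ⟪_,_⟫    : Carrierᴹ → Carrierᴹ → K.Carrier
    ⟪⟫-cong  : ∀ {x x′ y y′} → x ≈ᴹ x′ → y ≈ᴹ y′ → ⟪ x , y ⟫ K.≈ ⟪ x′ , y′ ⟫
    ⟪⟫-sym   : ∀ x y → ⟪ x , y ⟫ K.≈ ⟪ y , x ⟫
    ⟪⟫-+     : ∀ x y z → ⟪ x +ᴹ y , z ⟫ K.≈ ⟪ x , z ⟫ K.+ ⟪ y , z ⟫
    ⟪⟫-*     : ∀ a x y → ⟪ a *ₗ x , y ⟫ K.≈ a K.* ⟪ x , y ⟫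
    nonneg   : ∀ x → ¬ (⟪ x , x ⟫ K.< K.0#)
    definite : ∀ {x} → ⟪ x , x ⟫ K.≈ K.0# → x ≈ᴹ 0ᴹ

module _ (G : Group c ℓ₁) where
  open Group G

  data Generated (S : Pred Carrier p) : Pred Carrier (c ⊔ ℓ₁ ⊔ p) where
    gen  : ∀ {g} → g ∈ S → g ∈ Generated S
    unit : ε ∈ Generated S
    mul  : ∀ {g h} → g ∈ Generated S → h ∈ Generated S → g ∙ h ∈ Generated S
    inv  : ∀ {g} → g ∈ Generated S → g ⁻¹ ∈ Generated S
    resp : ∀ {g h} → g ≈ h → g ∈ Generated S → h ∈ Generated S

  HasCardinality : Pred Carrier p → ℕ → Set _
  HasCardinality H k =
    Inverse (On.setoid {B = ∃ H} setoid proj₁) (≡.setoid (Fin k))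

  open RawMonoidDefs rawMonoid public using ()
    renaming (_×_ to power; sum to prod)

  HasOrder : Carrier → ℕ → Set ℓ₁
  HasOrder g k = 0 ℕ.< k × power k g ≈ ε ×
                 (∀ {j} → 0 ℕ.< j → power j g ≈ ε → k ℕ.≤ j)

module _ {K : OrderedField c ℓ₁ ℓ₂} (E : EuclideanSpace K v ℓv) where
  private module K = OrderedField K
  open EuclideanSpace E

  record LinearAutomorphism : Set (c ⊔ v ⊔ ℓv) where
    field
      to        : Carrierᴹ → Carrierᴹ
      from      : Carrierᴹ → Carrierᴹ
      to-cong   : ∀ {x y} → x ≈ᴹ y → to x ≈ᴹ to y
      from-cong : ∀ {x y} → x ≈ᴹ y → from x ≈ᴹ from y
      to∘from   : ∀ x → to (from x) ≈ᴹ x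
      from∘to   : ∀ x → from (to x) ≈ᴹ x
      to-+      : ∀ x y → to (x +ᴹ y) ≈ᴹ to x +ᴹ to y
      to-*      : ∀ a x → to (a *ₗ x) ≈ᴹ a *ₗ to x

  private
    open LinearAutomorphism

    idᴸ : LinearAutomorphism
    idᴸ = record
      { to        = λ x → x
      ; from      = λ x → x
      ; to-cong   = λ eq → eq
      ; from-cong = λ eq → eq
      ; to∘from   = λ _ → ≈ᴹ-refl
      ; from∘to   = λ _ → ≈ᴹ-refl
      ; to-+      = λ _ _ → ≈ᴹ-refl
      ; to-*      = λ _ _ → ≈ᴹ-refl
      }

    _∘ᴸ_ : LinearAutomorphism → LinearAutomorphism → LinearAutomorphism
    f ∘ᴸ g = record
      { to        = to f ∘ to g
      ; from      = from g ∘ from f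
      ; to-cong   = to-cong f ∘ to-cong g
      ; from-cong = from-cong g ∘ from-cong f
      ; to∘from   = λ x → ≈ᴹ-trans (to-cong f (to∘from g _)) (to∘from f x)
      ; from∘to   = λ x → ≈ᴹ-trans (from-cong g (from∘to f _)) (from∘to g x)
      ; to-+      = λ x y → ≈ᴹ-trans (to-cong f (to-+ g x y)) (to-+ f _ _)
      ; to-*      = λ a x → ≈ᴹ-trans (to-cong f (to-* g a x)) (to-* f a _)
      }

    invᴸ : LinearAutomorphism → LinearAutomorphism
    invᴸ f = record
      { to        = from f
      ; from      = to f
      ; to-cong   = from-cong f
      ; from-cong = to-cong f
      ; to∘from   = from∘to f
      ; from∘to   = to∘from f
      ; to-+      = λ x y → ≈ᴹ-trans
          (from-cong f (≈ᴹ-sym (≈ᴹ-trans (to-+ f _ _)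
            (+ᴹ-cong (to∘from f x) (to∘from f y)))))
          (from∘to f _)
      ; to-*      = λ a x → ≈ᴹ-trans
          (from-cong f (≈ᴹ-sym (≈ᴹ-trans (to-* f a _)
            (*ₗ-cong K.refl (to∘from f x)))))
          (from∘to f _)
      }

  GL : Group (c ⊔ v ⊔ ℓv) (v ⊔ ℓv)
  GL = record
    { Carrier = LinearAutomorphism
    ; _≈_     = λ f g → ∀ x → to f x ≈ᴹ to g x
    ; _∙_     = _∘ᴸ_
    ; ε       = idᴸ
    ; _⁻¹     = invᴸ
    ; isGroup = record
      { isMonoid = record
        { isSemigroup = record
          { isMagma = record
            { isEquivalence = record
              { refl  = λ _ → ≈ᴹ-refl
              ; sym   = λ eq x → ≈ᴹ-sym (eq x)
              ; trans = λ eq₁ eq₂ x → ≈ᴹ-trans (eq₁ x) (eq₂ x)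
              }
            ; ∙-cong = λ {f} {f′} {g} {g′} eq₁ eq₂ x →
                ≈ᴹ-trans (to-cong f (eq₂ x)) (eq₁ (to g′ x))
            }
          ; assoc = λ _ _ _ _ → ≈ᴹ-refl
          }
        ; identity = (λ _ _ → ≈ᴹ-refl) , (λ _ _ → ≈ᴹ-refl)
        }
      ; inverse = (λ f → from∘to f) , (λ f → to∘from f)
      ; ⁻¹-cong = λ {f} {g} eq x → ≈ᴹ-trans
          (from-cong f (≈ᴹ-trans (≈ᴹ-sym (to∘from g x)) (≈ᴹ-sym (eq (from g x)))))
          (from∘to f (from g x))
      }
    }

  cartan : Carrierᴹ → Carrierᴹ → K.Carrier
  cartan x β = K.2# K.* ⟪ x , β ⟫ K.* ⟪ β , β ⟫ K.⁻¹

  reflect : Carrierᴹ → Carrierᴹ → Carrierᴹ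
  reflect β x = x +ᴹ -ᴹ (cartan x β *ₗ β)

  module _ where
    private
      module AG = AbelianGroupProps +ᴹ-abelianGroup
      module SP = SumProps +ᴹ-commutativeMonoid
      module CS = CommSemigroupProps (CommutativeMonoid.commutativeSemigroup +ᴹ-commutativeMonoid)

    -ᴹ≈-1*ₗ : ∀ x → -ᴹ x ≈ᴹ (K.- K.1#) *ₗ x
    -ᴹ≈-1*ₗ x = ≈ᴹ-sym (AG.inverseʳ-unique x _ (begin
      x +ᴹ (K.- K.1#) *ₗ x             ≈⟨ +ᴹ-congʳ (≈ᴹ-sym (*ₗ-identityˡ x)) ⟩
      K.1# *ₗ x +ᴹ (K.- K.1#) *ₗ x     ≈⟨ ≈ᴹ-sym (*ₗ-distribʳ x _ _) ⟩
      (K.1# K.+ K.- K.1#) *ₗ x         ≈⟨ *ₗ-cong (K.-‿inverseʳ _) ≈ᴹ-refl ⟩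
      K.0# *ₗ x                        ≈⟨ *ₗ-zeroˡ x ⟩
      0ᴹ                               ∎))
      where open ≈-Reasoning ≈ᴹ-setoid

    -ᴹ-*ₗ : ∀ a x → -ᴹ (a *ₗ x) ≈ᴹ (K.- a) *ₗ x
    -ᴹ-*ₗ a x = ≈ᴹ-trans (-ᴹ≈-1*ₗ _) (≈ᴹ-trans (≈ᴹ-sym (*ₗ-assoc _ a x))
      (*ₗ-cong (RingProps.-1*x≈-x K.ring a) ≈ᴹ-refl))

    *ₗ-ᴹ : ∀ a x → a *ₗ (-ᴹ x) ≈ᴹ -ᴹ (a *ₗ x)
    *ₗ-ᴹ a x = ≈ᴹ-trans (*ₗ-cong K.refl (-ᴹ≈-1*ₗ x))
      (≈ᴹ-trans (≈ᴹ-sym (*ₗ-assoc a _ x))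
      (≈ᴹ-trans (*ₗ-cong (K.trans (K.*-comm _ _) (RingProps.-1*x≈-x K.ring a)) ≈ᴹ-refl)
      (≈ᴹ-sym (-ᴹ-*ₗ a x))))

    cartan-congˡ : ∀ {x y} β → x ≈ᴹ y → cartan x β K.≈ cartan y β
    cartan-congˡ β eq = K.*-congʳ (K.*-congˡ (⟪⟫-cong eq ≈ᴹ-refl))

    cartan-+ : ∀ x y β → cartan (x +ᴹ y) β K.≈ cartan x β K.+ cartan y β
    cartan-+ x y β = K.trans
      (K.*-congʳ (K.trans (K.*-congˡ (⟪⟫-+ x y β)) (K.distribˡ _ _ _)))
      (K.distribʳ _ _ _)

    cartan-* : ∀ a x β → cartan (a *ₗ x) β K.≈ a K.* cartan x β
    cartan-* a x β = begin
      K.2# K.* ⟪ a *ₗ x , β ⟫ K.* i       ≈⟨ K.*-congʳ (K.*-congˡ (⟪⟫-* a x β)) ⟩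
      K.2# K.* (a K.* ⟪ x , β ⟫) K.* i    ≈⟨ K.*-congʳ (K.sym (K.*-assoc _ _ _)) ⟩
      K.2# K.* a K.* ⟪ x , β ⟫ K.* i      ≈⟨ K.*-congʳ (K.*-congʳ (K.*-comm _ _)) ⟩
      a K.* K.2# K.* ⟪ x , β ⟫ K.* i      ≈⟨ K.*-congʳ (K.*-assoc _ _ _) ⟩
      a K.* (K.2# K.* ⟪ x , β ⟫) K.* i    ≈⟨ K.*-assoc _ _ _ ⟩
      a K.* (K.2# K.* ⟪ x , β ⟫ K.* i)    ∎
      where
      open ≈-Reasoning K.setoid
      i = ⟪ β , β ⟫ K.⁻¹

    cartan-self : ∀ {β} → β ≉ᴹ 0ᴹ → cartan β β K.≈ K.2#
    cartan-self β≉0 = K.trans (K.*-assoc _ _ _) (K.trans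
      (K.*-congˡ (K.⁻¹-inverseʳ (β≉0 ∘ definite))) (K.*-identityʳ _))

    reflect-cong : ∀ β {x y} → x ≈ᴹ y → reflect β x ≈ᴹ reflect β y
    reflect-cong β eq =
      +ᴹ-cong eq (-ᴹ‿cong (*ₗ-cong (cartan-congˡ β eq) ≈ᴹ-refl))

    reflect-+ : ∀ β x y → reflect β (x +ᴹ y) ≈ᴹ reflect β x +ᴹ reflect β y
    reflect-+ β x y = begin
      (x +ᴹ y) +ᴹ -ᴹ (cartan (x +ᴹ y) β *ₗ β)
        ≈⟨ +ᴹ-congˡ (-ᴹ‿cong (≈ᴹ-trans (*ₗ-cong (cartan-+ x y β) ≈ᴹ-refl)
             (*ₗ-distribʳ β _ _))) ⟩
      (x +ᴹ y) +ᴹ -ᴹ (cartan x β *ₗ β +ᴹ cartan y β *ₗ β)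
        ≈⟨ +ᴹ-congˡ (≈ᴹ-sym (AG.⁻¹-∙-comm _ _)) ⟩
      (x +ᴹ y) +ᴹ (-ᴹ (cartan x β *ₗ β) +ᴹ -ᴹ (cartan y β *ₗ β))
        ≈⟨ CS.interchange x y _ _ ⟩
      reflect β x +ᴹ reflect β y ∎
      where
      open ≈-Reasoning ≈ᴹ-setoid

    reflect-* : ∀ β a x → reflect β (a *ₗ x) ≈ᴹ a *ₗ reflect β x
    reflect-* β a x = begin
      a *ₗ x +ᴹ -ᴹ (cartan (a *ₗ x) β *ₗ β)
        ≈⟨ +ᴹ-congˡ (-ᴹ‿cong (≈ᴹ-trans (*ₗ-cong (cartan-* a x β) ≈ᴹ-refl)
             (*ₗ-assoc _ _ _))) ⟩
      a *ₗ x +ᴹ -ᴹ (a *ₗ (cartan x β *ₗ β))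
        ≈⟨ +ᴹ-congˡ (≈ᴹ-sym (*ₗ-ᴹ a _)) ⟩
      a *ₗ x +ᴹ a *ₗ (-ᴹ (cartan x β *ₗ β))
        ≈⟨ ≈ᴹ-sym (*ₗ-distribˡ a _ _) ⟩
      a *ₗ reflect β x ∎
      where open ≈-Reasoning ≈ᴹ-setoid

    reflect-self : ∀ {β} → β ≉ᴹ 0ᴹ → reflect β β ≈ᴹ -ᴹ β
    reflect-self {β} β≉0 = begin
      β +ᴹ -ᴹ (cartan β β *ₗ β)  ≈⟨ +ᴹ-congˡ (-ᴹ‿cong 2β) ⟩
      β +ᴹ -ᴹ (β +ᴹ β)           ≈⟨ +ᴹ-congˡ (≈ᴹ-sym (AG.⁻¹-∙-comm β β)) ⟩
      β +ᴹ (-ᴹ β +ᴹ -ᴹ β)        ≈⟨ ≈ᴹ-sym (+ᴹ-assoc _ _ _) ⟩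
      (β +ᴹ -ᴹ β) +ᴹ -ᴹ β        ≈⟨ +ᴹ-congʳ (-ᴹ‿inverseʳ β) ⟩
      0ᴹ +ᴹ -ᴹ β                 ≈⟨ +ᴹ-identityˡ _ ⟩
      -ᴹ β                       ∎
      where
      open ≈-Reasoning ≈ᴹ-setoid
      2β : cartan β β *ₗ β ≈ᴹ β +ᴹ β
      2β = ≈ᴹ-trans (*ₗ-cong (cartan-self β≉0) ≈ᴹ-refl)
        (≈ᴹ-trans (*ₗ-distribʳ β _ _) (+ᴹ-cong (*ₗ-identityˡ β) (*ₗ-identityˡ β)))

    reflect-involutive : ∀ {β} → β ≉ᴹ 0ᴹ → ∀ x → reflect β (reflect β x) ≈ᴹ x
    reflect-involutive {β} β≉0 x = begin
      reflect β (x +ᴹ -ᴹ (k *ₗ β))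
        ≈⟨ reflect-+ β x _ ⟩
      reflect β x +ᴹ reflect β (-ᴹ (k *ₗ β))
        ≈⟨ +ᴹ-congˡ (reflect-cong β (≈ᴹ-sym (*ₗ-ᴹ k β))) ⟩
      reflect β x +ᴹ reflect β (k *ₗ (-ᴹ β))
        ≈⟨ +ᴹ-congˡ (reflect-* β k _) ⟩
      reflect β x +ᴹ k *ₗ reflect β (-ᴹ β)
        ≈⟨ +ᴹ-congˡ (*ₗ-cong K.refl reflect-neg) ⟩
      (x +ᴹ -ᴹ (k *ₗ β)) +ᴹ k *ₗ β
        ≈⟨ +ᴹ-assoc _ _ _ ⟩
      x +ᴹ (-ᴹ (k *ₗ β) +ᴹ k *ₗ β)
        ≈⟨ +ᴹ-congˡ (-ᴹ‿inverseˡ _) ⟩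
      x +ᴹ 0ᴹ
        ≈⟨ +ᴹ-identityʳ x ⟩
      x ∎
      where
      open ≈-Reasoning ≈ᴹ-setoid
      k = cartan x β
      reflect-neg : reflect β (-ᴹ β) ≈ᴹ β
      reflect-neg = begin
        reflect β (-ᴹ β)                  ≈⟨ reflect-cong β (-ᴹ≈-1*ₗ β) ⟩
        reflect β ((K.- K.1#) *ₗ β)       ≈⟨ reflect-* β _ β ⟩
        (K.- K.1#) *ₗ reflect β β         ≈⟨ *ₗ-cong K.refl (reflect-self β≉0) ⟩
        (K.- K.1#) *ₗ (-ᴹ β)              ≈⟨ ≈ᴹ-sym (-ᴹ≈-1*ₗ _) ⟩
        -ᴹ (-ᴹ β)                         ≈⟨ AG.⁻¹-involutive β ⟩
        β                                 ∎

    ∙ₗ-cong : ∀ {n} {a b : Fin n → K.Carrier} (e : Fin n → Carrierᴹ) →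
              (∀ i → a i K.≈ b i) → a ∙ₗ e ≈ᴹ b ∙ₗ e
    ∙ₗ-cong e eq = SP.sum-cong-≋ (λ i → *ₗ-cong (eq i) ≈ᴹ-refl)

    ∙ₗ-+ : ∀ {n} (a b : Fin n → K.Carrier) (e : Fin n → Carrierᴹ) →
           (λ i → a i K.+ b i) ∙ₗ e ≈ᴹ a ∙ₗ e +ᴹ b ∙ₗ e
    ∙ₗ-+ a b e = ≈ᴹ-trans (SP.sum-cong-≋ (λ i → *ₗ-distribʳ (e i) (a i) (b i)))
                          (SP.∑-distrib-+ (λ i → a i *ₗ e i) (λ i → b i *ₗ e i))

    ∙ₗ-* : ∀ {n} k (a : Fin n → K.Carrier) (e : Fin n → Carrierᴹ) →
           (λ i → k K.* a i) ∙ₗ e ≈ᴹ k *ₗ (a ∙ₗ e)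
    ∙ₗ-* {zero}  k a e = ≈ᴹ-sym (*ₗ-zeroʳ k)
    ∙ₗ-* {suc n} k a e = ≈ᴹ-trans
      (+ᴹ-cong (*ₗ-assoc _ _ _) (∙ₗ-* k (a ∘ Fin.suc) (e ∘ Fin.suc)))
      (≈ᴹ-sym (*ₗ-distribˡ k _ _))

    ∙ₗ-remove : ∀ {n} (i : Fin (suc n)) (a : Fin (suc n) → K.Carrier)
                (e : Fin (suc n) → Carrierᴹ) →
                a ∙ₗ e ≈ᴹ a i *ₗ e i +ᴹ (a ∘ punchIn i) ∙ₗ (e ∘ punchIn i)
    ∙ₗ-remove i a e = SP.sum-remove {i = i} (λ j → a j *ₗ e j)

  reflection : ∀ β → β ≉ᴹ 0ᴹ → LinearAutomorphism
  reflection β β≉0 = record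
    { to        = reflect β
    ; from      = reflect β
    ; to-cong   = reflect-cong β
    ; from-cong = reflect-cong β
    ; to∘from   = reflect-involutive β≉0
    ; from∘to   = reflect-involutive β≉0
    ; to-+      = reflect-+ β
    ; to-*      = reflect-* β
    }

-- Roots are not required to span the ambient space, so that a root
-- subsystem lives in the same space.
record RootSystem {K : OrderedField c ℓ₁ ℓ₂} (E : EuclideanSpace K v ℓv) p
                  : Set (c ⊔ ℓ₁ ⊔ v ⊔ ℓv ⊔ lsuc p) where
  private module K = OrderedField K
  open EuclideanSpace E
  field
    Root           : Pred Carrierᴹ p
    Root-resp      : ∀ {x y} → x ≈ᴹ y → x ∈ Root → y ∈ Root
    -- Classically the same as finiteness of Root; the list e may
    -- contain vectors that are not roots.
    finite         : Σ[ N ∈ ℕ ] Σ[ e ∈ (Fin N → Carrierᴹ) ]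
                       (∀ {β} → β ∈ Root → ∃ λ i → β ≈ᴹ e i)
    nonzero        : ∀ {β} → β ∈ Root → β ≉ᴹ 0ᴹ
    reduced        : ∀ {β a} → β ∈ Root → a *ₗ β ∈ Root →
                     a K.≈ K.1# ⊎ a K.≈ K.- K.1#
    reflect-closed : ∀ {β γ} → β ∈ Root → γ ∈ Root → reflect E β γ ∈ Root
    integral       : ∀ {β γ} → β ∈ Root → γ ∈ Root →
                     ∃ λ k → cartan E γ β K.≈ K.fromℤ k

record SimpleSystem {K : OrderedField c ℓ₁ ℓ₂} {E : EuclideanSpace K v ℓv}
                    (Φ : RootSystem E p) (n : ℕ)
                    : Set (c ⊔ ℓ₁ ⊔ v ⊔ ℓv ⊔ p) where
  private module K = OrderedField K
  open EuclideanSpace E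
  open RootSystem Φ
  field
    simple      : Fin n → Carrierᴹ
    simple-root : ∀ i → simple i ∈ Root
    independent : ∀ a → a ∙ₗ simple ≈ᴹ 0ᴹ → ∀ i → a i K.≈ K.0#
    expansion   : ∀ {β} → β ∈ Root → Σ[ k ∈ (Fin n → ℤ) ]
                    (β ≈ᴹ (K.fromℤ ∘ k) ∙ₗ simple) ×
                    ((∀ i → 0ℤ ℤ.≤ k i) ⊎ (∀ i → k i ℤ.≤ 0ℤ))

  s : Fin n → LinearAutomorphism E
  s i = reflection E (simple i) (nonzero (simple-root i))

module _ {K : OrderedField c ℓ₁ ℓ₂} {E : EuclideanSpace K v ℓv} where
  private module K = OrderedField K
  open EuclideanSpace E

  data GeneratedRoot {r} (S : Fin r → Carrierᴹ) : Pred Carrierᴹ (v ⊔ ℓv) where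
    base : ∀ {x} i → x ≈ᴹ S i → x ∈ GeneratedRoot S
    step : ∀ {x β γ} → β ∈ GeneratedRoot S → γ ∈ GeneratedRoot S →
           x ≈ᴹ reflect E β γ → x ∈ GeneratedRoot S

  module _ {Φ : RootSystem E p} {r : ℕ} (Π : SimpleSystem Φ (suc r))
           (α : Fin (suc r)) where
    open RootSystem Φ
    open SimpleSystem Π

    others : Fin r → Carrierᴹ
    others = simple ∘ punchIn α

    generated⇒root : ∀ {x} → x ∈ GeneratedRoot others → x ∈ Root
    generated⇒root (base i eq)   = Root-resp (≈ᴹ-sym eq) (simple-root _)
    generated⇒root (step β γ eq) = Root-resp (≈ᴹ-sym eq)
      (reflect-closed (generated⇒root β) (generated⇒root γ))

    subsystem : RootSystem E (v ⊔ ℓv)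
    subsystem = record
      { Root           = GeneratedRoot others
      ; Root-resp      = generated-resp
      ; finite         = proj₁ finite , proj₁ (proj₂ finite) ,
                         λ x → proj₂ (proj₂ finite) (generated⇒root x)
      ; nonzero        = λ x → nonzero (generated⇒root x)
      ; reduced        = λ x y → reduced (generated⇒root x) (generated⇒root y)
      ; reflect-closed = λ x y → step x y ≈ᴹ-refl
      ; integral       = λ x y → integral (generated⇒root x) (generated⇒root y)
      }
      where
      generated-resp : ∀ {x y} → x ≈ᴹ y →
                       x ∈ GeneratedRoot others → y ∈ GeneratedRoot others
      generated-resp eq (base i x≈)   = base i (≈ᴹ-trans (≈ᴹ-sym eq) x≈)
      generated-resp eq (step β γ x≈) = step β γ (≈ᴹ-trans (≈ᴹ-sym eq) x≈)

    private
      module AG = AbelianGroupProps +ᴹ-abelianGroup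

      δ : ∀ {n} → Fin n → Fin n → K.Carrier
      δ Fin.zero    Fin.zero    = K.1#
      δ Fin.zero    (Fin.suc _) = K.0#
      δ (Fin.suc _) Fin.zero    = K.0#
      δ (Fin.suc i) (Fin.suc j) = δ i j

      0∙ₗ : ∀ {n} (e : Fin n → Carrierᴹ) → (λ _ → K.0#) ∙ₗ e ≈ᴹ 0ᴹ
      0∙ₗ e = ≈ᴹ-trans (∙ₗ-cong E e (λ _ → K.sym (K.zeroˡ K.0#)))
        (≈ᴹ-trans (∙ₗ-* E K.0# (λ _ → K.0#) e) (*ₗ-zeroˡ _))

      δ∙ₗ : ∀ {n} (e : Fin n → Carrierᴹ) i → δ i ∙ₗ e ≈ᴹ e i
      δ∙ₗ e Fin.zero    = ≈ᴹ-trans (+ᴹ-cong (*ₗ-identityˡ _) (0∙ₗ (e ∘ Fin.suc)))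
                                   (+ᴹ-identityʳ _)
      δ∙ₗ e (Fin.suc i) = ≈ᴹ-trans (+ᴹ-cong (*ₗ-zeroˡ _) (δ∙ₗ (e ∘ Fin.suc) i))
                                   (+ᴹ-identityˡ _)

      in-span : ∀ {x} → x ∈ GeneratedRoot others → ∃ λ a → x ≈ᴹ a ∙ₗ others
      in-span (base i eq) = δ i , ≈ᴹ-trans eq (≈ᴹ-sym (δ∙ₗ others i))
      in-span (step {x} {β} {γ} gβ gγ eq) with in-span gβ | in-span gγ
      ... | a , β≈ | b , γ≈ = (λ i → b i K.+ k K.* a i) , (begin
        x                                       ≈⟨ eq ⟩
        γ +ᴹ -ᴹ (cartan E γ β *ₗ β)             ≈⟨ +ᴹ-congˡ (-ᴹ-*ₗ E _ β) ⟩
        γ +ᴹ k *ₗ β                             ≈⟨ +ᴹ-cong γ≈ (*ₗ-cong K.refl β≈) ⟩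
        b ∙ₗ others +ᴹ k *ₗ (a ∙ₗ others)       ≈⟨ +ᴹ-congˡ (≈ᴹ-sym (∙ₗ-* E k a others)) ⟩
        b ∙ₗ others +ᴹ (λ i → k K.* a i) ∙ₗ others
                                                ≈⟨ ≈ᴹ-sym (∙ₗ-+ E b _ others) ⟩
        (λ i → b i K.+ k K.* a i) ∙ₗ others     ∎)
        where
        open ≈-Reasoning ≈ᴹ-setoid
        k = K.- cartan E γ β

      extend : (Fin r → K.Carrier) → K.Carrier → Fin (suc r) → K.Carrier
      extend a k = insertAt a α k

      extend∙ₗ : ∀ a k → extend a k ∙ₗ simple ≈ᴹ k *ₗ simple α +ᴹ a ∙ₗ others
      extend∙ₗ a k = ≈ᴹ-trans (∙ₗ-remove E α (extend a k) simple)
        (+ᴹ-cong (*ₗ-cong (K.reflexive (Vector.insertAt-lookup a α k)) ≈ᴹ-refl)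
                 (∙ₗ-cong E others (λ i →
                    K.reflexive (Vector.insertAt-punchIn a α k i))))

      -- The α-coefficient of a vector in the span of the other simple roots.
      coefficient-0 : ∀ (b : Fin (suc r) → K.Carrier) a →
                      b ∙ₗ simple ≈ᴹ a ∙ₗ others → b α K.≈ K.0#
      coefficient-0 b a eq = K.trans (K.sym (K.+-identityʳ _))
        (K.trans (K.+-congˡ (K.sym ext≈0)) (independent d d≈0 α))
        where
        open ≈-Reasoning ≈ᴹ-setoid
        k = K.- K.1#
        d : Fin (suc r) → K.Carrier
        d i = b i K.+ k K.* extend a K.0# i
        ext≈0 : k K.* extend a K.0# α K.≈ K.0#
        ext≈0 = K.trans (K.*-congˡ (K.reflexive (Vector.insertAt-lookup a α K.0#)))
                        (K.zeroʳ k)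
        d≈0 : d ∙ₗ simple ≈ᴹ 0ᴹ
        d≈0 = begin
          d ∙ₗ simple
            ≈⟨ ∙ₗ-+ E b (λ i → k K.* extend a K.0# i) simple ⟩
          b ∙ₗ simple +ᴹ (λ i → k K.* extend a K.0# i) ∙ₗ simple
            ≈⟨ +ᴹ-cong eq (∙ₗ-* E k (extend a K.0#) simple) ⟩
          a ∙ₗ others +ᴹ k *ₗ (extend a K.0# ∙ₗ simple)
            ≈⟨ +ᴹ-congˡ (*ₗ-cong K.refl (≈ᴹ-trans (extend∙ₗ a K.0#)
                 (≈ᴹ-trans (+ᴹ-congʳ (*ₗ-zeroˡ _)) (+ᴹ-identityˡ _)))) ⟩
          a ∙ₗ others +ᴹ k *ₗ (a ∙ₗ others)
            ≈⟨ +ᴹ-congˡ (≈ᴹ-sym (-ᴹ≈-1*ₗ E _)) ⟩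
          a ∙ₗ others +ᴹ -ᴹ (a ∙ₗ others)
            ≈⟨ -ᴹ‿inverseʳ _ ⟩
          0ᴹ ∎

    subsimple : SimpleSystem subsystem r
    subsimple = record
      { simple      = others
      ; simple-root = λ i → base i ≈ᴹ-refl
      ; independent = λ a eq i → K.trans
          (K.sym (K.reflexive (Vector.insertAt-punchIn a α K.0# i)))
          (independent (extend a K.0#)
            (≈ᴹ-trans (extend∙ₗ a K.0#) (≈ᴹ-trans
              (+ᴹ-cong (*ₗ-zeroˡ _) eq) (+ᴹ-identityˡ _)))
            (punchIn α i))
      ; expansion   = expand
      }
      where
      expand : ∀ {β} → β ∈ GeneratedRoot others → Σ[ k ∈ (Fin r → ℤ) ]
               (β ≈ᴹ (K.fromℤ ∘ k) ∙ₗ others) ×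
               ((∀ i → 0ℤ ℤ.≤ k i) ⊎ (∀ i → k i ℤ.≤ 0ℤ))
      expand {β} gβ with expansion (generated⇒root gβ) | in-span gβ
      ... | k , β≈ , sign | a , β≈′ = k ∘ punchIn α , β≈k , restrict sign
        where
        kα≈0 : K.fromℤ (k α) K.≈ K.0#
        kα≈0 = coefficient-0 (K.fromℤ ∘ k) a (≈ᴹ-trans (≈ᴹ-sym β≈) β≈′)
        β≈k : β ≈ᴹ (K.fromℤ ∘ k ∘ punchIn α) ∙ₗ others
        β≈k = ≈ᴹ-trans β≈ (≈ᴹ-trans (∙ₗ-remove E α (K.fromℤ ∘ k) simple)
          (≈ᴹ-trans (+ᴹ-congʳ (≈ᴹ-trans (*ₗ-cong kα≈0 ≈ᴹ-refl) (*ₗ-zeroˡ _)))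
                    (+ᴹ-identityˡ _)))
        restrict : (∀ i → 0ℤ ℤ.≤ k i) ⊎ (∀ i → k i ℤ.≤ 0ℤ) →
                   (∀ i → 0ℤ ℤ.≤ k (punchIn α i)) ⊎ (∀ i → k (punchIn α i) ℤ.≤ 0ℤ)
        restrict (inj₁ pos) = inj₁ (pos ∘ punchIn α)
        restrict (inj₂ neg) = inj₂ (neg ∘ punchIn α)

-- The vertices of the A-diagram and the D-diagram on n vertices are
-- numbered from 0; an edge is listed with its smaller endpoint first.
edgeA : (n i j : ℕ) → Bool
edgeA n i j = suc i ≡ᵇ j

-- The path 0 — 1 — ⋯ — (n - 2), and the further edge (n - 3) — (n - 1).
edgeD : (n i j : ℕ) → Bool
edgeD n i j = ((suc i ≡ᵇ j) ∧ (suc j <ᵇ n)) ∨ ((3 ℕ.+ i ≡ᵇ n) ∧ (suc j ≡ᵇ n))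

cartanMatrix : (edge : (n i j : ℕ) → Bool) → ∀ {n} → Fin n → Fin n → ℤ
cartanMatrix edge {n} i j =
  if toℕ i ≡ᵇ toℕ j then + 2
  else if edge n (toℕ i) (toℕ j) ∨ edge n (toℕ j) (toℕ i) then -1ℤ
  else 0ℤ

module _ {K : OrderedField c ℓ₁ ℓ₂} {E : EuclideanSpace K v ℓv}
         {Φ : RootSystem E p} {n : ℕ} (Π : SimpleSystem Φ n) where
  private module K = OrderedField K
  open EuclideanSpace E
  open SimpleSystem Π

  HasCartanMatrix : (Fin n → Fin n → ℤ) → Set ℓ₁
  HasCartanMatrix C = Σ[ σ ∈ Permutation′ n ] (∀ i j →
    cartan E (simple (σ ⟨$⟩ʳ i)) (simple (σ ⟨$⟩ʳ j)) K.≈ K.fromℤ (C i j))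

  TypeA : Set ℓ₁
  TypeA = 1 ℕ.≤ n × HasCartanMatrix (cartanMatrix edgeA)

  TypeD : Set ℓ₁
  TypeD = 4 ℕ.≤ n × HasCartanMatrix (cartanMatrix edgeD)

  Adjacent : Fin n → Fin n → Set ℓ₁
  Adjacent i j = i ≢ j × ⟪ simple i , simple j ⟫ K.≉ K.0#

  -- The single vertex of a one-vertex diagram counts as a leaf.
  IsLeaf : Fin n → Set ℓ₁
  IsLeaf i = ∀ {j k} → Adjacent i j → Adjacent i k → j ≡ k

  Ñ[_] : Fin n → Pred (Fin n) ℓ₁
  Ñ[ i ] j = ⟪ simple j , simple i ⟫ K.≉ K.0#

  W : Pred (Fin n) q → Pred (LinearAutomorphism E) _
  W X = Generated (GL E) (λ g → ∃ λ i → i ∉ X × g ≡ s i)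

  coxeterElement : Permutation′ n → LinearAutomorphism E
  coxeterElement π = prod (GL E) (λ i → s (π ⟨$⟩ʳ i))

  -- All orderings of Π give conjugate Coxeter elements, so demanding
  -- the same order h for every π is no restriction.
  IsCoxeterNumber : ℕ → Set (v ⊔ ℓv)
  IsCoxeterNumber h = ∀ π → HasOrder (GL E) (coxeterElement π) h

-- In a forest, any two orderings of the simple reflections have conjugate
-- products: peel off a leaf, move its reflection next to that of its neighbour
-- and treat the two as a single factor.  So one ordering decides the Coxeter
-- number.  It is read off the weights of a minuscule representation: the product
-- of the simple reflections is an (n + 1)-cycle on the weights of A n, while on
-- the weights ± ε p of D n it is a 2 (n - 1)-cycle together with a sign change of
-- the last coordinate.  An element of W is determined by its action on the
-- weights, because it is an isometry that fixes everything orthogonal to Π.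
--
-- The quotient of group orders is an index computed by orbit-stabilizer.  The
-- stabilizer of a minuscule fundamental weight is parabolic: by induction on the
-- height, all descending paths from a weight to the fundamental weight define
-- the same coset.  At an end of a path W_α has type A and the orbit has n
-- weights; at the tail of a fork it has type D and the orbit has 2 (n - 1); on a
-- branch of a fork, two steps in type A contribute n (n - 1), of which the
-- isolated node of Π ∖ Ñ[α] takes back a factor 2.

module Submission where

open import Defs
open import Algebra.Bundles using (Group)
import Algebra.Definitions.RawMonoid as RawMonoidDefs
import Algebra.Properties.AbelianGroup as AbelianGroupProps
import Algebra.Properties.Group as GroupProps
import Algebra.Properties.Ring as RingProps
open import Data.Bool.Properties using (∧-zeroʳ)
open import Data.Fin.Base as Fin
  using (Fin; zero; suc; combine; fromℕ; fromℕ<; inject₁; punchIn; remQuot; toℕ)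
open import Data.Fin.Induction using (<-weakInduction)
open import Data.Fin.Patterns using (0F; 1F)
open import Data.Fin.Permutation as Perm using (Permutation′; _⟨$⟩ʳ_; _⟨$⟩ˡ_; _∘ₚ_; flip)
import Data.Fin.Properties as Fin
open import Data.Fin.Relation.Unary.Top using (view; ‵fromℕ; ‵inject₁)
open import Data.Integer.Base as ℤ using (ℤ; +_)
import Data.Integer.Properties as ℤ
open import Data.List.Base using (List; []; _∷_; _++_; foldr; tabulate)
open import Data.List.Membership.Propositional.Properties using (∈-∃++; ∈-++⁻)
open import Data.List.Properties using (++-assoc; tabulate-cong)
open import Data.List.Relation.Binary.Permutation.Propositional
  using (_↭_; prep; swap; ↭-sym; ↭-refl; ↭-reflexive; ↭-trans)
open import Data.List.Relation.Binary.Permutation.Propositional.Properties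
  using (∈-resp-↭; All-resp-↭; drop-mid; shift; ↭-empty-inv; ↭-singleton-inv)
open import Data.List.Relation.Unary.All as All using (All; []; _∷_)
import Data.List.Relation.Unary.All.Properties as All
open import Data.List.Relation.Unary.Any using (here)
open import Data.Nat.Base as ℕ using (ℕ; zero; suc; NonZero; s≤s; z≤n)
import Data.Nat.Properties as ℕ
open import Data.Nat.Tactic.RingSolver using (solve-∀)
open import Data.Product.Base using (∃; ∃₂; Σ-syntax; _×_; _,_; proj₁; proj₂)
open import Data.Rational.Base as ℚ using (_/_; toℚᵘ)
import Data.Rational.Properties as ℚ
import Data.Rational.Unnormalised.Base as ℚᵘ
import Data.Rational.Unnormalised.Properties as ℚᵘ
open import Data.Sum.Base as Sum using (_⊎_; inj₁; inj₂; [_,_]′)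
open import Function.Base using (_∘_)
open import Function.Bundles using (Inverse; _↔_)
open import Function.Construct.Identity using (↔-id)
open import Function.Construct.Symmetry using (↔-sym)
open import Level using (Level; 0ℓ; _⊔_) renaming (suc to lsuc)
open import Relation.Binary.PropositionalEquality as ≡ using (_≡_; _≢_)
import Relation.Binary.Reasoning.Setoid as ≈-Reasoning
open import Relation.Nullary.Decidable using (yes; no)
open import Relation.Nullary.Negation using (¬_; contradiction)
open import Relation.Unary using (Pred; _∈_; _∉_; _⊆_)

-- Cardinalities are explicit bijections here, so every element of a group must be assigned its
-- coset by computation. The data at hand is its membership proof in `Generated`; the coset is
-- followed along it, generator by generator, and the distinctness of the weights shows that the
-- outcome does not depend on the proof. Minuscule weights make this feasible: a simple root pairs
-- with them to `M`, 0 or `- M` only, so each reflection fixes a weight or moves it along one edge,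
-- and comparing two paths takes just the commutation and braid relations. The factor `M` clears the
-- denominators of the fundamental weight, which becomes an integral combination of simple roots.
--
-- The work is done for families of vectors with prescribed Cartan integers instead of root systems:
-- subdiagrams are then subfamilies, a leaf placed at `zero` is removed by `b ∘ suc`, and D_2 and
-- D_3 count as forks, where the inductions can start. With n nodes, both sides of the identity are
-- 2 n at an end of a path, 4 (n - 1) at the tail of a fork and n (n - 1) on a branch.

private variable
  c ℓ₁ ℓ₂ v ℓv p q : Level

-- Rearrangements of tabulated lists

module _ {a} {A : Set a} where

  tabulate-punchIn-↭ : ∀ {n} (t : Fin (suc n) → A) i →
                       t i ∷ tabulate (t ∘ punchIn i) ↭ tabulate t
  tabulate-punchIn-↭         t zero    = ↭-refl
  tabulate-punchIn-↭ {suc n} t (suc i) = ↭-trans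
    (swap _ _ ↭-refl) (prep _ (tabulate-punchIn-↭ (t ∘ suc) i))

  tabulate-permute-↭ : ∀ {n} (t : Fin n → A) (π : Permutation′ n) →
                       tabulate (t ∘ (π ⟨$⟩ʳ_)) ↭ tabulate t
  tabulate-permute-↭ {zero}  t π = ↭-refl
  tabulate-permute-↭ {suc n} t π = ↭-trans
    (prep _ (↭-trans
      (↭-reflexive (tabulate-cong (≡.cong t ∘ Perm.punchIn-permute π zero)))
      (tabulate-permute-↭ (t ∘ punchIn (π ⟨$⟩ʳ zero)) (Perm.remove zero π))))
    (tabulate-punchIn-↭ t (π ⟨$⟩ʳ zero))

-- Conjugacy of Coxeter elements

module Conjugacy (G : Group c ℓ₁) where
  open Group G
  open GroupProps G using (∙-cancelʳ)
  open ≈-Reasoning setoid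

  product : List Carrier → Carrier
  product = foldr _∙_ ε

  Commute : Carrier → Carrier → Set ℓ₁
  Commute g h = g ∙ h ≈ h ∙ g

  commute-∙ : ∀ {g h k} → Commute g k → Commute h k → Commute (g ∙ h) k
  commute-∙ {g} {h} {k} gk hk = begin
    (g ∙ h) ∙ k  ≈⟨ assoc g h k ⟩
    g ∙ (h ∙ k)  ≈⟨ ∙-congˡ hk ⟩
    g ∙ (k ∙ h)  ≈⟨ sym (assoc g k h) ⟩
    (g ∙ k) ∙ h  ≈⟨ ∙-congʳ gk ⟩
    (k ∙ g) ∙ h  ≈⟨ assoc k g h ⟩
    k ∙ (g ∙ h)  ∎

  product-++ : ∀ A B → product (A ++ B) ≈ product A ∙ product B
  product-++ []      B = sym (identityˡ _)
  product-++ (a ∷ A) B = trans (∙-congˡ (product-++ A B)) (sym (assoc _ _ _))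

  commute-product : ∀ {g} L → All (Commute g) L → Commute g (product L)
  commute-product []      []         = trans (identityʳ _) (sym (identityˡ _))
  commute-product (h ∷ L) (gh ∷ gL) =
    sym (commute-∙ (sym gh) (sym (commute-product L gL)))

  infix 4 _~_
  -- Conjugacy with the inverse cleared: transitivity and powers then take little more than
  -- associativity.
  _~_ : Carrier → Carrier → Set (c ⊔ ℓ₁)
  a ~ b = ∃ λ x → x ∙ a ≈ b ∙ x

  ~-reflexive : ∀ {a b} → a ≈ b → a ~ b
  ~-reflexive eq = ε , trans (identityˡ _) (trans eq (sym (identityʳ _)))

  ~-sym : ∀ {a b} → a ~ b → b ~ a
  ~-sym {a} {b} (x , eq) = x ⁻¹ , (begin
    x ⁻¹ ∙ b                ≈⟨ ∙-congˡ (sym (identityʳ b)) ⟩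
    x ⁻¹ ∙ (b ∙ ε)          ≈⟨ ∙-congˡ (∙-congˡ (sym (inverseʳ x))) ⟩
    x ⁻¹ ∙ (b ∙ (x ∙ x ⁻¹)) ≈⟨ ∙-congˡ (sym (assoc _ _ _)) ⟩
    x ⁻¹ ∙ ((b ∙ x) ∙ x ⁻¹) ≈⟨ ∙-congˡ (∙-congʳ (sym eq)) ⟩
    x ⁻¹ ∙ ((x ∙ a) ∙ x ⁻¹) ≈⟨ ∙-congˡ (assoc _ _ _) ⟩
    x ⁻¹ ∙ (x ∙ (a ∙ x ⁻¹)) ≈⟨ sym (assoc _ _ _) ⟩
    (x ⁻¹ ∙ x) ∙ (a ∙ x ⁻¹) ≈⟨ ∙-congʳ (inverseˡ x) ⟩
    ε ∙ (a ∙ x ⁻¹)          ≈⟨ identityˡ _ ⟩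
    a ∙ x ⁻¹                ∎)

  ~-trans : ∀ {a b d} → a ~ b → b ~ d → a ~ d
  ~-trans {a} {b} {d} (x , p) (y , q) = y ∙ x , (begin
    (y ∙ x) ∙ a  ≈⟨ assoc _ _ _ ⟩
    y ∙ (x ∙ a)  ≈⟨ ∙-congˡ p ⟩
    y ∙ (b ∙ x)  ≈⟨ sym (assoc _ _ _) ⟩
    (y ∙ b) ∙ x  ≈⟨ ∙-congʳ q ⟩
    (d ∙ y) ∙ x  ≈⟨ assoc _ _ _ ⟩
    d ∙ (y ∙ x)  ∎)

  ~-rotate : ∀ a b → a ∙ b ~ b ∙ a
  ~-rotate a b = b , sym (assoc b a b)

  ~-power : ∀ {a b} ((x , _) : a ~ b) k → x ∙ power G k a ≈ power G k b ∙ x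
  ~-power (x , eq) zero = trans (identityʳ x) (sym (identityˡ x))
  ~-power {a} {b} (x , eq) (suc k) = begin
    x ∙ (a ∙ power G k a)  ≈⟨ sym (assoc _ _ _) ⟩
    (x ∙ a) ∙ power G k a  ≈⟨ ∙-congʳ eq ⟩
    (b ∙ x) ∙ power G k a  ≈⟨ assoc _ _ _ ⟩
    b ∙ (x ∙ power G k a)  ≈⟨ ∙-congˡ (~-power (x , eq) k) ⟩
    b ∙ (power G k b ∙ x)  ≈⟨ sym (assoc _ _ _) ⟩
    (b ∙ power G k b) ∙ x  ∎

  ~-power-ε : ∀ {a b} → a ~ b → ∀ {k} → power G k a ≈ ε → power G k b ≈ ε
  ~-power-ε (x , eq) {k} aᵏ≈ε = ∙-cancelʳ x _ _ (begin
    power G k _ ∙ x  ≈⟨ sym (~-power (x , eq) k) ⟩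
    x ∙ power G k _  ≈⟨ ∙-congˡ aᵏ≈ε ⟩
    x ∙ ε            ≈⟨ trans (identityʳ x) (sym (identityˡ x)) ⟩
    ε ∙ x            ∎)

  ~-order : ∀ {a b h} → a ~ b → HasOrder G a h → HasOrder G b h
  ~-order {h = h} a~b (0<h , aʰ≈ε , min) =
    0<h , ~-power-ε a~b {h} aʰ≈ε ,
    λ {j} 0<j bʲ≈ε → min 0<j (~-power-ε (~-sym a~b) {j} bʲ≈ε)

  OrderIrrelevant : List Carrier → Set (c ⊔ ℓ₁)
  OrderIrrelevant L = ∀ L′ → L′ ↭ L → product L′ ~ product L

  OrderIrrelevant-↭ : ∀ {L M} → L ↭ M → OrderIrrelevant L → OrderIrrelevant M
  OrderIrrelevant-↭ {L} {M} L↭M irr L′ L′↭M =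
    ~-trans (irr L′ (↭-trans L′↭M (↭-sym L↭M))) (~-sym (irr M (↭-sym L↭M)))

  -- A factor g commuting with everything but m can be moved next to m,
  -- after a rotation if it comes first.
  attach-leaf : ∀ {g m} L → All (Commute g) L → OrderIrrelevant (m ∙ g ∷ L) →
                OrderIrrelevant (g ∷ m ∷ L)
  attach-leaf {g} {m} L gL irr L′ L′↭ =
    ~-trans (merge L′ L′↭) (~-sym (merge (g ∷ m ∷ L) ↭-refl))
    where
    merge : ∀ L′ → L′ ↭ g ∷ m ∷ L → product L′ ~ product (m ∙ g ∷ L)
    merge L′ L′↭ with ∈-∃++ (∈-resp-↭ (↭-sym L′↭) (here ≡.refl))
    ... | A , B , ≡.refl
      with AB↭ ← drop-mid A [] L′↭
      with ∈-++⁻ A (∈-resp-↭ (↭-sym AB↭) (here ≡.refl))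
    ... | inj₁ m∈A with C , D , ≡.refl ← ∈-∃++ m∈A =
      ~-trans (~-reflexive (begin
          product ((C ++ m ∷ D) ++ g ∷ B)
            ≈⟨ trans (product-++ (C ++ m ∷ D) (g ∷ B)) (∙-congʳ (product-++ C _)) ⟩
          (product C ∙ (m ∙ product D)) ∙ (g ∙ product B)
            ≈⟨ trans (assoc _ _ _) (∙-congˡ (trans (assoc _ _ _) (∙-congˡ (sym (assoc _ _ _))))) ⟩
          product C ∙ (m ∙ ((product D ∙ g) ∙ product B))
            ≈⟨ ∙-congˡ (∙-congˡ (∙-congʳ (sym (commute-product D gD)))) ⟩
          product C ∙ (m ∙ ((g ∙ product D) ∙ product B))
            ≈⟨ ∙-congˡ (trans (∙-congˡ (assoc _ _ _)) (sym (assoc _ _ _))) ⟩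
          product C ∙ ((m ∙ g) ∙ (product D ∙ product B))
            ≈⟨ ∙-congˡ (∙-congˡ (sym (product-++ D B))) ⟩
          product C ∙ ((m ∙ g) ∙ product (D ++ B))
            ≈⟨ sym (product-++ C _) ⟩
          product (C ++ m ∙ g ∷ (D ++ B)) ∎))
        (irr _ (↭-trans (shift _ C (D ++ B)) (prep _ CDB↭)))
      where
      CDB↭ : C ++ D ++ B ↭ L
      CDB↭ = drop-mid C [] (↭-trans (↭-reflexive (≡.sym (++-assoc C (m ∷ D) B))) AB↭)
      gD : All (Commute g) D
      gD = All.++⁻ˡ D (All.++⁻ʳ C (All-resp-↭ (↭-sym CDB↭) gL))
    ... | inj₂ m∈B with C , D , ≡.refl ← ∈-∃++ m∈B =
      ~-trans (~-reflexive to-front) (~-trans (~-rotate g _)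
        (~-trans (~-reflexive to-m)
          (irr _ (↭-trans (shift _ (A ++ C) D) (prep _ ACD↭)))))
      where
      ACD↭ : (A ++ C) ++ D ↭ L
      ACD↭ = drop-mid (A ++ C) [] (↭-trans (↭-reflexive (++-assoc A C (m ∷ D))) AB↭)
      gACD : All (Commute g) ((A ++ C) ++ D)
      gACD = All-resp-↭ (↭-sym ACD↭) gL
      gA : All (Commute g) A
      gA = All.++⁻ˡ A (All.++⁻ˡ (A ++ C) gACD)
      gD : All (Commute g) D
      gD = All.++⁻ʳ (A ++ C) gACD
      to-front : product (A ++ g ∷ C ++ m ∷ D) ≈ g ∙ product ((A ++ C) ++ m ∷ D)
      to-front = begin
        product (A ++ g ∷ C ++ m ∷ D)
          ≈⟨ product-++ A _ ⟩
        product A ∙ (g ∙ product (C ++ m ∷ D))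
          ≈⟨ sym (assoc _ _ _) ⟩
        (product A ∙ g) ∙ product (C ++ m ∷ D)
          ≈⟨ ∙-congʳ (sym (commute-product A gA)) ⟩
        (g ∙ product A) ∙ product (C ++ m ∷ D)
          ≈⟨ trans (assoc _ _ _) (∙-congˡ (sym (product-++ A _))) ⟩
        g ∙ product (A ++ C ++ m ∷ D)
          ≡⟨ ≡.cong (λ z → g ∙ product z) (≡.sym (++-assoc A C (m ∷ D))) ⟩
        g ∙ product ((A ++ C) ++ m ∷ D) ∎
      to-m : product ((A ++ C) ++ m ∷ D) ∙ g ≈ product ((A ++ C) ++ m ∙ g ∷ D)
      to-m = begin
        product ((A ++ C) ++ m ∷ D) ∙ g
          ≈⟨ ∙-congʳ (product-++ (A ++ C) _) ⟩
        (product (A ++ C) ∙ (m ∙ product D)) ∙ g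
          ≈⟨ trans (assoc _ _ _) (∙-congˡ (assoc _ _ _)) ⟩
        product (A ++ C) ∙ (m ∙ (product D ∙ g))
          ≈⟨ ∙-congˡ (∙-congˡ (sym (commute-product D gD))) ⟩
        product (A ++ C) ∙ (m ∙ (g ∙ product D))
          ≈⟨ ∙-congˡ (sym (assoc _ _ _)) ⟩
        product (A ++ C) ∙ ((m ∙ g) ∙ product D)
          ≈⟨ sym (product-++ (A ++ C) _) ⟩
        product ((A ++ C) ++ m ∙ g ∷ D) ∎

  -- Only commutation at distance two or more is recorded. Nothing is asked of neighbours, which is
  -- why merging the first two factors gives a `Path` again.
  data Path : List Carrier → Set (c ⊔ ℓ₁) where
    []   : Path []
    [-]  : ∀ {g} → Path (g ∷ [])
    cons : ∀ {g h L} → All (Commute g) L → Path (h ∷ L) → Path (g ∷ h ∷ L)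

  path-merge : ∀ {g h L} → All (Commute g) L → Path (h ∷ L) → Path (h ∙ g ∷ L)
  path-merge []        [-]         = [-]
  path-merge (_ ∷ gL)  (cons hL p) = cons (All.zipWith (λ (x , y) → commute-∙ x y) (hL , gL)) p

  path-irrelevant : ∀ {L} → Path L → OrderIrrelevant L
  path-irrelevant []  L′ L′↭ = ~-reflexive (reflexive (≡.cong product (↭-empty-inv L′↭)))
  path-irrelevant [-] L′ L′↭ = ~-reflexive (reflexive (≡.cong product (↭-singleton-inv L′↭)))
  path-irrelevant {g ∷ h ∷ L} (cons gL p) = attach-leaf L gL (go L (path-merge gL p))
    where
    -- The merged list is not a sublist of the given one, so the recursion runs on `L` with an
    -- arbitrary head.
    go : ∀ {g} L → Path (g ∷ L) → OrderIrrelevant (g ∷ L)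
    go []      [-]         = path-irrelevant [-]
    go (_ ∷ L) (cons gL p) = attach-leaf L gL (go L (path-merge gL p))

  data Fork : List Carrier → Set (c ⊔ ℓ₁) where
    base : ∀ {g h k} → Commute h k → Fork (g ∷ h ∷ k ∷ [])
    cons : ∀ {g h L} → All (Commute g) L → Fork (h ∷ L) → Fork (g ∷ h ∷ L)

  fork-merge : ∀ {g h L} → All (Commute g) L → Fork (h ∷ L) → Fork (h ∙ g ∷ L)
  fork-merge _        (base hk)   = base hk
  fork-merge (_ ∷ gL) (cons hL p) = cons (All.zipWith (λ (x , y) → commute-∙ x y) (hL , gL)) p

  -- A fork of three factors becomes a path once its centre is moved between the two tips; a longer
  -- fork sheds its first factor as a path does.
  fork-irrelevant : ∀ {g} L → Fork (g ∷ L) → OrderIrrelevant (g ∷ L)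
  fork-irrelevant _ (base hk) =
    OrderIrrelevant-↭ (swap _ _ ↭-refl) (path-irrelevant (cons (hk ∷ []) (cons [] [-])))
  fork-irrelevant (h ∷ L) (cons gL p) = attach-leaf L gL (fork-irrelevant L (fork-merge gL p))

  prod≈product : ∀ {n} (t : Fin n → Carrier) → prod G t ≈ product (tabulate t)
  prod≈product {zero}  t = refl
  prod≈product {suc n} t = ∙-congˡ (prod≈product (t ∘ suc))

  order-permute : ∀ {n h} (t : Fin n → Carrier) → OrderIrrelevant (tabulate t) →
                  HasOrder G (prod G t) h →
                  ∀ (π : Permutation′ n) → HasOrder G (prod G (t ∘ (π ⟨$⟩ʳ_))) h
  order-permute t irr o π = ~-order (~-trans (~-reflexive (prod≈product t))
    (~-trans (~-sym (irr _ (tabulate-permute-↭ t π)))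
             (~-reflexive (sym (prod≈product (t ∘ (π ⟨$⟩ʳ_))))))) o

module _ {G : Group c ℓ₁} where
  open Group G

  generated-⊆ : {S : Pred Carrier p} {T : Pred Carrier q} →
                S ⊆ Generated G T → Generated G S ⊆ Generated G T
  generated-⊆ S⊆ (gen s)    = S⊆ s
  generated-⊆ S⊆ unit       = unit
  generated-⊆ S⊆ (mul x y)  = mul (generated-⊆ S⊆ x) (generated-⊆ S⊆ y)
  generated-⊆ S⊆ (inv x)    = inv (generated-⊆ S⊆ x)
  generated-⊆ S⊆ (resp e x) = resp e (generated-⊆ S⊆ x)

-- Arithmetic in an ordered field

module OrderedFieldProperties (K : OrderedField c ℓ₁ ℓ₂) where
  open OrderedField K
  open RingProps ring public
  open ≈-Reasoning setoid

  <⇒≉ : ∀ {x y} → x < y → x ≉ y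
  <⇒≉ x<y x≈y = <-irrefl x≈y x<y

  2≉0 : 2# ≉ 0#
  2≉0 2≈0 = <⇒≉ (0<suc 1) (sym (trans (+-congˡ (+-identityʳ 1#)) 2≈0))

  x+[-x]*2≈-x : ∀ x → x + (- x) * 2# ≈ - x
  x+[-x]*2≈-x x = begin
    x + (- x) * 2#             ≈⟨ +-congˡ (trans (distribˡ _ _ _) (+-cong (*-identityʳ _) (*-identityʳ _))) ⟩
    x + (- x + - x)            ≈⟨ sym (+-assoc _ _ _) ⟩
    (x + - x) + - x            ≈⟨ +-congʳ (-‿inverseʳ x) ⟩
    0# + - x                   ≈⟨ +-identityˡ _ ⟩
    - x                        ∎

  [-x]*[-1]≈x : ∀ x → (- x) * (- 1#) ≈ x
  [-x]*[-1]≈x x = begin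
    (- x) * (- 1#)  ≈⟨ sym (-‿distribˡ-* _ _) ⟩
    - (x * - 1#)    ≈⟨ -‿cong (sym (-‿distribʳ-* _ _)) ⟩
    - - (x * 1#)    ≈⟨ -‿involutive _ ⟩
    x * 1#          ≈⟨ *-identityʳ x ⟩
    x               ∎

  *-cancel-0 : ∀ {x y} → x ≉ 0# → x * y ≈ 0# → y ≈ 0#
  *-cancel-0 {x} {y} x≉0 xy≈0 = begin
    y               ≈⟨ sym (*-identityˡ y) ⟩
    1# * y          ≈⟨ *-congʳ (sym (trans (*-comm _ _) (⁻¹-inverseʳ x≉0))) ⟩
    (x ⁻¹ * x) * y  ≈⟨ *-assoc _ _ _ ⟩
    x ⁻¹ * (x * y)  ≈⟨ *-congˡ xy≈0 ⟩
    x ⁻¹ * 0#       ≈⟨ zeroʳ _ ⟩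
    0#              ∎

  neg<0 : ∀ {x} → 0# < x → - x < 0#
  neg<0 {x} 0<x = proj₁ <-resp-≈ (-‿inverseʳ x) (proj₂ <-resp-≈ (+-identityˡ _) (+-monoˡ-< (- x) 0<x))

  0<+ : ∀ {x y} → 0# < x → 0# < y → 0# < x + y
  0<+ {x} {y} 0<x 0<y = <-trans 0<y (proj₂ <-resp-≈ (+-identityˡ y) (+-monoˡ-< y 0<x))

-- Reflections and the groups they generate

module Reflections {K : OrderedField c ℓ₁ ℓ₂} (E : EuclideanSpace K v ℓv) where
  open OrderedField K hiding (zero)
  open OrderedFieldProperties K
  open EuclideanSpace E
  open LinearAutomorphism
  private
    module AG = AbelianGroupProps +ᴹ-abelianGroup
    module GL = Group (GL E)
    module ≈ᴹ = ≈-Reasoning ≈ᴹ-setoid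
  open ≈-Reasoning setoid

  -- Amounts to β being nonzero, in the form in which the diagonal of a Cartan matrix supplies it.
  Root : Carrierᴹ → Set ℓ₁
  Root β = cartan E β β ≈ 2#

  infix 4 _⊥_
  -- Both Cartan integers are kept, so that either relation is reversed by swapping the components.
  -- `Adj` is a simple bond.
  _⊥_ Adj : Carrierᴹ → Carrierᴹ → Set ℓ₁
  β ⊥ γ   = cartan E β γ ≈ 0# × cartan E γ β ≈ 0#
  Adj β γ = cartan E β γ ≈ - 1# × cartan E γ β ≈ - 1#

  cartan-0ᴹ : ∀ β → cartan E 0ᴹ β ≈ 0#
  cartan-0ᴹ β = begin
    cartan E 0ᴹ β           ≈⟨ cartan-congˡ E β (≈ᴹ-sym (*ₗ-zeroˡ 0ᴹ)) ⟩
    cartan E (0# *ₗ 0ᴹ) β   ≈⟨ cartan-* E 0# 0ᴹ β ⟩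
    0# * cartan E 0ᴹ β      ≈⟨ zeroˡ _ ⟩
    0#                      ∎

  cartan-neg : ∀ x β → cartan E (-ᴹ x) β ≈ - cartan E x β
  cartan-neg x β = begin
    cartan E (-ᴹ x) β          ≈⟨ cartan-congˡ E β (-ᴹ≈-1*ₗ E x) ⟩
    cartan E ((- 1#) *ₗ x) β   ≈⟨ cartan-* E (- 1#) x β ⟩
    - 1# * cartan E x β        ≈⟨ -1*x≈-x _ ⟩
    - cartan E x β             ∎

  root≉0 : ∀ {β} → Root β → β ≉ᴹ 0ᴹ
  root≉0 {β} root β≈0 =
    2≉0 (trans (sym root) (trans (cartan-congˡ E β β≈0) (cartan-0ᴹ β)))

  reflect-value : ∀ {β x k} → cartan E x β ≈ k → reflect E β x ≈ᴹ x +ᴹ (- k) *ₗ β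
  reflect-value {β} eq = +ᴹ-congˡ (≈ᴹ-trans (-ᴹ-*ₗ E _ β) (*ₗ-cong (-‿cong eq) ≈ᴹ-refl))

  reflect-fix : ∀ {β x} → cartan E x β ≈ 0# → reflect E β x ≈ᴹ x
  reflect-fix {β} {x} eq = ≈ᴹ.begin
    reflect E β x        ≈ᴹ.≈⟨ reflect-value eq ⟩
    x +ᴹ (- 0#) *ₗ β     ≈ᴹ.≈⟨ +ᴹ-congˡ (*ₗ-cong -0#≈0# ≈ᴹ-refl) ⟩
    x +ᴹ 0# *ₗ β         ≈ᴹ.≈⟨ +ᴹ-congˡ (*ₗ-zeroˡ β) ⟩
    x +ᴹ 0ᴹ              ≈ᴹ.≈⟨ +ᴹ-identityʳ x ⟩
    x                    ≈ᴹ.∎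

  cartan-reflect : ∀ {β γ k} x → cartan E β γ ≈ k →
                   cartan E (reflect E β x) γ ≈ cartan E x γ + (- cartan E x β) * k
  cartan-reflect {β} {γ} {k} x eq = begin
    cartan E (reflect E β x) γ
      ≈⟨ cartan-congˡ E γ (reflect-value refl) ⟩
    cartan E (x +ᴹ (- cartan E x β) *ₗ β) γ
      ≈⟨ cartan-+ E x _ γ ⟩
    cartan E x γ + cartan E ((- cartan E x β) *ₗ β) γ
      ≈⟨ +-congˡ (trans (cartan-* E _ β γ) (*-congˡ eq)) ⟩
    cartan E x γ + (- cartan E x β) * k ∎

  cartan-reflect-⊥ : ∀ {β γ} x → β ⊥ γ → cartan E (reflect E β x) γ ≈ cartan E x γ
  cartan-reflect-⊥ x (eq , _) =
    trans (cartan-reflect x eq) (trans (+-congˡ (zeroʳ _)) (+-identityʳ _))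

  cartan-reflect-adj : ∀ {β γ} x → Adj β γ →
                       cartan E (reflect E β x) γ ≈ cartan E x γ + cartan E x β
  cartan-reflect-adj x (eq , _) =
    trans (cartan-reflect x eq) (+-congˡ ([-x]*[-1]≈x _))

  cartan-reflect-self : ∀ {β} x → Root β → cartan E (reflect E β x) β ≈ - cartan E x β
  cartan-reflect-self x root = trans (cartan-reflect x root) (x+[-x]*2≈-x _)

  reflect-comm : ∀ {β γ} → β ⊥ γ → ∀ x →
                 reflect E β (reflect E γ x) ≈ᴹ reflect E γ (reflect E β x)
  reflect-comm {β} {γ} β⊥γ@(p , q) x = ≈ᴹ.begin
    reflect E β (reflect E γ x)
      ≈ᴹ.≈⟨ reflect-value (cartan-reflect-⊥ x (q , p)) ⟩
    reflect E γ x +ᴹ (- b) *ₗ β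
      ≈ᴹ.≈⟨ +ᴹ-congʳ (reflect-value refl) ⟩
    (x +ᴹ (- a) *ₗ γ) +ᴹ (- b) *ₗ β
      ≈ᴹ.≈⟨ ≈ᴹ-trans (+ᴹ-assoc x _ _) (≈ᴹ-trans (+ᴹ-congˡ (+ᴹ-comm _ _)) (≈ᴹ-sym (+ᴹ-assoc x _ _))) ⟩
    (x +ᴹ (- b) *ₗ β) +ᴹ (- a) *ₗ γ
      ≈ᴹ.≈⟨ +ᴹ-congʳ (reflect-value refl) ⟨
    reflect E β x +ᴹ (- a) *ₗ γ
      ≈ᴹ.≈⟨ reflect-value (cartan-reflect-⊥ x β⊥γ) ⟨
    reflect E γ (reflect E β x) ≈ᴹ.∎
    where
    a = cartan E x γ
    b = cartan E x β

  -- Both sides of the braid relation are the reflection in β + γ.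
  reflect-triple : ∀ {β γ} → Root β → Adj β γ → ∀ x →
    let t = - (cartan E x β + cartan E x γ) in
    reflect E β (reflect E γ (reflect E β x)) ≈ᴹ x +ᴹ (t *ₗ β +ᴹ t *ₗ γ)
  reflect-triple {β} {γ} root adj@(p , q) x = ≈ᴹ.begin
    reflect E β (reflect E γ (reflect E β x))
      ≈ᴹ.≈⟨ reflect-value cart ⟩
    reflect E γ (reflect E β x) +ᴹ (- b) *ₗ β
      ≈ᴹ.≈⟨ +ᴹ-congʳ (reflect-value (trans (cartan-reflect-adj x adj) (+-comm _ _))) ⟩
    (reflect E β x +ᴹ t *ₗ γ) +ᴹ (- b) *ₗ β
      ≈ᴹ.≈⟨ +ᴹ-congʳ (+ᴹ-congʳ (reflect-value refl)) ⟩
    ((x +ᴹ (- a) *ₗ β) +ᴹ t *ₗ γ) +ᴹ (- b) *ₗ β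
      ≈ᴹ.≈⟨ ≈ᴹ-trans (+ᴹ-assoc _ _ _) (≈ᴹ-trans (+ᴹ-congˡ (+ᴹ-comm _ _)) (≈ᴹ-sym (+ᴹ-assoc _ _ _))) ⟩
    ((x +ᴹ (- a) *ₗ β) +ᴹ (- b) *ₗ β) +ᴹ t *ₗ γ
      ≈ᴹ.≈⟨ +ᴹ-congʳ (≈ᴹ-trans (+ᴹ-assoc _ _ _) (+ᴹ-congˡ (≈ᴹ-sym (*ₗ-distribʳ β _ _)))) ⟩
    (x +ᴹ (- a + - b) *ₗ β) +ᴹ t *ₗ γ
      ≈ᴹ.≈⟨ +ᴹ-congʳ (+ᴹ-congˡ (*ₗ-cong (-‿+-comm a b) ≈ᴹ-refl)) ⟩
    (x +ᴹ t *ₗ β) +ᴹ t *ₗ γ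
      ≈ᴹ.≈⟨ +ᴹ-assoc _ _ _ ⟩
    x +ᴹ (t *ₗ β +ᴹ t *ₗ γ) ≈ᴹ.∎
    where
    a = cartan E x β
    b = cartan E x γ
    t = - (a + b)
    cart : cartan E (reflect E γ (reflect E β x)) β ≈ b
    cart = begin
      cartan E (reflect E γ (reflect E β x)) β
        ≈⟨ cartan-reflect-adj _ (q , p) ⟩
      cartan E (reflect E β x) β + cartan E (reflect E β x) γ
        ≈⟨ +-cong (cartan-reflect-self x root) (trans (cartan-reflect-adj x adj) (+-comm b a)) ⟩
      - a + (a + b)
        ≈⟨ trans (sym (+-assoc _ _ _)) (trans (+-congʳ (-‿inverseˡ a)) (+-identityˡ b)) ⟩
      b ∎

  reflect-braid : ∀ {β γ} → Root β → Root γ → Adj β γ → ∀ x →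
    reflect E β (reflect E γ (reflect E β x)) ≈ᴹ
    reflect E γ (reflect E β (reflect E γ x))
  reflect-braid rβ rγ adj@(p , q) x = ≈ᴹ-trans (reflect-triple rβ adj x)
    (≈ᴹ-trans (+ᴹ-congˡ (≈ᴹ-trans (+ᴹ-comm _ _) (+ᴹ-cong eq eq)))
              (≈ᴹ-sym (reflect-triple rγ (q , p) x)))
    where
    eq : ∀ {y} → _ *ₗ y ≈ᴹ _ *ₗ y
    eq = *ₗ-cong (-‿cong (+-comm _ _)) ≈ᴹ-refl

  ⟪⟫-+ʳ : ∀ x y z → ⟪ x , y +ᴹ z ⟫ ≈ ⟪ x , y ⟫ + ⟪ x , z ⟫
  ⟪⟫-+ʳ x y z = trans (⟪⟫-sym x _) (trans (⟪⟫-+ y z x) (+-cong (⟪⟫-sym y x) (⟪⟫-sym z x)))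

  ⟪⟫-*ʳ : ∀ a x y → ⟪ x , a *ₗ y ⟫ ≈ a * ⟪ x , y ⟫
  ⟪⟫-*ʳ a x y = trans (⟪⟫-sym x _) (trans (⟪⟫-* a y x) (*-congˡ (⟪⟫-sym y x)))

  ⟪⟫-neg : ∀ x y → ⟪ -ᴹ x , y ⟫ ≈ - ⟪ x , y ⟫
  ⟪⟫-neg x y = trans (⟪⟫-cong (-ᴹ≈-1*ₗ E x) ≈ᴹ-refl) (trans (⟪⟫-* _ x y) (-1*x≈-x _))

  -- The terms subtracted on the two sides are ⟪ x , β ⟫ and ⟪ y , β ⟫ multiplied together with the
  -- same factor `2# * i`. With involutivity this makes reflections isometries.
  reflect-self-adjoint : ∀ β x y → ⟪ reflect E β x , y ⟫ ≈ ⟪ x , reflect E β y ⟫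
  reflect-self-adjoint β x y = begin
    ⟪ reflect E β x , y ⟫
      ≈⟨ ⟪⟫-cong (reflect-value refl) ≈ᴹ-refl ⟩
    ⟪ x +ᴹ (- cartan E x β) *ₗ β , y ⟫
      ≈⟨ trans (⟪⟫-+ x _ y) (+-congˡ (trans (⟪⟫-* _ β y) (sym (-‿distribˡ-* _ _)))) ⟩
    ⟪ x , y ⟫ + - (cartan E x β * ⟪ β , y ⟫)
      ≈⟨ +-congˡ (-‿cong exchange) ⟩
    ⟪ x , y ⟫ + - (cartan E y β * ⟪ x , β ⟫)
      ≈⟨ trans (⟪⟫-+ʳ x y _) (+-congˡ (trans (⟪⟫-*ʳ _ x β) (sym (-‿distribˡ-* _ _)))) ⟨
    ⟪ x , y +ᴹ (- cartan E y β) *ₗ β ⟫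
      ≈⟨ ⟪⟫-cong ≈ᴹ-refl (reflect-value refl) ⟨
    ⟪ x , reflect E β y ⟫ ∎
    where
    i = ⟪ β , β ⟫ ⁻¹
    exchange : (2# * ⟪ x , β ⟫ * i) * ⟪ β , y ⟫ ≈ (2# * ⟪ y , β ⟫ * i) * ⟪ x , β ⟫
    exchange = begin
      (2# * ⟪ x , β ⟫ * i) * ⟪ β , y ⟫    ≈⟨ trans (*-congʳ (trans (*-assoc _ _ _) (trans (*-congˡ (*-comm _ _)) (sym (*-assoc _ _ _))))) (*-assoc _ _ _) ⟩
      (2# * i) * (⟪ x , β ⟫ * ⟪ β , y ⟫)  ≈⟨ *-congˡ (trans (*-comm _ _) (*-congʳ (⟪⟫-sym β y))) ⟩
      (2# * i) * (⟪ y , β ⟫ * ⟪ x , β ⟫)  ≈⟨ trans (*-congʳ (trans (*-assoc _ _ _) (trans (*-congˡ (*-comm _ _)) (sym (*-assoc _ _ _))))) (*-assoc _ _ _) ⟨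
      (2# * ⟪ y , β ⟫ * i) * ⟪ x , β ⟫    ∎

  module _ {i} {I : Set i} where

    -- Generators are recognised by their action, so the group depends on the vectors alone and not
    -- on a root system or on proofs that they are nonzero.
    ReflectionGroup : (I → Carrierᴹ) → Pred (LinearAutomorphism E) _
    ReflectionGroup b = Generated (GL E) (λ g → ∃ λ i → ∀ x → to g x ≈ᴹ reflect E (b i) x)

    Roots : (I → Carrierᴹ) → Set _
    Roots b = ∀ i → Root (b i)

    reflections : ∀ {b} → Roots b → I → LinearAutomorphism E
    reflections roots i = reflection E _ (root≉0 (roots i))

    module _ {b : I → Carrierᴹ} where

      group-fix : ∀ {g x} → g ∈ ReflectionGroup b → (∀ i → cartan E x (b i) ≈ 0#) → to g x ≈ᴹ x
      group-fix (gen (i , eq)) x⊥ = ≈ᴹ-trans (eq _) (reflect-fix (x⊥ i))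
      group-fix unit x⊥ = ≈ᴹ-refl
      group-fix (mul {g} p q) x⊥ = ≈ᴹ-trans (to-cong g (group-fix q x⊥)) (group-fix p x⊥)
      group-fix (inv {g} p) x⊥ = ≈ᴹ-trans (from-cong g (≈ᴹ-sym (group-fix p x⊥))) (from∘to g _)
      group-fix (resp eq p) x⊥ = ≈ᴹ-trans (≈ᴹ-sym (eq _)) (group-fix p x⊥)

      module _ (roots : Roots b) where

        reflect² : ∀ i x → reflect E (b i) (reflect E (b i) x) ≈ᴹ x
        reflect² i = reflect-involutive E (root≉0 (roots i))

        group-isometry : ∀ {g} → g ∈ ReflectionGroup b → ∀ x y → ⟪ to g x , to g y ⟫ ≈ ⟪ x , y ⟫
        group-isometry {g} (gen (i , eq)) x y = begin
          ⟪ to g x , to g y ⟫                            ≈⟨ ⟪⟫-cong (eq x) (eq y) ⟩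
          ⟪ reflect E (b i) x , reflect E (b i) y ⟫      ≈⟨ reflect-self-adjoint (b i) x _ ⟩
          ⟪ x , reflect E (b i) (reflect E (b i) y) ⟫    ≈⟨ ⟪⟫-cong ≈ᴹ-refl (reflect² i y) ⟩
          ⟪ x , y ⟫                                      ∎
        group-isometry unit x y = refl
        group-isometry (mul p q) x y = trans (group-isometry p _ _) (group-isometry q x y)
        group-isometry (inv {g} p) x y = trans (sym (group-isometry p _ _))
          (⟪⟫-cong (to∘from g x) (to∘from g y))
        group-isometry (resp eq p) x y =
          trans (⟪⟫-cong (≈ᴹ-sym (eq x)) (≈ᴹ-sym (eq y))) (group-isometry p x y)

        -- The displacement u = g x - x is orthogonal to every e p, hence to
        -- every b i, so g fixes u and ⟪ u , u ⟫ = ⟪ g x , g u ⟫ - ⟪ x , u ⟫ = 0.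
        group-faithful : ∀ {j} {J : Set j} {e : J → Carrierᴹ} →
          (∀ y → (∀ p → ⟪ y , e p ⟫ ≈ 0#) → ∀ i → ⟪ y , b i ⟫ ≈ 0#) →
          ∀ {g} → g ∈ ReflectionGroup b → (∀ p → to g (e p) ≈ᴹ e p) → ∀ x → to g x ≈ᴹ x
        group-faithful {e = e} spans {g} g∈ g-fix x =
          AG.x∙y⁻¹≈ε⇒x≈y _ _ (definite (begin
            ⟪ u , u ⟫                            ≈⟨ ⟪⟫-diff u ⟩
            ⟪ to g x , u ⟫ + - ⟪ x , u ⟫         ≈⟨ +-congʳ (⟪⟫-cong ≈ᴹ-refl (≈ᴹ-sym gu≈u)) ⟩
            ⟪ to g x , to g u ⟫ + - ⟪ x , u ⟫    ≈⟨ +-congʳ (group-isometry g∈ x u) ⟩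
            ⟪ x , u ⟫ + - ⟪ x , u ⟫              ≈⟨ -‿inverseʳ _ ⟩
            0#                                   ∎))
          where
          u = to g x +ᴹ -ᴹ x
          ⟪⟫-diff : ∀ y → ⟪ u , y ⟫ ≈ ⟪ to g x , y ⟫ + - ⟪ x , y ⟫
          ⟪⟫-diff y = trans (⟪⟫-+ _ _ y) (+-congˡ (⟪⟫-neg x y))
          u⊥e : ∀ p → ⟪ u , e p ⟫ ≈ 0#
          u⊥e p = begin
            ⟪ u , e p ⟫                            ≈⟨ ⟪⟫-diff (e p) ⟩
            ⟪ to g x , e p ⟫ + - ⟪ x , e p ⟫       ≈⟨ +-congʳ (⟪⟫-cong ≈ᴹ-refl (≈ᴹ-sym (g-fix p))) ⟩
            ⟪ to g x , to g (e p) ⟫ + - ⟪ x , e p ⟫ ≈⟨ +-congʳ (group-isometry g∈ x (e p)) ⟩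
            ⟪ x , e p ⟫ + - ⟪ x , e p ⟫            ≈⟨ -‿inverseʳ _ ⟩
            0#                                     ∎
          gu≈u : to g u ≈ᴹ u
          gu≈u = group-fix g∈ (λ i → trans (*-congʳ (trans (*-congˡ (spans u u⊥e i)) (zeroʳ _))) (zeroˡ _))

        -- Inverses need no separate hypothesis, the generators being involutions.
        group-act : ∀ {r} {P : Pred (LinearAutomorphism E) r} →
          (∀ {g h} → g GL.≈ h → g ∈ P → h ∈ P) →
          (∀ i {g} → g ∈ P → reflections roots i GL.∙ g ∈ P) →
          ∀ {g h} → g ∈ ReflectionGroup b → h ∈ P → g GL.∙ h ∈ P × g GL.⁻¹ GL.∙ h ∈ P
        group-act P-resp P-act (gen {g} (i , eq)) h∈ =
          P-resp (λ x → ≈ᴹ-sym (eq _)) (P-act i h∈) ,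
          P-resp (λ x → ≈ᴹ-trans (≈ᴹ-sym (from∘to g _))
            (from-cong g (≈ᴹ-trans (eq _) (reflect² i _)))) (P-act i h∈)
        group-act P-resp P-act unit h∈ = P-resp (λ _ → ≈ᴹ-refl) h∈ , P-resp (λ _ → ≈ᴹ-refl) h∈
        group-act P-resp P-act (mul p q) h∈ =
          P-resp (λ _ → ≈ᴹ-refl) (proj₁ (group-act P-resp P-act p (proj₁ (group-act P-resp P-act q h∈)))) ,
          P-resp (λ _ → ≈ᴹ-refl) (proj₂ (group-act P-resp P-act q (proj₂ (group-act P-resp P-act p h∈))))
        group-act P-resp P-act (inv p) h∈ with x , y ← group-act P-resp P-act p h∈ =
          y , P-resp (λ _ → ≈ᴹ-refl) x
        group-act P-resp P-act (resp {g} {h} eq p) h∈ with x , y ← group-act P-resp P-act p h∈ =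
          P-resp (λ z → eq _) x , P-resp (λ z → GL.⁻¹-cong {g} {h} eq _) y

-- Counting a group by cosets

module _ {G : Group c ℓ₁} where
  open Group G

  cardinality-cong : {H : Pred Carrier p} {H′ : Pred Carrier q} → H ⊆ H′ → H′ ⊆ H →
                     ∀ {k} → HasCardinality G H k → HasCardinality G H′ k
  cardinality-cong H⊆H′ H′⊆H bij = record
    { to        = λ (g , x) → I.to (g , H′⊆H x)
    ; from      = λ i → proj₁ (I.from i) , H⊆H′ (proj₂ (I.from i))
    ; to-cong   = λ eq → I.to-cong eq
    ; from-cong = I.from-cong
    ; inverse   = (λ eq → I.inverseˡ eq) , λ eq → I.inverseʳ eq
    }
    where module I = Inverse bij

  -- An element g is coded by its coset q and by `rep q ⁻¹ ∙ g`. The located coset may depend on the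
  -- proof of g ∈ H; uniqueness removes this dependence and makes the code respect `≈`.
  cardinality-coset :
    {H : Pred Carrier p} {H′ : Pred Carrier q} {m k : ℕ} {Q : Set}
    (Q↔Fin : Q ↔ Fin m) (rep : Q → Carrier) →
    (∀ q {h} → h ∈ H′ → rep q ∙ h ∈ H) →
    (∀ {g} → g ∈ H → ∃ λ q → rep q ⁻¹ ∙ g ∈ H′) →
    (∀ {q q′ h h′} → h ∈ H′ → h′ ∈ H′ → rep q ∙ h ≈ rep q′ ∙ h′ → q ≡ q′) →
    HasCardinality G H′ k → HasCardinality G H (m ℕ.* k)
  cardinality-coset {H = H} {H′} {m} {k} Q↔Fin rep rep∈ locate unique bij = record
    { to        = code
    ; from      = decode
    ; to-cong   = λ {g} {h} → code-cong {g} {h}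
    ; from-cong = λ { ≡.refl → refl }
    ; inverse   = (λ {f} {g} → code-decode {f} {g}) , λ { ≡.refl → decode-code _ }
    }
    where
    module I = Inverse bij
    module Q = Inverse Q↔Fin
    open GroupProps G using (∙-cancelˡ)
    code : ∃ H → Fin (m ℕ.* k)
    code (g , g∈) with q , h∈ ← locate g∈ = combine (Q.to q) (I.to (_ , h∈))
    element : Fin m × Fin k → ∃ H
    element (i , j) = rep (Q.from i) ∙ proj₁ (I.from j) , rep∈ (Q.from i) (proj₂ (I.from j))
    decode : Fin (m ℕ.* k) → ∃ H
    decode f = element (remQuot {m} k f)
    undo : ∀ x g → x ∙ (x ⁻¹ ∙ g) ≈ g
    undo x g = trans (sym (assoc _ _ _)) (trans (∙-congʳ (inverseʳ x)) (identityˡ g))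
    code-cong : {g h : ∃ H} → proj₁ g ≈ proj₁ h → code g ≡ code h
    code-cong {g , g∈} {h , h∈} g≈h with locate g∈ | locate h∈
    ... | q , x | q′ , y with unique x y (trans (undo _ g) (trans g≈h (sym (undo _ h))))
    ...   | ≡.refl = ≡.cong (combine (Q.to q)) (I.to-cong (∙-congˡ g≈h))
    code-decode : ∀ {f} {g : ∃ H} → proj₁ g ≈ proj₁ (decode f) → code g ≡ f
    code-decode {f} {g , g∈} g≈ with locate g∈
    ... | q , x with unique x (proj₂ (I.from (proj₂ (remQuot {m} k f)))) (trans (undo _ g) g≈)
    ...   | ≡.refl = ≡.trans
      (≡.cong₂ combine (Q.strictlyInverseˡ _)
        (I.inverseˡ (∙-cancelˡ _ _ _ (trans (undo _ g) g≈))))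
      (Fin.combine-remQuot {m} k f)
    decode-code : ∀ g → proj₁ (decode (code g)) ≈ proj₁ g
    decode-code (g , g∈) with locate g∈
    ... | q , x = trans
      (reflexive (≡.cong (proj₁ ∘ element) (Fin.remQuot-combine (Q.to q) (I.to (_ , x)))))
      (trans (∙-cong (reflexive (≡.cong rep (Q.strictlyInverseʳ q))) (I.inverseʳ ≡.refl)) (undo _ g))

-- Orbits and stabilizers of minuscule weights

module Orbits {K : OrderedField c ℓ₁ ℓ₂} (E : EuclideanSpace K v ℓv) where
  open OrderedField K hiding (zero)
  open OrderedFieldProperties K
  open EuclideanSpace E
  open LinearAutomorphism
  open Reflections E
  private
    module GL = Group (GL E)
    module ≈ᴹ = ≈-Reasoning ≈ᴹ-setoid

  SimplyLaced : ∀ {i} {I : Set i} → (I → Carrierᴹ) → Set (i ⊔ ℓ₁)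
  SimplyLaced b = ∀ i j → i ≡ j ⊎ b i ⊥ b j ⊎ Adj (b i) (b j)

  -- Weights are indices rather than vectors, so that they can be counted and compared by `≡`.
  record Weights {k} (b : Fin k → Carrierᴹ) : Set (lsuc 0ℓ ⊔ c ⊔ v) where
    field
      Weight : Set
      vec    : Weight → Carrierᴹ
      height : Weight → ℕ
      M      : Carrier

    record Up (i : Fin k) (q q′ : Weight) : Set (ℓ₁ ⊔ ℓv) where
      constructor mkUp
      field
        pairing : cartan E (vec q) (b i) ≈ M
        target  : vec q′ ≈ᴹ reflect E (b i) (vec q)
        rise    : height q′ ≡ suc (height q)

    -- The minuscule condition: the pairing is `M`, 0 or `- M`, and the reflected vector is again a
    -- listed weight.
    data Move (i : Fin k) (q : Weight) : Set (ℓ₁ ⊔ ℓv) where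
      up   : ∀ {q′} → Up i q q′ → Move i q
      fix  : cartan E (vec q) (b i) ≈ 0# → Move i q
      down : ∀ {q′} → Up i q′ q → Move i q

  -- The weights of a minuscule representation, scaled by M; the height counts
  -- the simple roots subtracted from the fundamental weight q₀.
  record Minuscule {k} (b : Fin k → Carrierᴹ) : Set (lsuc 0ℓ ⊔ c ⊔ ℓ₁ ⊔ ℓ₂ ⊔ v ⊔ ℓv) where
    field
      weights : Weights b
    open Weights weights public
    field
      0<M       : 0# < M
      injective : ∀ {q q′} → vec q ≈ᴹ vec q′ → q ≡ q′
      move      : ∀ i q → Move i q
      q₀        : Weight
      height₀   : height q₀ ≡ 0
      descends  : ∀ q → q ≡ q₀ ⊎ ∃₂ λ i q′ → Up i q′ q

  module _ {k} {b : Fin (suc k) → Carrierᴹ} (roots : Roots b) (laced : SimplyLaced b)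
           (Q : Minuscule b) where
    open Minuscule Q

    -M≉0 : - M ≉ 0#
    -M≉0 = <⇒≉ (neg<0 0<M)

    -M≉M : - M ≉ M
    -M≉M = <⇒≉ (<-trans (neg<0 0<M) 0<M)

    -M-M<-M : - M + - M < - M
    -M-M<-M = proj₁ <-resp-≈ (+-identityˡ _) (+-monoˡ-< (- M) (neg<0 0<M))

    -- `q₀` is `M` times a fundamental weight for node `zero`: the reflections in the remaining
    -- nodes fix it, and they will turn out to generate its whole stabilizer.
    module _ (start : cartan E (vec q₀) (b zero) ≈ M)
             (stab : ∀ i → cartan E (vec q₀) (b (suc i)) ≈ 0#) where
      private
        H H′ : Pred (LinearAutomorphism E) _
        H  = ReflectionGroup b
        H′ = ReflectionGroup (b ∘ suc)

        s : Fin (suc k) → LinearAutomorphism E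
        s = reflections roots

        r : Fin (suc k) → Carrierᴹ → Carrierᴹ
        r i = reflect E (b i)

        r-cong : ∀ i {x y} → x ≈ᴹ y → r i x ≈ᴹ r i y
        r-cong i = reflect-cong E (b i)

        r² : ∀ i x → r i (r i x) ≈ᴹ x
        r² = reflect² roots

        s∈ : ∀ i → s i ∈ H
        s∈ i = gen (i , λ _ → ≈ᴹ-refl)

        H′⊆H : H′ ⊆ H
        H′⊆H = generated-⊆ λ (i , eq) → gen (suc i , eq)

        -- Rep q is the coset of those g in H with g (vec q₀) ≈ vec q,
        -- given by all descending paths from q to q₀.
        data Rep : Weight → LinearAutomorphism E → Set (c ⊔ ℓ₁ ⊔ v ⊔ ℓv) where
          base : ∀ {g} → g ∈ H′ → Rep q₀ g
          step : ∀ {i q q′ g h} → Up i q q′ → Rep q g →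
                 (∀ x → to h x ≈ᴹ r i (to g x)) → Rep q′ h

        Rep-resp : ∀ {q g h} → g GL.≈ h → Rep q g → Rep q h
        Rep-resp eq (base x)       = base (resp eq x)
        Rep-resp eq (step u x eq′) = step u x (λ z → ≈ᴹ-trans (≈ᴹ-sym (eq z)) (eq′ z))

        down-pairing : ∀ {i q q′} → Up i q q′ → cartan E (vec q′) (b i) ≈ - M
        down-pairing {i} u = trans (cartan-congˡ E _ (Up.target u))
          (trans (cartan-reflect-self _ (roots i)) (-‿cong (Up.pairing u)))

        source : ∀ {i q q′} → Up i q q′ → vec q ≈ᴹ r i (vec q′)
        source {i} u = ≈ᴹ-sym (≈ᴹ-trans (r-cong i (Up.target u)) (r² i _))

        no-down₀ : ∀ {i q} → ¬ Up i q q₀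
        no-down₀ u = ℕ.0≢1+n (≡.trans (≡.sym height₀) (Up.rise u))

        pairing-⊥ : ∀ {i j q q′} → b i ⊥ b j → Up i q q′ →
                    cartan E (vec q) (b j) ≈ cartan E (vec q′) (b j)
        pairing-⊥ o u = trans (cartan-congˡ E _ (source u)) (cartan-reflect-⊥ _ o)

        pairing-adj : ∀ {i j q q′} → Adj (b i) (b j) → Up i q q′ →
                      cartan E (vec q) (b j) ≈ cartan E (vec q′) (b j) + - M
        pairing-adj adj u = trans (cartan-congˡ E _ (source u))
          (trans (cartan-reflect-adj _ adj) (+-congˡ (down-pairing u)))

        forced-down : ∀ {j q} → cartan E (vec q) (b j) ≈ - M → ∃ λ q′ → Up j q′ q
        forced-down {j} {q} eq with move j q
        ... | up u    = contradiction (trans (sym eq) (Up.pairing u)) -M≉M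
        ... | fix eq′ = contradiction (trans (sym eq) eq′) -M≉0
        ... | down u  = _ , u

        height-< : ∀ {i q q′ n} → Up i q q′ → height q′ ℕ.< suc n → height q ℕ.< n
        height-< u lt = ℕ.s<s⁻¹ (≡.subst (ℕ._< _) (Up.rise u) lt)

        -- n only bounds the recursion.  Two descents i and j from the same weight
        -- commute: for adjacent i and j the weight q″ would have pairing - 2 M.
        Rep-down : ∀ n {j q q′ g} → height q ℕ.< n → Up j q′ q → Rep q g →
                   Rep q′ (s j GL.∙ g)
        Rep-down n       lt u (base x) = contradiction u no-down₀
        Rep-down (suc n) {j} {q} {q′} {g} lt u (step {i} {q″} {.q} {g₁} u₁ x eq) with laced i j
        ... | inj₁ ≡.refl with injective (≈ᴹ-trans (source u) (≈ᴹ-sym (source u₁)))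
        ...   | ≡.refl = Rep-resp (λ z → ≈ᴹ-sym (≈ᴹ-trans (r-cong i (eq z)) (r² i _))) x
        -- The weight `η` closes a commuting square: j leads from it up to `q″`, i leads from it up
        -- to `q′`, and the other two sides meet in q.
        Rep-down (suc n) {j} {q} {q′} {g} lt u (step {i} {q″} {.q} {g₁} u₁ x eq) | inj₂ (inj₁ o)
          with η , w ← forced-down (trans (pairing-⊥ o u₁) (down-pairing u)) =
          step (mkUp (trans (pairing-⊥ (proj₂ o , proj₁ o) w) (Up.pairing u₁)) tgt
                     (ℕ.suc-injective (≡.trans (≡.sym (Up.rise u)) (≡.trans (Up.rise u₁) (≡.cong suc (Up.rise w))))))
               (Rep-down n (height-< u₁ lt) w x)
               (λ z → ≈ᴹ-trans (r-cong j (eq z)) (≈ᴹ-sym (reflect-comm o _)))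
          where
          tgt : vec q′ ≈ᴹ r i (vec η)
          tgt = ≈ᴹ.begin
            vec q′             ≈ᴹ.≈⟨ source u ⟩
            r j (vec q)        ≈ᴹ.≈⟨ r-cong j (Up.target u₁) ⟩
            r j (r i (vec q″)) ≈ᴹ.≈⟨ reflect-comm o _ ⟨
            r i (r j (vec q″)) ≈ᴹ.≈⟨ r-cong i (source w) ⟨
            r i (vec η)        ≈ᴹ.∎
        Rep-down (suc n) {j} {q} {q′} {g} lt u (step {i} {q″} {.q} {g₁} u₁ x eq) | inj₂ (inj₂ adj)
          with -2M ← trans (pairing-adj adj u₁) (+-congʳ (down-pairing u)) | move j q″
        ... | up w    = contradiction (trans (sym -2M) (Up.pairing w))
                          (<⇒≉ (<-trans -M-M<-M (<-trans (neg<0 0<M) 0<M)))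
        ... | fix eq′ = contradiction (trans (sym -2M) eq′) (<⇒≉ (<-trans -M-M<-M (neg<0 0<M)))
        ... | down w  = contradiction (trans (sym -2M) (down-pairing w)) (<⇒≉ -M-M<-M)

        -- A reflection that fixes q preserves the coset of q. At `q₀` it is a generator of H′;
        -- otherwise it is pushed down the path, past the last reflection of the path.
        Rep-fix : ∀ n {j q g} → height q ℕ.< n → cartan E (vec q) (b j) ≈ 0# → Rep q g →
                  Rep q (s j GL.∙ g)
        Rep-fix n {zero}  lt e (base x) = contradiction (trans (sym e) start) (<⇒≉ 0<M)
        Rep-fix n {suc j} lt e (base x) = base (mul (gen {g = s (suc j)} (j , λ _ → ≈ᴹ-refl)) x)
        Rep-fix (suc n) {j} {q} lt e (step {i} {q″} {g = g₁} u x eq) with laced i j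
        ... | inj₁ ≡.refl = contradiction (trans (sym (down-pairing u)) e) -M≉0
        ... | inj₂ (inj₁ o) =
          step u (Rep-fix n (height-< u lt) (trans (pairing-⊥ o u) e) x)
                 (λ z → ≈ᴹ-trans (r-cong j (eq z)) (≈ᴹ-sym (reflect-comm o _)))
        -- Here `q″` pairs to `- M` with `b j`, so j descends from it to `η`, which pairs to 0 with
        -- `b i`. The induction hypothesis for i at `η`, followed by the steps j and i upwards,
        -- yields s_i s_j s_i s_j g₁, and this is s_j s_i g₁ by the braid relation.
        ... | inj₂ (inj₂ adj)
          with η , w ← forced-down (trans (pairing-adj adj u) (trans (+-congʳ e) (+-identityˡ _))) =
          step u (step {h = s j GL.∙ (s i GL.∙ (s j GL.∙ g₁))} w
            (Rep-fix n (ℕ.<-trans (≡.subst (height η ℕ.<_) (≡.sym (Up.rise w)) (ℕ.n<1+n _)) (height-< u lt))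
               (trans (pairing-adj (proj₂ adj , proj₁ adj) w)
                 (trans (+-congʳ (Up.pairing u)) (-‿inverseʳ M)))
               (Rep-down n (height-< u lt) w x))
            (λ _ → ≈ᴹ-refl))
            (λ z → ≈ᴹ-trans (r-cong j (eq z)) (≈ᴹ-sym (≈ᴹ-trans
              (reflect-braid (roots i) (roots j) adj _) (r-cong j (r-cong i (r² j _))))))

        Rep-act : ∀ j {g} → ∃ (λ q → Rep q g) → ∃ λ q → Rep q (s j GL.∙ g)
        Rep-act j (q , x) with move j q
        ... | up u   = _ , step u x (λ _ → ≈ᴹ-refl)
        ... | fix e  = q , Rep-fix (suc (height q)) (ℕ.n<1+n _) e x
        ... | down u = _ , Rep-down (suc (height q)) (ℕ.n<1+n _) u x

        -- The union of the cosets contains the identity and is stable under all generators.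
        Rep-total : ∀ {g} → g ∈ H → ∃ λ q → Rep q g
        Rep-total g∈ with q , x ← proj₁ (group-act roots
            {P = λ g → ∃ λ q → Rep q g}
            (λ {g} {h} eq (q , x) → q , Rep-resp {g = g} {h} eq x) Rep-act g∈ (q₀ , base unit)) =
          q , Rep-resp (λ _ → ≈ᴹ-refl) x

        Rep-vec : ∀ {q g} → Rep q g → to g (vec q₀) ≈ᴹ vec q
        Rep-vec (base x)              = group-fix x stab
        Rep-vec (step {i} u x eq) = ≈ᴹ-trans (eq _)
          (≈ᴹ-trans (r-cong i (Rep-vec x)) (≈ᴹ-sym (Up.target u)))

        Rep-∙ : ∀ {q g h} → Rep q g → h ∈ H′ → Rep q (g GL.∙ h)
        Rep-∙ (base x)      h∈ = base (mul x h∈)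
        Rep-∙ (step u x eq) h∈ = step u (Rep-∙ x h∈) (λ _ → eq _)

        Rep⊆H : ∀ {q g} → Rep q g → g ∈ H
        Rep⊆H (base x)          = H′⊆H x
        Rep⊆H (step {i} u x eq) = resp (λ z → ≈ᴹ-sym (eq z)) (mul (s∈ i) (Rep⊆H x))

        -- The point where the stabilizer becomes parabolic: nothing lies below `q₀`, so a path
        -- ending there has no steps and its element is in H′.
        Rep₀ : ∀ {q g} → Rep q g → q ≡ q₀ → g ∈ H′
        Rep₀ (base x)     ≡.refl = x
        Rep₀ (step u _ _) ≡.refl = contradiction u no-down₀

        -- Follow the path of h downwards; `Rep-down` strips the same reflections from g, even if g
        -- was reached along another path.
        Rep-quotient : ∀ {q g h} → Rep q h → Rep q g → h GL.⁻¹ GL.∙ g ∈ H′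
        Rep-quotient (base y) x = mul (inv y) (Rep₀ x ≡.refl)
        Rep-quotient {q} {g} {h} (step {i} {g = h₁} u y eq) x =
          resp (λ z → from-cong′ z)
            (Rep-quotient y (Rep-down (suc (height q)) (ℕ.n<1+n _) u x))
          where
          from-cong′ : ∀ z → from h₁ (r i (to g z)) ≈ᴹ from h (to g z)
          from-cong′ z = ≈ᴹ.begin
            from h₁ (r i (to g z))                          ≈ᴹ.≈⟨ from-cong h₁ (r-cong i (to∘from h _)) ⟨
            from h₁ (r i (to h (from h (to g z))))          ≈ᴹ.≈⟨ from-cong h₁ (r-cong i (eq _)) ⟩
            from h₁ (r i (r i (to h₁ (from h (to g z)))))   ≈ᴹ.≈⟨ from-cong h₁ (r² i _) ⟩
            from h₁ (to h₁ (from h (to g z)))               ≈ᴹ.≈⟨ from∘to h₁ _ ⟩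
            from h (to g z)                                 ≈ᴹ.∎

        representative : ∀ n q → height q ℕ.< n → ∃ λ g → Rep q g
        representative (suc n) q lt with descends q
        ... | inj₁ ≡.refl       = GL.ε , base unit
        ... | inj₂ (i , q′ , u) with g , x ← representative n q′ (height-< u lt) =
          s i GL.∙ g , step u x (λ _ → ≈ᴹ-refl)

        rep : ∀ q → ∃ λ g → Rep q g
        rep q = representative (suc (height q)) q (ℕ.n<1+n _)

      -- The weights index the cosets faithfully: `Rep-vec` recovers a weight from the image of
      -- `q₀`, and `vec` is injective.
      orbit-stabilizer : ∀ {m k} → Weight ↔ Fin m → HasCardinality (GL E) H′ k →
                         HasCardinality (GL E) H (m ℕ.* k)
      orbit-stabilizer Weight↔Fin =
        cardinality-coset {G = GL E} {H = H} {H′ = H′} Weight↔Fin (λ q → proj₁ (rep q))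
          (λ q {h} h∈ → Rep⊆H (Rep-∙ {h = h} (proj₂ (rep q)) h∈))
          (λ {g} g∈ → let q , x = Rep-total g∈ in q , Rep-quotient {g = g} (proj₂ (rep q)) x)
          (λ {q} {q′} {h} {h′} h∈ h′∈ eq → injective (≈ᴹ-trans
            (≈ᴹ-sym (Rep-vec (Rep-∙ {h = h} (proj₂ (rep q)) h∈)))
            (≈ᴹ-trans (eq _) (Rep-vec (Rep-∙ {h = h′} (proj₂ (rep q′)) h′∈)))))

-- The hypothesis is additive and free of division, so that it can be solved over the natural
-- numbers. Unnormalised rationals reduce the conclusion to a cross multiplication of integers.
coxeter-identity : ∀ X Y a b .{{_ : NonZero b}} → X ℕ.* b ≡ Y ℕ.* b ℕ.+ 2 ℕ.* a →
                   (+ X ℤ.- + Y) / 1 ≡ (+ 2 / 1) ℚ.* (+ a / b)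
coxeter-identity X Y a b@(suc _) eq = ℚ.toℚᵘ-injective (R.begin
  toℚᵘ ((+ X ℤ.- + Y) / 1)                         R.≈⟨ ℚ.toℚᵘ-fromℚᵘ ((+ X ℤ.- + Y) ℚᵘ./ 1) ⟩
  (+ X ℤ.- + Y) ℚᵘ./ 1                             R.≈⟨ ℚᵘ.*≡* cross ⟩
  (+ 2 ℚᵘ./ 1) ℚᵘ.* (+ a ℚᵘ./ b)                   R.≈⟨ ℚᵘ.*-cong (ℚ.toℚᵘ-fromℚᵘ (+ 2 ℚᵘ./ 1)) (ℚ.toℚᵘ-fromℚᵘ (+ a ℚᵘ./ b)) ⟨
  toℚᵘ (+ 2 / 1) ℚᵘ.* toℚᵘ (+ a / b)               R.≈⟨ ℚ.toℚᵘ-homo-* (+ 2 / 1) (+ a / b) ⟨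
  toℚᵘ ((+ 2 / 1) ℚ.* (+ a / b))                   R.∎)
  where
  module R = ℚᵘ.≃-Reasoning
  open ≡.≡-Reasoning
  cross : (+ X ℤ.- + Y) ℤ.* + (1 ℕ.* b) ≡ (+ 2 ℤ.* + a) ℤ.* + 1
  cross = begin
    (+ X ℤ.- + Y) ℤ.* + (1 ℕ.* b)                        ≡⟨ ≡.cong (λ z → (+ X ℤ.- + Y) ℤ.* + z) (ℕ.*-identityˡ b) ⟩
    (+ X ℤ.- + Y) ℤ.* + b                                ≡⟨ ℤ.*-distribʳ-+ (+ b) (+ X) (ℤ.- + Y) ⟩
    + X ℤ.* + b ℤ.+ (ℤ.- + Y) ℤ.* + b                    ≡⟨ ≡.cong₂ ℤ._+_ (≡.sym (ℤ.pos-* X b)) (≡.sym (ℤ.neg-distribˡ-* (+ Y) (+ b))) ⟩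
    + (X ℕ.* b) ℤ.- + Y ℤ.* + b                          ≡⟨ ≡.cong₂ (λ x y → + x ℤ.- y) eq (≡.sym (ℤ.pos-* Y b)) ⟩
    + (Y ℕ.* b ℕ.+ 2 ℕ.* a) ℤ.- + (Y ℕ.* b)              ≡⟨ ≡.cong (λ z → z ℤ.- + (Y ℕ.* b)) (≡.trans (≡.cong +_ (ℕ.+-comm (Y ℕ.* b) _)) (ℤ.pos-+ (2 ℕ.* a) (Y ℕ.* b))) ⟩
    (+ (2 ℕ.* a) ℤ.+ + (Y ℕ.* b)) ℤ.- + (Y ℕ.* b)        ≡⟨ ℤ.+-assoc (+ (2 ℕ.* a)) (+ (Y ℕ.* b)) (ℤ.- + (Y ℕ.* b)) ⟩
    + (2 ℕ.* a) ℤ.+ (+ (Y ℕ.* b) ℤ.- + (Y ℕ.* b))        ≡⟨ ≡.cong (λ z → + (2 ℕ.* a) ℤ.+ z) (ℤ.+-inverseʳ (+ (Y ℕ.* b))) ⟩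
    + (2 ℕ.* a) ℤ.+ + 0                                  ≡⟨ ℤ.+-identityʳ _ ⟩
    + (2 ℕ.* a)                                          ≡⟨ ℤ.pos-* 2 a ⟩
    + 2 ℤ.* + a                                          ≡⟨ ℤ.*-identityʳ _ ⟨
    (+ 2 ℤ.* + a) ℤ.* + 1                                ∎

module _ {K : OrderedField c ℓ₁ ℓ₂} (E : EuclideanSpace K v ℓv) where
  open OrderedField K hiding (zero)
  open OrderedFieldProperties K
  open EuclideanSpace E
  open LinearAutomorphism
  open Reflections E
  open Orbits E
  open Conjugacy (GL E)
  open RawMonoidDefs +-rawMonoid using () renaming (_×_ to _ℕ×_)
  private
    module AG = AbelianGroupProps +ᴹ-abelianGroup
    module GL = Group (GL E)
    module ≈ᴹ = ≈-Reasoning ≈ᴹ-setoid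
  open ≈-Reasoning setoid

  Family : ℕ → Set v
  Family k = Fin k → Carrierᴹ

  cartan-separates : ∀ {x y β k l} → cartan E x β ≈ k → cartan E y β ≈ l → k ≉ l → x ≉ᴹ y
  cartan-separates {β = β} p q k≉l x≈y = k≉l (trans (sym p) (trans (cartan-congˡ E β x≈y) q))

  0<2 : 0# < 2#
  0<2 = 0<+ 0<1 0<1

  -2≉2 : - 2# ≉ 2#
  -2≉2 = <⇒≉ (<-trans (neg<0 0<2) 0<2)

  ⊥-sym : ∀ {β γ} → β ⊥ γ → γ ⊥ β
  ⊥-sym (p , q) = q , p

  -- Type A

  PathLink : ∀ {k} → Carrierᴹ → Family k → Fin k → Set ℓ₁
  PathLink γ b zero    = Adj γ (b zero)
  PathLink γ b (suc i) = γ ⊥ b (suc i)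

  -- Type A built from one end, so that deleting the leaf at `zero` is composition with `suc`.
  data IsPath : ∀ {k} → Family k → Set (v ⊔ ℓ₁) where
    []  : {b : Family 0} → IsPath b
    _,_ : ∀ {k} {b : Family (suc k)} →
          Root (b zero) × (∀ i → PathLink (b zero) (b ∘ suc) i) →
          IsPath (b ∘ suc) → IsPath b

  path-tail : ∀ {k} {b : Family (suc k)} → IsPath b → IsPath (b ∘ suc)
  path-tail (_ , path) = path

  path-roots : ∀ {k} {b : Family k} → IsPath b → Roots b
  path-roots ((root , _) , _) zero    = root
  path-roots (_ , path)       (suc i) = path-roots path i

  path-laced : ∀ {k} {b : Family k} → IsPath b → SimplyLaced b
  path-laced _               zero    zero          = inj₁ ≡.refl
  path-laced ((_ , link) , _) zero    (suc zero)    = inj₂ (inj₂ (link zero))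
  path-laced ((_ , link) , _) zero    (suc (suc j)) = inj₂ (inj₁ (link (suc j)))
  path-laced ((_ , link) , _) (suc zero)    zero    = let p , q = link zero in inj₂ (inj₂ (q , p))
  path-laced ((_ , link) , _) (suc (suc i)) zero    = inj₂ (inj₁ (⊥-sym (link (suc i))))
  path-laced (_ , path) (suc i) (suc j)       = Sum.map₁ (≡.cong suc) (path-laced path i j)

  at-zero : ∀ {k} → Carrier → Fin k → Carrier
  at-zero M zero    = M
  at-zero M (suc _) = 0#

  -- Only pairings are prescribed; the component of x orthogonal to b stays free. Hence a reflected
  -- weight can serve as fundamental weight of the tail, although it need not lie in its span.
  Fundamental : ∀ {k} → Carrier → Family k → Carrierᴹ → Set ℓ₁
  Fundamental M b x = ∀ i → cartan E x (b i) ≈ at-zero M i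

  -- For fundamental x these are, up to scaling, the weights of the standard representation: x, r_0
  -- x, r_1 r_0 x and so on.
  chain : ∀ {k} → Family k → Carrierᴹ → Fin (suc k) → Carrierᴹ
  chain         b x zero    = x
  chain {suc k} b x (suc q) = chain (b ∘ suc) (reflect E (b zero) x) q

  chain-⊥ : ∀ {k} (b : Family k) x γ → (∀ i → b i ⊥ γ) → ∀ q →
            cartan E (chain b x q) γ ≈ cartan E x γ
  chain-⊥         b x γ b⊥γ zero    = refl
  chain-⊥ {suc k} b x γ b⊥γ (suc q) = trans
    (chain-⊥ (b ∘ suc) _ γ (b⊥γ ∘ suc) q) (cartan-reflect-⊥ x (b⊥γ zero))

  chainWeights : ∀ {k} → Carrier → (b : Family k) → Carrierᴹ → Weights b
  chainWeights {k} M b x = record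
    { Weight = Fin (suc k) ; vec = chain b x ; height = toℕ ; M = M }

  module _ {M : Carrier} where

    -- Subtracting `M` times `b zero` raises the pairing with its neighbour from 0 to `M` and leaves
    -- the later ones alone. The inductions along `chain` rest on this.
    fundamental-reflect : ∀ {k} {b : Family (suc k)} {x} → IsPath b → Fundamental M b x →
                          Fundamental M (b ∘ suc) (reflect E (b zero) x)
    fundamental-reflect ((_ , link) , _) fund zero = trans (cartan-reflect-adj _ (link zero))
      (trans (+-cong (fund (suc zero)) (fund zero)) (+-identityˡ M))
    fundamental-reflect ((_ , link) , _) fund (suc i) =
      trans (cartan-reflect-⊥ _ (link (suc i))) (fund (suc (suc i)))

    -- The pairing with `b zero` runs through `M`, `- M`, 0: the second reflection adds the pairing
    -- `M` with the neighbour, and all later reflections are orthogonal to `b zero`.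
    chain-far : ∀ {k} {b : Family (suc k)} {x} → IsPath b → Fundamental M b x → ∀ (q : Fin k) →
                cartan E (chain b x (suc (suc q))) (b zero) ≈ 0#
    chain-far {suc k} {b} {x} path@((root , link) , _) fund q = begin
      cartan E (chain b x (suc (suc q))) (b zero)
        ≈⟨ chain-⊥ (λ i → b (suc (suc i))) _ _ (λ i → ⊥-sym (link (suc i))) q ⟩
      cartan E (reflect E (b (suc zero)) x′) (b zero)
        ≈⟨ cartan-reflect-adj _ (let p , q = link zero in q , p) ⟩
      cartan E x′ (b zero) + cartan E x′ (b (suc zero))
        ≈⟨ +-cong (trans (cartan-reflect-self x root) (-‿cong (fund zero)))
                  (fundamental-reflect path fund zero) ⟩
      - M + M
        ≈⟨ -‿inverseˡ M ⟩
      0# ∎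
      where x′ = reflect E (b zero) x

    module _ {k} {b : Family k} {x : Carrierᴹ} where
      open Weights (chainWeights M b x) public using () renaming (Up to ChainUp; Move to ChainMove)

    chain-up-suc : ∀ {k} {b : Family (suc k)} {x i q q′} →
                   ChainUp {b = b ∘ suc} {reflect E (b zero) x} i q q′ →
                   ChainUp {b = b} {x} (suc i) (suc q) (suc q′)
    chain-up-suc (Weights.mkUp p t r) = Weights.mkUp p t (≡.cong suc r)

    chain-up : ∀ {k} {b : Family k} {x} → IsPath b → Fundamental M b x →
               ∀ i → ChainUp {b = b} {x} i (inject₁ i) (suc i)
    chain-up path fund zero    = Weights.mkUp (fund zero) ≈ᴹ-refl ≡.refl
    chain-up path fund (suc i) =
      chain-up-suc (chain-up (path-tail path) (fundamental-reflect path fund) i)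

    chain-move : ∀ {k} {b : Family k} {x} → IsPath b → Fundamental M b x →
                 ∀ i q → ChainMove {b = b} {x} i q
    chain-move path fund zero    zero          = Weights.up (chain-up path fund zero)
    chain-move path fund zero    (suc zero)    = Weights.down (chain-up path fund zero)
    chain-move path fund zero    (suc (suc q)) = Weights.fix (chain-far path fund q)
    chain-move path fund (suc i) zero          = Weights.fix (fund (suc i))
    chain-move path fund (suc i) (suc q)
      with chain-move (path-tail path) (fundamental-reflect path fund) i q
    ... | Weights.up u   = Weights.up (chain-up-suc u)
    ... | Weights.fix e  = Weights.fix e
    ... | Weights.down u = Weights.down (chain-up-suc u)

    module _ (0<M : 0# < M) where

      chain-zero≉suc : ∀ {k} {b : Family (suc k)} {x} → IsPath b → Fundamental M b x →
                       ∀ q → x ≉ᴹ chain b x (suc q)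
      chain-zero≉suc ((root , _) , _) fund zero = cartan-separates (fund zero)
        (trans (cartan-reflect-self _ root) (-‿cong (fund zero)))
        (λ eq → <⇒≉ (<-trans (neg<0 0<M) 0<M) (sym eq))
      chain-zero≉suc path fund (suc q) = cartan-separates (fund zero) (chain-far path fund q)
        (λ eq → <⇒≉ 0<M (sym eq))

      chain-injective : ∀ {k} {b : Family k} {x} → IsPath b → Fundamental M b x →
                        ∀ {q q′} → chain b x q ≈ᴹ chain b x q′ → q ≡ q′
      chain-injective path fund {zero}  {zero}   eq = ≡.refl
      chain-injective {suc k} path fund {zero} {suc q′} eq =
        contradiction eq (chain-zero≉suc path fund q′)
      chain-injective {suc k} path fund {suc q} {zero} eq =
        contradiction (≈ᴹ-sym eq) (chain-zero≉suc path fund q)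
      chain-injective {suc k} path fund {suc q} {suc q′} eq =
        ≡.cong suc (chain-injective (path-tail path) (fundamental-reflect path fund) eq)

      chainMinuscule : ∀ {k} {b : Family k} {x} → IsPath b → Fundamental M b x → Minuscule b
      chainMinuscule {k} {b} {x} path fund = record
        { weights   = chainWeights M b x
        ; 0<M       = 0<M
        ; injective = chain-injective path fund
        ; move      = chain-move path fund
        ; q₀        = zero
        ; height₀   = ≡.refl
        ; descends  = λ { zero    → inj₁ ≡.refl
                        ; (suc q) → inj₂ (q , inject₁ q , chain-up path fund q) }
        }

  -- The first fundamental weight of A k, scaled by k + 1.
  topPath : ∀ {k} → Family k → Carrierᴹ
  topPath {zero}  b = 0ᴹ
  topPath {suc k} b = (suc k ℕ× 1#) *ₗ b zero +ᴹ topPath (b ∘ suc)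

  cartan-lin : ∀ a β y γ → cartan E (a *ₗ β +ᴹ y) γ ≈ a * cartan E β γ + cartan E y γ
  cartan-lin a β y γ = trans (cartan-+ E _ y γ) (+-congʳ (cartan-* E a β γ))

  topPath-⊥ : ∀ {k} {b : Family k} {γ} → (∀ i → b i ⊥ γ) → cartan E (topPath b) γ ≈ 0#
  topPath-⊥ {zero}  b⊥γ = cartan-0ᴹ _
  topPath-⊥ {suc k} b⊥γ = trans (cartan-lin _ _ _ _)
    (trans (+-cong (trans (*-congˡ (proj₁ (b⊥γ zero))) (zeroʳ _)) (topPath-⊥ (b⊥γ ∘ suc)))
           (+-identityˡ _))

  x*-1≈-x : ∀ x → x * - 1# ≈ - x
  x*-1≈-x x = trans (*-comm _ _) (-1*x≈-x x)

  topPath-link : ∀ {k} {b : Family k} {γ} → (∀ i → PathLink γ b i) →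
                 cartan E (topPath b) γ ≈ - (k ℕ× 1#)
  topPath-link {zero}  link = trans (cartan-0ᴹ _) (sym -0#≈0#)
  topPath-link {suc k} link = trans (cartan-lin _ _ _ _)
    (trans (+-cong (trans (*-congˡ (proj₂ (link zero))) (x*-1≈-x _))
                   (topPath-⊥ (λ i → ⊥-sym (link (suc i)))))
           (+-identityʳ _))

  -- The coefficients k, k - 1, ..., 1 fall linearly, so 2 a - (a + 1) - (a - 1) vanishes at every
  -- node except the first, where the absent neighbour leaves k + 1.
  topPath-fundamental : ∀ {k} {b : Family k} → IsPath b → Fundamental (suc k ℕ× 1#) b (topPath b)
  topPath-fundamental {suc k} {b} ((root , link) , path) zero = begin
    cartan E (topPath b) (b zero)             ≈⟨ cartan-lin _ _ _ _ ⟩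
    (1# + n) * cartan E (b zero) (b zero) + cartan E (topPath (b ∘ suc)) (b zero)
                                              ≈⟨ +-cong (*-congˡ root) (topPath-link link) ⟩
    (1# + n) * 2# + - n                       ≈⟨ +-congʳ (trans (distribˡ _ _ _) (+-cong (*-identityʳ _) (*-identityʳ _))) ⟩
    ((1# + n) + (1# + n)) + - n               ≈⟨ trans (+-assoc _ _ _) (+-congˡ (+-assoc _ _ _)) ⟩
    (1# + n) + (1# + (n + - n))               ≈⟨ +-congˡ (trans (+-congˡ (-‿inverseʳ n)) (+-identityʳ 1#)) ⟩
    (1# + n) + 1#                             ≈⟨ +-comm _ _ ⟩
    1# + (1# + n)                             ∎
    where n = k ℕ× 1#
  topPath-fundamental {suc (suc k)} {b} ((_ , link) , path) (suc zero) = trans (cartan-lin _ _ _ _)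
    (trans (+-cong (trans (*-congˡ (proj₁ (link zero))) (x*-1≈-x _)) (topPath-fundamental path zero))
           (-‿inverseˡ _))
  topPath-fundamental {suc (suc k)} {b} ((_ , link) , path) (suc (suc i)) = trans (cartan-lin _ _ _ _)
    (trans (+-cong (trans (*-congˡ (proj₁ (link (suc i)))) (zeroʳ _)) (topPath-fundamental path (suc i)))
           (+-identityˡ _))

  pathMinuscule : ∀ {k} {b : Family k} → IsPath b → Minuscule b
  pathMinuscule {k} path = chainMinuscule (0<suc k) path (topPath-fundamental path)

  path-step : ∀ {k n} {b : Family (suc k)} → IsPath b →
              HasCardinality (GL E) (ReflectionGroup (b ∘ suc)) n →
              HasCardinality (GL E) (ReflectionGroup b) ((2 ℕ.+ k) ℕ.* n)
  path-step path = orbit-stabilizer (path-roots path) (path-laced path) (pathMinuscule path)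
    (topPath-fundamental path zero) (topPath-fundamental path ∘ suc) (↔-id _)

  IsFinite : Pred (LinearAutomorphism E) p → Set _
  IsFinite H = ∃ λ n → NonZero n × HasCardinality (GL E) H n

  trivial-cardinality : {b : Family 0} → HasCardinality (GL E) (ReflectionGroup b) 1
  trivial-cardinality {b} = record
    { to        = λ _ → zero
    ; from      = λ _ → GL.ε , unit
    ; to-cong   = λ _ → ≡.refl
    ; from-cong = λ _ _ → ≈ᴹ-refl
    ; inverse   = (λ { {zero} _ → ≡.refl }) ,
                  λ { {_ , g∈} _ _ → ≈ᴹ-sym (group-fix {b = b} g∈ λ ()) }
    }

  path-finite : ∀ {k} {b : Family k} → IsPath b → IsFinite (ReflectionGroup b)
  path-finite {zero}  path = 1 , _ , trivial-cardinality
  path-finite {suc k} path@(_ , tail) with n , n≢0 , card ← path-finite tail =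
    (2 ℕ.+ k) ℕ.* n , ℕ.m*n≢0 (2 ℕ.+ k) n {{_}} {{n≢0}} , path-step path card

  -- Lets the order computations apply to the simple reflections of any `SimpleSystem`, whichever
  -- nonvanishing proofs they carry.
  Realizes : ∀ {k} → (Fin k → LinearAutomorphism E) → Family k → Set (v ⊔ ℓv)
  Realizes t b = ∀ i x → to (t i) x ≈ᴹ reflect E (b i) x

  realizes-commute : ∀ {g h β γ} → (∀ x → to g x ≈ᴹ reflect E β x) →
                     (∀ x → to h x ≈ᴹ reflect E γ x) → β ⊥ γ → Commute g h
  realizes-commute {g} {h} {β} {γ} g≈ h≈ o x = ≈ᴹ.begin
    to g (to h x)                ≈ᴹ.≈⟨ g≈ _ ⟩
    reflect E β (to h x)         ≈ᴹ.≈⟨ reflect-cong E β (h≈ x) ⟩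
    reflect E β (reflect E γ x)  ≈ᴹ.≈⟨ reflect-comm o x ⟩
    reflect E γ (reflect E β x)  ≈ᴹ.≈⟨ reflect-cong E γ (g≈ x) ⟨
    reflect E γ (to g x)         ≈ᴹ.≈⟨ h≈ _ ⟨
    to h (to g x)                ≈ᴹ.∎

  path-commutes : ∀ {k} {b : Family k} → IsPath b → (t : Fin k → LinearAutomorphism E) →
                  Realizes t b → Path (tabulate t)
  path-commutes []                      t real = []
  path-commutes (_ , [])                t real = [-]
  path-commutes ((_ , link) , path@(_ , _)) t real = cons
    (All.tabulate⁺ (λ i → realizes-commute {g = t zero} {h = t (suc (suc i))} (real zero) (real (suc (suc i))) (link (suc i))))
    (path-commutes path (t ∘ suc) (real ∘ suc))

  prod∈ : ∀ {k} (t : Fin k → LinearAutomorphism E) {b : Family k} → Realizes t b →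
          prod (GL E) t ∈ ReflectionGroup b
  prod∈ {zero}  t real = unit
  prod∈ {suc k} t real = mul {g = t zero} (gen (zero , real zero))
    (generated-⊆ {G = GL E} (λ (i , eq) → gen (suc i , eq)) (prod∈ (t ∘ suc) (real ∘ suc)))

  power∈ : ∀ {H : Pred (LinearAutomorphism E) p} {g} → g ∈ Generated (GL E) H →
           ∀ n → power (GL E) n g ∈ Generated (GL E) H
  power∈ g∈ zero    = unit
  power∈ g∈ (suc n) = mul g∈ (power∈ g∈ n)

  to-neg : ∀ (g : LinearAutomorphism E) x → to g (-ᴹ x) ≈ᴹ -ᴹ (to g x)
  to-neg g x = ≈ᴹ-trans (to-cong g (-ᴹ≈-1*ₗ E x))
    (≈ᴹ-trans (to-* g _ x) (≈ᴹ-sym (-ᴹ≈-1*ₗ E _)))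

  module _ (g : LinearAutomorphism E) where
    private
      _^ : ℕ → Carrierᴹ → Carrierᴹ
      n ^ = to (power (GL E) n g)

    power-cong : ∀ n {x y} → x ≈ᴹ y → (n ^) x ≈ᴹ (n ^) y
    power-cong n = to-cong (power (GL E) n g)

    power-suc : ∀ n x → (n ^) (to g x) ≈ᴹ to g ((n ^) x)
    power-suc zero    x = ≈ᴹ-refl
    power-suc (suc n) x = to-cong g (power-suc n x)

    power-+ : ∀ m n x → ((m ℕ.+ n) ^) x ≈ᴹ (m ^) ((n ^) x)
    power-+ zero    n x = ≈ᴹ-refl
    power-+ (suc m) n x = to-cong g (power-+ m n x)

    power-orbit : ∀ n j {x} → (n ^) x ≈ᴹ x → (n ^) ((j ^) x) ≈ᴹ (j ^) x
    power-orbit n zero    eq = eq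
    power-orbit n (suc j) eq = ≈ᴹ-trans (power-suc n _) (to-cong g (power-orbit n j eq))

    power-neg : ∀ n {x} → to g x ≈ᴹ -ᴹ x → ((n ℕ.+ n) ^) x ≈ᴹ x
    power-neg zero    eq = ≈ᴹ-refl
    power-neg (suc n) {x} eq rewrite ℕ.+-suc n n = ≈ᴹ.begin
      to g (to g (((n ℕ.+ n) ^) x))  ≈ᴹ.≈⟨ to-cong g (to-cong g (power-neg n eq)) ⟩
      to g (to g x)                  ≈ᴹ.≈⟨ to-cong g eq ⟩
      to g (-ᴹ x)                    ≈ᴹ.≈⟨ to-neg g x ⟩
      -ᴹ (to g x)                    ≈ᴹ.≈⟨ -ᴹ‿cong eq ⟩
      -ᴹ (-ᴹ x)                      ≈ᴹ.≈⟨ AG.⁻¹-involutive x ⟩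
      x                              ≈ᴹ.∎

    module _ {n} {w : Fin (suc n) → Carrierᴹ} (next : ∀ i → to g (w (inject₁ i)) ≈ᴹ w (suc i)) where

      power-cycle : ∀ i → (toℕ i ^) (w zero) ≈ᴹ w i
      power-cycle = <-weakInduction _ ≈ᴹ-refl λ i ih →
        ≈ᴹ-trans (to-cong g (≈ᴹ-trans (≈ᴹ-reflexive (≡.cong (λ j → (j ^) (w zero)) (≡.sym (Fin.toℕ-inject₁ i)))) ih))
                 (next i)

      power-cycle< : ∀ {j} (j<1+n : j ℕ.< suc n) → (j ^) (w zero) ≈ᴹ w (fromℕ< j<1+n)
      power-cycle< j<1+n = ≈ᴹ-trans
        (≈ᴹ-reflexive (≡.cong (λ j → (j ^) (w zero)) (≡.sym (Fin.toℕ-fromℕ< j<1+n))))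
        (power-cycle (fromℕ< j<1+n))

      power-full : ∀ {z} → to g (w (fromℕ n)) ≈ᴹ z → (suc n ^) (w zero) ≈ᴹ z
      power-full last = ≈ᴹ-trans (to-cong g (≈ᴹ-trans
        (≈ᴹ-reflexive (≡.cong (λ j → (j ^) (w zero)) (≡.sym (Fin.toℕ-fromℕ n))))
        (power-cycle (fromℕ n)))) last

      power-returns : ∀ m → (m ^) (w zero) ≈ᴹ w zero → ∀ i → (m ^) (w i) ≈ᴹ w i
      power-returns m eq i = ≈ᴹ-trans (power-cong m (≈ᴹ-sym (power-cycle i)))
        (≈ᴹ-trans (power-orbit m (toℕ i) eq) (power-cycle i))

  -- The tail product fixes x and, by induction, cycles the remaining weights. The first reflection
  -- only swaps x with the next weight, which inserts x into the cycle.
  coxeter-chain : ∀ {k M} {b : Family k} {x} → IsPath b → Fundamental M b x →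
    (t : Fin k → LinearAutomorphism E) → Realizes t b →
    (∀ i → to (prod (GL E) t) (chain b x (inject₁ i)) ≈ᴹ chain b x (suc i)) ×
    to (prod (GL E) t) (chain b x (fromℕ k)) ≈ᴹ x
  coxeter-chain []                              fund t real = (λ ()) , ≈ᴹ-refl
  coxeter-chain {suc k} {M} {b} {x} path@((root , _) , tail) fund t real = next , last
    where
    fund′ : Fundamental M (b ∘ suc) (reflect E (b zero) x)
    fund′ = fundamental-reflect path fund
    ih = coxeter-chain tail fund′ (t ∘ suc) (real ∘ suc)
    next : ∀ i → to (prod (GL E) t) (chain b x (inject₁ i)) ≈ᴹ chain b x (suc i)
    next zero    = ≈ᴹ-trans (to-cong (t zero) (group-fix (prod∈ (t ∘ suc) (real ∘ suc)) (λ i → fund (suc i))))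
                            (real zero x)
    next (suc i) = ≈ᴹ-trans (to-cong (t zero) (proj₁ ih i))
                            (≈ᴹ-trans (real zero _) (reflect-fix (chain-far path fund i)))
    last : to (prod (GL E) t) (chain b x (fromℕ (suc k))) ≈ᴹ x
    last = ≈ᴹ-trans (to-cong (t zero) (proj₂ ih))
                    (≈ᴹ-trans (real zero _) (reflect-involutive E (root≉0 root) x))

  module _ {k} {b : Family k} (roots : Roots b) (Q : Minuscule b) where
    open Minuscule Q

    -- A step up along i shows `- M *ₗ b i` as a difference of two weights. This is the spanning
    -- hypothesis of `group-faithful`.
    minuscule-spans : (∀ i → ∃₂ λ q q′ → Up i q q′) →
                      ∀ y → (∀ q → ⟪ y , vec q ⟫ ≈ 0#) → ∀ i → ⟪ y , b i ⟫ ≈ 0#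
    minuscule-spans ups y y⊥ i with q , q′ , u ← ups i = *-cancel-0 (<⇒≉ (neg<0 0<M)) (begin
      - M * ⟪ y , b i ⟫                       ≈⟨ sym (⟪⟫-*ʳ (- M) y (b i)) ⟩
      ⟪ y , - M *ₗ b i ⟫                      ≈⟨ sym (+-identityˡ _) ⟩
      0# + ⟪ y , - M *ₗ b i ⟫                 ≈⟨ +-congʳ (sym (y⊥ q)) ⟩
      ⟪ y , vec q ⟫ + ⟪ y , - M *ₗ b i ⟫      ≈⟨ sym (⟪⟫-+ʳ y _ _) ⟩
      ⟪ y , vec q +ᴹ - M *ₗ b i ⟫             ≈⟨ ⟪⟫-cong ≈ᴹ-refl (≈ᴹ-sym (≈ᴹ-trans (Up.target u) (reflect-value (Up.pairing u)))) ⟩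
      ⟪ y , vec q′ ⟫                          ≈⟨ y⊥ q′ ⟩
      0#                                      ∎)

  path-order : ∀ {k} {b : Family k} → IsPath b → (t : Fin k → LinearAutomorphism E) →
               Realizes t b → ∀ (π : Permutation′ k) →
               HasOrder (GL E) (prod (GL E) (λ i → t (π ⟨$⟩ʳ i))) (suc k)
  path-order {k} {b} path t real = order-permute t
    (path-irrelevant (path-commutes path t real)) (s≤s z≤n , period , minimal)
    where
    Q = pathMinuscule path
    open Minuscule Q using (injective)
    g : LinearAutomorphism E
    g = prod (GL E) t
    w : Fin (suc k) → Carrierᴹ
    w = chain b (topPath b)
    cycle : (∀ i → to g (w (inject₁ i)) ≈ᴹ w (suc i)) × to g (w (fromℕ k)) ≈ᴹ w zero
    cycle = coxeter-chain path (topPath-fundamental path) t real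
    period : ∀ y → to (power (GL E) (suc k) g) y ≈ᴹ y
    period = group-faithful (path-roots path)
      (minuscule-spans (path-roots path) Q
        (λ i → _ , _ , chain-up path (topPath-fundamental path) i))
      (power∈ (prod∈ t real) (suc k))
      (power-returns g {w = w} (proj₁ cycle) (suc k) (power-full g {w = w} (proj₁ cycle) (proj₂ cycle)))
    minimal : ∀ {j} → 0 ℕ.< j → power (GL E) j g GL.≈ GL.ε → suc k ℕ.≤ j
    minimal {j} 0<j gʲ≈ε with suc k ℕ.≤? j
    ... | yes k<j = k<j
    ... | no  k≮j with j<1+k ← ℕ.≰⇒> k≮j
      with injective (≈ᴹ-trans (≈ᴹ-sym (power-cycle< g {w = w} (proj₁ cycle) j<1+k)) (gʲ≈ε _))
    ...   | eq = contradiction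
      (≡.trans (≡.sym (Fin.toℕ-fromℕ< j<1+k)) (≡.cong toℕ eq)) (ℕ.>⇒≢ 0<j)

  -- Type D

  ForkLink : ∀ {m} → Carrierᴹ → Family (2 ℕ.+ m) → Fin (2 ℕ.+ m) → Set ℓ₁
  ForkLink {zero}  γ b i       = Adj γ (b i)
  ForkLink {suc m} γ b zero    = Adj γ (b zero)
  ForkLink {suc m} γ b (suc i) = γ ⊥ b (suc i)

  -- Built up from the two tips, which form D_2. The first node put in front of them is the branch
  -- node, joined to both; this is D_3, that is A_3.
  data IsFork : ∀ {m} → Family (2 ℕ.+ m) → Set (v ⊔ ℓ₁) where
    base : {b : Family 2} → Root (b 0F) → Root (b 1F) → b 0F ⊥ b 1F → IsFork b
    _,_  : ∀ {m} {b : Family (3 ℕ.+ m)} →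
           Root (b zero) × (∀ i → ForkLink (b zero) (b ∘ suc) i) →
           IsFork (b ∘ suc) → IsFork b

  fork-roots : ∀ {m} {b : Family (2 ℕ.+ m)} → IsFork b → Roots b
  fork-roots (base r₀ r₁ _)   0F      = r₀
  fork-roots (base r₀ r₁ _)   1F      = r₁
  fork-roots ((root , _) , _) zero    = root
  fork-roots (_ , fork)       (suc i) = fork-roots fork i

  link-related : ∀ {m} {γ} {b : Family (2 ℕ.+ m)} → (∀ i → ForkLink γ b i) →
                 ∀ i → γ ⊥ b i ⊎ Adj γ (b i)
  link-related {zero}  link i       = inj₂ (link i)
  link-related {suc m} link zero    = inj₂ (link zero)
  link-related {suc m} link (suc i) = inj₁ (link (suc i))

  fork-laced : ∀ {m} {b : Family (2 ℕ.+ m)} → IsFork b → SimplyLaced b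
  fork-laced _                zero zero = inj₁ ≡.refl
  fork-laced (base _ _ o)     0F   1F   = inj₂ (inj₁ o)
  fork-laced (base _ _ o)     1F   0F   = inj₂ (inj₁ (⊥-sym o))
  fork-laced (base _ _ o)     1F   1F   = inj₁ ≡.refl
  fork-laced ((_ , link) , _) zero (suc j) = inj₂ (link-related link j)
  fork-laced ((_ , link) , _) (suc i) zero =
    inj₂ (Sum.map (λ (p , q) → q , p) (λ (p , q) → q , p) (link-related link i))
  fork-laced (_ , fork) (suc i) (suc j) = Sum.map₁ (≡.cong suc) (fork-laced fork i j)

  -- Twice the coordinate vectors ε p of D n, where b i = ε i - ε (i + 1)
  -- and the last vector of b is ε (n - 2) + ε (n - 1).
  coord : ∀ {m} → Family (2 ℕ.+ m) → Fin (2 ℕ.+ m) → Carrierᴹ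
  coord {zero}  b 0F      = b 0F +ᴹ b 1F
  coord {zero}  b 1F      = b 1F +ᴹ -ᴹ b 0F
  coord {suc m} b zero    = 2# *ₗ b zero +ᴹ coord (b ∘ suc) zero
  coord {suc m} b (suc p) = coord (b ∘ suc) p

  cartan-diff : ∀ x y γ → cartan E (x +ᴹ -ᴹ y) γ ≈ cartan E x γ + - cartan E y γ
  cartan-diff x y γ = trans (cartan-+ E x _ γ) (+-congˡ (cartan-neg y γ))

  coord-⊥ : ∀ {m} {b : Family (2 ℕ.+ m)} {γ} → (∀ i → b i ⊥ γ) → ∀ p →
            cartan E (coord b p) γ ≈ 0#
  coord-⊥ {zero} b⊥γ 0F = trans (cartan-+ E _ _ _)
    (trans (+-cong (proj₁ (b⊥γ 0F)) (proj₁ (b⊥γ 1F))) (+-identityˡ _))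
  coord-⊥ {zero} b⊥γ 1F = trans (cartan-diff _ _ _)
    (trans (+-cong (proj₁ (b⊥γ 1F)) (trans (-‿cong (proj₁ (b⊥γ 0F))) -0#≈0#)) (+-identityˡ _))
  coord-⊥ {suc m} b⊥γ zero = trans (cartan-lin _ _ _ _)
    (trans (+-cong (trans (*-congˡ (proj₁ (b⊥γ zero))) (zeroʳ _)) (coord-⊥ (b⊥γ ∘ suc) zero))
           (+-identityˡ _))
  coord-⊥ {suc m} b⊥γ (suc p) = coord-⊥ (b⊥γ ∘ suc) p

  coord-link-zero : ∀ {m} {b : Family (2 ℕ.+ m)} {γ} → (∀ i → ForkLink γ b i) →
                    cartan E (coord b zero) γ ≈ - 2#
  coord-link-zero {zero} link = trans (cartan-+ E _ _ _)
    (trans (+-cong (proj₂ (link 0F)) (proj₂ (link 1F))) (-‿+-comm _ _))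
  coord-link-zero {suc m} link = trans (cartan-lin _ _ _ _)
    (trans (+-cong (trans (*-congˡ (proj₂ (link zero))) (x*-1≈-x _))
                   (coord-⊥ (λ i → ⊥-sym (link (suc i))) zero))
           (+-identityʳ _))

  coord-link-suc : ∀ {m} {b : Family (2 ℕ.+ m)} {γ} → (∀ i → ForkLink γ b i) → ∀ p →
                   cartan E (coord b (suc p)) γ ≈ 0#
  coord-link-suc {zero} link zero = trans (cartan-diff _ _ _)
    (trans (+-cong (proj₂ (link 1F)) (-‿cong (proj₂ (link 0F)))) (-‿inverseʳ _))
  coord-link-suc {suc m} link p = coord-⊥ (λ i → ⊥-sym (link (suc i))) p

  2*2-2≈2 : 2# * 2# + - 2# ≈ 2#
  2*2-2≈2 = trans (+-congʳ (trans (distribˡ _ _ _) (+-cong (*-identityʳ _) (*-identityʳ _))))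
    (trans (+-assoc _ _ _) (trans (+-congˡ (-‿inverseʳ _)) (+-identityʳ _)))

  coord-zero : ∀ {m} {b : Family (2 ℕ.+ m)} → IsFork b → cartan E (coord b zero) (b zero) ≈ 2#
  coord-zero (base r₀ r₁ o) = trans (cartan-+ E _ _ _)
    (trans (+-cong r₀ (proj₂ o)) (+-identityʳ _))
  coord-zero ((root , link) , fork) = trans (cartan-lin _ _ _ _)
    (trans (+-cong (*-congˡ root) (coord-link-zero link)) 2*2-2≈2)

  coord-start : ∀ {m} {b : Family (3 ℕ.+ m)} → IsFork b → ∀ i →
                cartan E (coord b zero) (b (suc i)) ≈ 0#
  coord-start {b = b} ((_ , link) , fork) i =
    trans (cartan-lin _ _ _ _) (trans (+-congˡ (tail fork link i)) (-‿inverseʳ _))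
    where
    -- On the roots of the tail, γ pairs like minus half the first coordinate vector of the tail; so
    -- the two summands of `coord b zero` cancel there.
    tail : ∀ {m} {γ} {b : Family (2 ℕ.+ m)} → IsFork b → (∀ i → ForkLink γ b i) → ∀ i →
           cartan E (coord b zero) (b i) ≈ - (2# * cartan E γ (b i))
    tail fork@(base r₀ r₁ o) link 0F =
      trans (coord-zero fork) (sym (trans (-‿cong (trans (*-congˡ (proj₁ (link 0F))) (x*-1≈-x _))) (-‿involutive _)))
    tail (base r₀ r₁ o) link 1F = trans (cartan-+ E _ _ _) (trans (+-cong (proj₁ o) r₁)
      (trans (+-identityˡ _) (sym (trans (-‿cong (trans (*-congˡ (proj₁ (link 1F))) (x*-1≈-x _))) (-‿involutive _)))))
    tail fork@(_ , _) link zero =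
      trans (coord-zero fork) (sym (trans (-‿cong (trans (*-congˡ (proj₁ (link zero))) (x*-1≈-x _))) (-‿involutive _)))
    tail fork@(_ , _) link (suc i) =
      trans (coord-start fork i) (sym (trans (-‿cong (trans (*-congˡ (proj₁ (link (suc i)))) (zeroʳ _))) -0#≈0#))

  SignedCoord : ℕ → Set
  SignedCoord m = Fin (2 ℕ.+ m) ⊎ Fin (2 ℕ.+ m)

  signed : ∀ {m} → Family (2 ℕ.+ m) → SignedCoord m → Carrierᴹ
  signed b = [ coord b , (λ p → -ᴹ (coord b p)) ]′

  -- The height of - ε p; that of ε p is p.
  height⁻ : ∀ {m} → Fin (2 ℕ.+ m) → ℕ
  height⁻ {zero}  0F      = 2
  height⁻ {zero}  1F      = 1
  height⁻ {suc m} zero    = 2 ℕ.+ height⁻ {m} zero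
  height⁻ {suc m} (suc p) = suc (height⁻ {m} p)

  forkWeights : ∀ {m} (b : Family (2 ℕ.+ m)) → Weights b
  forkWeights {m} b = record
    { Weight = SignedCoord m ; vec = signed b ; height = [ toℕ , height⁻ ]′ ; M = 2# }

  module _ {m} {b : Family (2 ℕ.+ m)} where
    open Weights (forkWeights b) public using () renaming (Up to ForkUp; Move to ForkMove)

  lift-signed : ∀ {m} → SignedCoord m → SignedCoord (suc m)
  lift-signed = Sum.map suc suc

  -- The clauses differ only in their constructors; matching on these lets `vec` and `height`
  -- compute on the lifted weights.
  fork-up-suc : ∀ {m} {b : Family (3 ℕ.+ m)} {i} q q′ → ForkUp {b = b ∘ suc} i q q′ →
                ForkUp {b = b} (suc i) (lift-signed q) (lift-signed q′)
  fork-up-suc (inj₁ _) (inj₁ _) (Weights.mkUp p t r) = Weights.mkUp p t (≡.cong suc r)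
  fork-up-suc (inj₁ _) (inj₂ _) (Weights.mkUp p t r) = Weights.mkUp p t (≡.cong suc r)
  fork-up-suc (inj₂ _) (inj₁ _) (Weights.mkUp p t r) = Weights.mkUp p t (≡.cong suc r)
  fork-up-suc (inj₂ _) (inj₂ _) (Weights.mkUp p t r) = Weights.mkUp p t (≡.cong suc r)

  reflect-2 : ∀ {β x} → cartan E x β ≈ 2# → reflect E β x ≈ᴹ x +ᴹ -ᴹ (β +ᴹ β)
  reflect-2 {β} eq = +ᴹ-congˡ (-ᴹ‿cong (≈ᴹ-trans (*ₗ-cong eq ≈ᴹ-refl)
    (≈ᴹ-trans (*ₗ-distribʳ β _ _) (+ᴹ-cong (*ₗ-identityˡ β) (*ₗ-identityˡ β)))))

  reflect-neg : ∀ β x → reflect E β (-ᴹ x) ≈ᴹ -ᴹ (reflect E β x)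
  reflect-neg β x = ≈ᴹ-trans (reflect-cong E β (-ᴹ≈-1*ₗ E x))
    (≈ᴹ-trans (reflect-* E β _ x) (≈ᴹ-sym (-ᴹ≈-1*ₗ E _)))

  [x+y]-[x+x]≈y-x : ∀ x y → (x +ᴹ y) +ᴹ -ᴹ (x +ᴹ x) ≈ᴹ y +ᴹ -ᴹ x
  [x+y]-[x+x]≈y-x x y = ≈ᴹ.begin
    (x +ᴹ y) +ᴹ -ᴹ (x +ᴹ x)         ≈ᴹ.≈⟨ +ᴹ-cong (+ᴹ-comm x y) (≈ᴹ-sym (AG.⁻¹-∙-comm x x)) ⟩
    (y +ᴹ x) +ᴹ (-ᴹ x +ᴹ -ᴹ x)      ≈ᴹ.≈⟨ ≈ᴹ-trans (+ᴹ-assoc _ _ _) (+ᴹ-congˡ (≈ᴹ-sym (+ᴹ-assoc _ _ _))) ⟩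
    y +ᴹ ((x +ᴹ -ᴹ x) +ᴹ -ᴹ x)      ≈ᴹ.≈⟨ +ᴹ-congˡ (≈ᴹ-trans (+ᴹ-congʳ (-ᴹ‿inverseʳ x)) (+ᴹ-identityˡ _)) ⟩
    y +ᴹ -ᴹ x                       ≈ᴹ.∎

  coord-base-1 : {b : Family 2} → IsFork b → cartan E (coord b zero) (b 1F) ≈ 2#
  coord-base-1 (base r₀ r₁ o) = trans (cartan-+ E _ _ _) (trans (+-cong (proj₁ o) r₁) (+-identityˡ _))

  coord-swap : ∀ {m} {b : Family (2 ℕ.+ m)} → IsFork b →
               coord b 1F ≈ᴹ reflect E (b zero) (coord b zero)
  coord-swap fork@(base r₀ r₁ o) = ≈ᴹ-sym (≈ᴹ-trans (reflect-2 (coord-zero fork)) ([x+y]-[x+x]≈y-x _ _))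
  coord-swap {suc m} {b} fork@(_ , _) = ≈ᴹ-sym (≈ᴹ.begin
    reflect E (b zero) (2# *ₗ b zero +ᴹ x)     ≈ᴹ.≈⟨ reflect-value (coord-zero fork) ⟩
    (2# *ₗ b zero +ᴹ x) +ᴹ (- 2#) *ₗ b zero    ≈ᴹ.≈⟨ +ᴹ-cong (+ᴹ-comm _ _) (≈ᴹ-sym (-ᴹ-*ₗ E _ _)) ⟩
    (x +ᴹ 2# *ₗ b zero) +ᴹ -ᴹ (2# *ₗ b zero)   ≈ᴹ.≈⟨ ≈ᴹ-trans (+ᴹ-assoc _ _ _) (+ᴹ-congˡ (-ᴹ‿inverseʳ _)) ⟩
    x +ᴹ 0ᴹ                                    ≈ᴹ.≈⟨ +ᴹ-identityʳ x ⟩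
    x                                          ≈ᴹ.∎)
    where x = coord (b ∘ suc) zero

  -- The last root is a sum of two coordinate vectors, so its reflection exchanges them with a
  -- change of sign. The passage from positive to negative weights happens only here.
  coord-swap⁻ : {b : Family 2} → IsFork b → -ᴹ (coord b 1F) ≈ᴹ reflect E (b 1F) (coord b 0F)
  coord-swap⁻ {b} fork = ≈ᴹ-sym (≈ᴹ.begin
    reflect E (b 1F) (b 0F +ᴹ b 1F)               ≈ᴹ.≈⟨ reflect-2 (coord-base-1 fork) ⟩
    (b 0F +ᴹ b 1F) +ᴹ -ᴹ (b 1F +ᴹ b 1F)           ≈ᴹ.≈⟨ +ᴹ-congʳ (+ᴹ-comm _ _) ⟩
    (b 1F +ᴹ b 0F) +ᴹ -ᴹ (b 1F +ᴹ b 1F)           ≈ᴹ.≈⟨ [x+y]-[x+x]≈y-x _ _ ⟩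
    b 0F +ᴹ -ᴹ b 1F                               ≈ᴹ.≈⟨ AG.⁻¹-anti-homo‿- (b 1F) (b 0F) ⟨
    -ᴹ (b 1F +ᴹ -ᴹ b 0F)                          ≈ᴹ.∎)

  fork-up₀ : ∀ {m} {b : Family (2 ℕ.+ m)} → IsFork b → ForkUp {b = b} zero (inj₁ 0F) (inj₁ 1F)
  fork-up₀ fork = Weights.mkUp (coord-zero fork) (coord-swap fork) ≡.refl

  coord-one : ∀ {m} {b : Family (2 ℕ.+ m)} → IsFork b → cartan E (coord b 1F) (b zero) ≈ - 2#
  coord-one fork = trans (cartan-congˡ E _ (coord-swap fork))
    (trans (cartan-reflect-self _ (fork-roots fork zero)) (-‿cong (coord-zero fork)))

  signed-neg : ∀ {x β k} → cartan E x β ≈ - k → cartan E (-ᴹ x) β ≈ k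
  signed-neg eq = trans (cartan-neg _ _) (trans (-‿cong eq) (-‿involutive _))

  signed-neg-0 : ∀ {x β} → cartan E x β ≈ 0# → cartan E (-ᴹ x) β ≈ 0#
  signed-neg-0 eq = signed-neg (trans eq (sym -0#≈0#))

  height⁻-zero : ∀ m → height⁻ {m} 0F ≡ suc (height⁻ {m} 1F)
  height⁻-zero zero    = ≡.refl
  height⁻-zero (suc m) = ≡.refl

  fork-up₀⁻ : ∀ {m} {b : Family (2 ℕ.+ m)} → IsFork b → ForkUp {b = b} zero (inj₂ 1F) (inj₂ 0F)
  fork-up₀⁻ {m} {b} fork = Weights.mkUp (signed-neg (coord-one fork))
    (≈ᴹ-sym (≈ᴹ-trans (reflect-neg _ _) (-ᴹ‿cong (≈ᴹ-trans (reflect-cong E _ (coord-swap fork))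
      (reflect² (fork-roots fork) zero _)))))
    (height⁻-zero m)

  fork-up₁ : {b : Family 2} → IsFork b → ForkUp {b = b} 1F (inj₁ 0F) (inj₂ 1F)
  fork-up₁ fork = Weights.mkUp (coord-base-1 fork) (coord-swap⁻ fork) ≡.refl

  fork-up₁′ : {b : Family 2} → IsFork b → ForkUp {b = b} 1F (inj₁ 1F) (inj₂ 0F)
  fork-up₁′ fork@(base r₀ r₁ o) = Weights.mkUp
    (trans (cartan-diff _ _ _) (trans (+-cong r₁ (trans (-‿cong (proj₁ o)) -0#≈0#)) (+-identityʳ _)))
    (≈ᴹ-sym (≈ᴹ-trans (reflect-cong E _ (≈ᴹ-trans (≈ᴹ-sym (AG.⁻¹-involutive _)) (-ᴹ‿cong (coord-swap⁻ fork))))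
      (≈ᴹ-trans (reflect-neg _ _) (-ᴹ‿cong (reflect-involutive E (root≉0 r₁) _)))))
    ≡.refl

  fork-move : ∀ {m} {b : Family (2 ℕ.+ m)} → IsFork b → ∀ i q → ForkMove {b = b} i q
  fork-move fork zero (inj₁ zero)       = Weights.up (fork-up₀ fork)
  fork-move fork zero (inj₁ (suc zero)) = Weights.down (fork-up₀ fork)
  fork-move fork zero (inj₂ zero)       = Weights.down (fork-up₀⁻ fork)
  fork-move fork zero (inj₂ (suc zero)) = Weights.up (fork-up₀⁻ fork)
  fork-move {suc m} ((_ , link) , _) zero (inj₁ (suc (suc p))) =
    Weights.fix (coord-link-suc link p)
  fork-move {suc m} ((_ , link) , _) zero (inj₂ (suc (suc p))) =
    Weights.fix (signed-neg-0 (coord-link-suc link p))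
  fork-move {zero} fork 1F (inj₁ 0F) = Weights.up (fork-up₁ fork)
  fork-move {zero} fork 1F (inj₁ 1F) = Weights.up (fork-up₁′ fork)
  fork-move {zero} fork 1F (inj₂ 0F) = Weights.down (fork-up₁′ fork)
  fork-move {zero} fork 1F (inj₂ 1F) = Weights.down (fork-up₁ fork)
  fork-move {suc m} fork (suc i) (inj₁ zero) = Weights.fix (coord-start fork i)
  fork-move {suc m} fork (suc i) (inj₂ zero) = Weights.fix (signed-neg-0 (coord-start fork i))
  fork-move {suc m} (_ , fork) (suc i) (inj₁ (suc p)) with fork-move fork i (inj₁ p)
  ... | Weights.up {q′} u   = Weights.up (fork-up-suc (inj₁ p) q′ u)
  ... | Weights.fix e       = Weights.fix e
  ... | Weights.down {q′} u = Weights.down (fork-up-suc q′ (inj₁ p) u)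
  fork-move {suc m} (_ , fork) (suc i) (inj₂ (suc p)) with fork-move fork i (inj₂ p)
  ... | Weights.up {q′} u   = Weights.up (fork-up-suc (inj₂ p) q′ u)
  ... | Weights.fix e       = Weights.fix e
  ... | Weights.down {q′} u = Weights.down (fork-up-suc q′ (inj₂ p) u)

  fork-up : ∀ {m} {b : Family (2 ℕ.+ m)} → IsFork b → ∀ i → ∃₂ λ q q′ → ForkUp {b = b} i q q′
  fork-up         fork       zero    = _ , _ , fork-up₀ fork
  fork-up {zero}  fork       1F      = _ , _ , fork-up₁ fork
  fork-up {suc m} (_ , fork) (suc i) with q , q′ , u ← fork-up fork i = _ , _ , fork-up-suc q q′ u

  2≉-2 : 2# ≉ - 2#
  2≉-2 eq = -2≉2 (sym eq)

  -2≉0 : - 2# ≉ 0#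
  -2≉0 = <⇒≉ (neg<0 (0<2))

  -- Used to tell coordinates apart: by `coord-start` the first coordinate is orthogonal to every
  -- root of the tail, and no coordinate of the tail is.
  coord-nonzero : ∀ {m} {b : Family (2 ℕ.+ m)} → IsFork b → ∀ p →
                  ∃ λ i → cartan E (coord b p) (b i) ≉ 0#
  coord-nonzero fork zero = zero , λ eq → 2≉0 (trans (sym (coord-zero fork)) eq)
  coord-nonzero fork@(base _ _ _) 1F = zero , λ eq → -2≉0 (trans (sym (coord-one fork)) eq)
  coord-nonzero (_ , fork) (suc p) with i , ≉0 ← coord-nonzero fork p = suc i , ≉0

  neg-nonzero : ∀ {x β} → cartan E x β ≉ 0# → cartan E (-ᴹ x) β ≉ 0#
  neg-nonzero ≉0 eq = ≉0 (trans (sym (trans (-‿cong (cartan-neg _ _)) (-‿involutive _))) (trans (-‿cong eq) -0#≈0#))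

  coord≉neg : ∀ {m} {b : Family (2 ℕ.+ m)} → IsFork b → ∀ p q → coord b p ≉ᴹ -ᴹ (coord b q)
  coord≉neg fork zero zero = cartan-separates (coord-zero fork)
    (trans (cartan-neg _ _) (-‿cong (coord-zero fork))) 2≉-2
  coord≉neg fork@(base _ _ _) 0F 1F eq = cartan-separates (coord-base-1 fork)
    (trans (cartan-congˡ E _ (coord-swap⁻ fork)) (trans (cartan-reflect-self _ (fork-roots fork 1F))
      (-‿cong (coord-base-1 fork)))) 2≉-2 eq
  coord≉neg fork@(base _ _ _) 1F 0F eq = coord≉neg fork 0F 1F
    (≈ᴹ-trans (≈ᴹ-sym (AG.⁻¹-involutive _)) (-ᴹ‿cong (≈ᴹ-sym eq)))
  coord≉neg fork@(base _ _ _) 1F 1F = cartan-separates (coord-one fork)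
    (signed-neg (coord-one fork)) (-2≉2)
  coord≉neg {suc m} fork@(_ , tail) zero (suc q) eq with i , ≉0 ← coord-nonzero tail q =
    neg-nonzero ≉0 (trans (cartan-congˡ E _ (≈ᴹ-sym eq)) (coord-start fork i))
  coord≉neg {suc m} fork@(_ , tail) (suc p) zero eq with i , ≉0 ← coord-nonzero tail p =
    ≉0 (trans (cartan-congˡ E _ eq) (signed-neg-0 (coord-start fork i)))
  coord≉neg {suc m} (_ , tail) (suc p) (suc q) = coord≉neg tail p q

  coord-injective : ∀ {m} {b : Family (2 ℕ.+ m)} → IsFork b → ∀ p q →
                    coord b p ≈ᴹ coord b q → p ≡ q
  coord-injective fork zero zero eq = ≡.refl
  coord-injective fork@(base _ _ _) 0F 1F eq =
    contradiction eq (cartan-separates (coord-zero fork) (coord-one fork) 2≉-2)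
  coord-injective fork@(base _ _ _) 1F 0F eq =
    contradiction eq (cartan-separates (coord-one fork) (coord-zero fork) (-2≉2))
  coord-injective fork@(base _ _ _) 1F 1F eq = ≡.refl
  coord-injective {suc m} fork@(_ , tail) zero (suc q) eq with i , ≉0 ← coord-nonzero tail q =
    contradiction (trans (cartan-congˡ E _ (≈ᴹ-sym eq)) (coord-start fork i)) ≉0
  coord-injective {suc m} fork@(_ , tail) (suc p) zero eq with i , ≉0 ← coord-nonzero tail p =
    contradiction (trans (cartan-congˡ E _ eq) (coord-start fork i)) ≉0
  coord-injective {suc m} (_ , tail) (suc p) (suc q) eq = ≡.cong suc (coord-injective tail p q eq)

  signed-injective : ∀ {m} {b : Family (2 ℕ.+ m)} → IsFork b → ∀ q q′ →
                     signed b q ≈ᴹ signed b q′ → q ≡ q′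
  signed-injective fork (inj₁ p) (inj₁ q) eq = ≡.cong inj₁ (coord-injective fork p q eq)
  signed-injective fork (inj₁ p) (inj₂ q) eq = contradiction eq (coord≉neg fork p q)
  signed-injective fork (inj₂ p) (inj₁ q) eq = contradiction (≈ᴹ-sym eq) (coord≉neg fork q p)
  signed-injective fork (inj₂ p) (inj₂ q) eq =
    ≡.cong inj₂ (coord-injective fork p q (AG.⁻¹-injective eq))

  fork-descends : ∀ {m} {b : Family (2 ℕ.+ m)} → IsFork b → ∀ q →
                  q ≡ inj₁ zero ⊎ ∃₂ λ i q′ → ForkUp {b = b} i q′ q
  fork-descends fork (inj₁ zero) = inj₁ ≡.refl
  fork-descends fork (inj₂ zero) = inj₂ (_ , _ , fork-up₀⁻ fork)
  fork-descends fork@(base _ _ _) (inj₁ 1F) = inj₂ (_ , _ , fork-up₀ fork)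
  fork-descends fork@(base _ _ _) (inj₂ 1F) = inj₂ (_ , _ , fork-up₁ fork)
  fork-descends fork@(_ , tail) (inj₁ (suc p)) with fork-descends tail (inj₁ p)
  ... | inj₁ ≡.refl       = inj₂ (_ , _ , fork-up₀ fork)
  ... | inj₂ (i , q′ , u) = inj₂ (_ , _ , fork-up-suc q′ (inj₁ p) u)
  fork-descends (_ , tail) (inj₂ (suc p)) with fork-descends tail (inj₂ p)
  ... | inj₂ (i , q′ , u) = inj₂ (_ , _ , fork-up-suc q′ (inj₂ p) u)

  forkMinuscule : ∀ {m} {b : Family (2 ℕ.+ m)} → IsFork b → Minuscule b
  forkMinuscule {m} {b} fork = record
    { weights   = forkWeights b
    ; 0<M       = 0<2
    ; injective = signed-injective fork _ _
    ; move      = fork-move fork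
    ; q₀        = inj₁ zero
    ; height₀   = ≡.refl
    ; descends  = fork-descends fork
    }

  -- Starts at three nodes: on D_2 the first coordinate pairs to 2 with both roots, so that
  -- `b ∘ suc` does not lie in its stabilizer.
  fork-step : ∀ {m n} {b : Family (3 ℕ.+ m)} → IsFork b →
              HasCardinality (GL E) (ReflectionGroup (b ∘ suc)) n →
              HasCardinality (GL E) (ReflectionGroup b) (((3 ℕ.+ m) ℕ.+ (3 ℕ.+ m)) ℕ.* n)
  fork-step fork = orbit-stabilizer (fork-roots fork) (fork-laced fork) (forkMinuscule fork)
    (coord-zero fork) (coord-start fork) (↔-sym Fin.+↔⊎)

  -- An isolated node is a factor A_1 with the two weights ± `b zero`. A root is twice its own
  -- fundamental weight, hence `M` is 2.
  orthogonal-step : ∀ {k n} {b : Family (suc k)} → Roots b → SimplyLaced b →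
                    (∀ i → b zero ⊥ b (suc i)) →
                    HasCardinality (GL E) (ReflectionGroup (b ∘ suc)) n →
                    HasCardinality (GL E) (ReflectionGroup b) (2 ℕ.* n)
  orthogonal-step {b = b} roots laced orth = orbit-stabilizer roots laced Q
    (roots zero) (λ i → proj₁ (orth i)) (↔-id _)
    where
    vec : Fin 2 → Carrierᴹ
    vec 0F = b zero
    vec 1F = reflect E (b zero) (b zero)
    ws : Weights b
    ws = record { Weight = Fin 2 ; vec = vec ; height = toℕ ; M = 2# }
    open Weights ws using (Up; mkUp; Move; up; fix; down)
    rise₀ : Up zero 0F 1F
    rise₀ = mkUp (roots zero) ≈ᴹ-refl ≡.refl
    b≉-b : b zero ≉ᴹ reflect E (b zero) (b zero)
    b≉-b = cartan-separates (roots zero)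
      (trans (cartan-reflect-self _ (roots zero)) (-‿cong (roots zero))) 2≉-2
    inj : ∀ {q q′} → vec q ≈ᴹ vec q′ → q ≡ q′
    inj {0F} {0F} _  = ≡.refl
    inj {0F} {1F} eq = contradiction eq b≉-b
    inj {1F} {0F} eq = contradiction (≈ᴹ-sym eq) b≉-b
    inj {1F} {1F} _  = ≡.refl
    mv : ∀ i q → Move i q
    mv zero    0F = up rise₀
    mv zero    1F = down rise₀
    mv (suc i) 0F = fix (proj₁ (orth i))
    mv (suc i) 1F = fix (trans (cartan-reflect-⊥ _ (orth i)) (proj₁ (orth i)))
    Q : Minuscule b
    Q = record
      { weights = ws ; 0<M = 0<2 ; injective = inj ; move = mv ; q₀ = 0F ; height₀ = ≡.refl
      ; descends = λ { 0F → inj₁ ≡.refl ; 1F → inj₂ (_ , _ , rise₀) }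
      }

  fork-finite : ∀ {m} {b : Family (2 ℕ.+ m)} → IsFork b → IsFinite (ReflectionGroup b)
  fork-finite fork@(base _ r₁ o) with n , n≢0 , card ← path-finite ((r₁ , λ ()) , []) =
    2 ℕ.* n , ℕ.m*n≢0 2 n {{_}} {{n≢0}} ,
    orthogonal-step (fork-roots fork) (fork-laced fork) (λ { zero → o }) card
  fork-finite {suc m} fork@(_ , tail) with n , n≢0 , card ← fork-finite tail =
    ((3 ℕ.+ m) ℕ.+ (3 ℕ.+ m)) ℕ.* n , ℕ.m*n≢0 ((3 ℕ.+ m) ℕ.+ (3 ℕ.+ m)) n {{_}} {{n≢0}} , fork-step fork card

  fork-commutes : ∀ {m} {b : Family (3 ℕ.+ m)} → IsFork b →
                  (t : Fin (3 ℕ.+ m) → LinearAutomorphism E) → Realizes t b → Fork (tabulate t)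
  fork-commutes (_ , base _ _ o) t real =
    base (realizes-commute {g = t 1F} {h = t (suc 1F)} (real 1F) (real (suc 1F)) o)
  fork-commutes ((_ , link) , fork@(_ , _)) t real = cons
    (All.tabulate⁺ {f = λ i → t (suc (suc i))} (λ i → realizes-commute {g = t zero} {h = t (suc (suc i))}
      (real zero) (real (suc (suc i))) (link (suc i))))
    (fork-commutes fork (t ∘ suc) (real ∘ suc))

  -- On D_2 the product negates both coordinates. A reflection added in front swaps ε 0 and ε 1,
  -- while the tail product fixes ε 0; this inserts ε 0 before ε 1 and turns the final value - ε 1
  -- into - ε 0.
  coxeter-fork : ∀ {m} {b : Family (2 ℕ.+ m)} → IsFork b →
    (t : Fin (2 ℕ.+ m) → LinearAutomorphism E) → Realizes t b →
    (∀ i → to (prod (GL E) t) (coord b (inject₁ (inject₁ i))) ≈ᴹ coord b (inject₁ (suc i))) ×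
    to (prod (GL E) t) (coord b (inject₁ (fromℕ m))) ≈ᴹ -ᴹ (coord b zero) ×
    to (prod (GL E) t) (coord b (fromℕ (suc m))) ≈ᴹ -ᴹ (coord b (fromℕ (suc m)))
  coxeter-fork {b = b} fork@(base r₀ r₁ o) t real =
    (λ ()) ,
    two-steps (Weights.Up.target (fork-up₁ fork)) (≈ᴹ-sym (Weights.Up.target (fork-up₀⁻ fork))) ,
    two-steps (Weights.Up.target (fork-up₁′ fork))
      (≈ᴹ-trans (reflect-neg _ _) (-ᴹ‿cong (≈ᴹ-sym (coord-swap fork))))
    where
    two-steps : ∀ {x y z} → y ≈ᴹ reflect E (b 1F) x → reflect E (b 0F) y ≈ᴹ z →
                to (t 0F) (to (t 1F) x) ≈ᴹ z
    two-steps y≈ z≈ = ≈ᴹ-trans (real 0F _)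
      (≈ᴹ-trans (reflect-cong E _ (≈ᴹ-trans (real 1F _) (≈ᴹ-sym y≈))) z≈)
  coxeter-fork {suc m} {b} fork@((root , link) , tail) t real = next , turn , last
    where
    g : LinearAutomorphism E
    g = prod (GL E) t
    ih = coxeter-fork tail (t ∘ suc) (real ∘ suc)
    next : ∀ i → to g (coord b (inject₁ (inject₁ i))) ≈ᴹ coord b (inject₁ (suc i))
    next zero    = ≈ᴹ-trans (to-cong (t zero) (group-fix (prod∈ (t ∘ suc) (real ∘ suc)) (coord-start fork)))
      (≈ᴹ-trans (real zero _) (≈ᴹ-sym (coord-swap fork)))
    next (suc i) = ≈ᴹ-trans (to-cong (t zero) (proj₁ ih i))
      (≈ᴹ-trans (real zero _) (reflect-fix (coord-link-suc link (inject₁ i))))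
    turn : to g (coord b (inject₁ (fromℕ (suc m)))) ≈ᴹ -ᴹ (coord b zero)
    turn = ≈ᴹ-trans (to-cong (t zero) (proj₁ (proj₂ ih)))
      (≈ᴹ-trans (real zero _) (≈ᴹ-sym (Weights.Up.target (fork-up₀⁻ fork))))
    last : to g (coord b (fromℕ (2 ℕ.+ m))) ≈ᴹ -ᴹ (coord b (fromℕ (2 ℕ.+ m)))
    last = ≈ᴹ-trans (to-cong (t zero) (proj₂ (proj₂ ih)))
      (≈ᴹ-trans (real zero _) (reflect-fix (signed-neg-0 (coord-link-suc link (fromℕ m)))))

  -- The product of the simple reflections permutes ± ε 0, …, ± ε (n - 2)
  -- in a cycle of length 2 (n - 1) and negates ε (n - 1).
  fork-order : ∀ {m} {b : Family (3 ℕ.+ m)} → IsFork b →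
               (t : Fin (3 ℕ.+ m) → LinearAutomorphism E) → Realizes t b →
               ∀ (π : Permutation′ (3 ℕ.+ m)) →
               HasOrder (GL E) (prod (GL E) (λ i → t (π ⟨$⟩ʳ i))) ((2 ℕ.+ m) ℕ.+ (2 ℕ.+ m))
  fork-order {m} {b} fork t real = order-permute t
    (fork-irrelevant _ (fork-commutes fork t real)) (s≤s z≤n , period , minimal)
    where
    N : ℕ
    N = 2 ℕ.+ m
    g : LinearAutomorphism E
    g = prod (GL E) t
    w : Fin N → Carrierᴹ
    w p = coord b (inject₁ p)
    cycle = coxeter-fork fork t real
    next : ∀ i → to g (w (inject₁ i)) ≈ᴹ w (suc i)
    next = proj₁ cycle
    half : to (power (GL E) N g) (w zero) ≈ᴹ -ᴹ (w zero)
    half = power-full g {w = w} next (proj₁ (proj₂ cycle))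
    power-minus : ∀ n x → to (power (GL E) n g) (-ᴹ x) ≈ᴹ -ᴹ (to (power (GL E) n g) x)
    power-minus n x = to-neg (power (GL E) n g) x
    full : to (power (GL E) (N ℕ.+ N) g) (w zero) ≈ᴹ w zero
    full = ≈ᴹ.begin
      to (power (GL E) (N ℕ.+ N) g) (w zero)                     ≈ᴹ.≈⟨ power-+ g N N _ ⟩
      to (power (GL E) N g) (to (power (GL E) N g) (w zero))     ≈ᴹ.≈⟨ power-cong g N half ⟩
      to (power (GL E) N g) (-ᴹ (w zero))                        ≈ᴹ.≈⟨ power-minus N _ ⟩
      -ᴹ (to (power (GL E) N g) (w zero))                        ≈ᴹ.≈⟨ -ᴹ‿cong half ⟩
      -ᴹ (-ᴹ (w zero))                                           ≈ᴹ.≈⟨ AG.⁻¹-involutive _ ⟩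
      w zero                                                     ≈ᴹ.∎
    fixes : ∀ p → to (power (GL E) (N ℕ.+ N) g) (coord b p) ≈ᴹ coord b p
    fixes p with view p
    ... | ‵fromℕ     = power-neg g N (proj₂ (proj₂ cycle))
    ... | ‵inject₁ i = power-returns g {w = w} next (N ℕ.+ N) full i
    period : ∀ y → to (power (GL E) (N ℕ.+ N) g) y ≈ᴹ y
    period = group-faithful (fork-roots fork)
      (minuscule-spans (fork-roots fork) (forkMinuscule fork) (fork-up fork))
      (power∈ (prod∈ t real) (N ℕ.+ N))
      λ { (inj₁ p) → fixes p
        ; (inj₂ p) → ≈ᴹ-trans (power-minus (N ℕ.+ N) _) (-ᴹ‿cong (fixes p)) }
    minimal : ∀ {j} → 0 ℕ.< j → power (GL E) j g GL.≈ GL.ε → N ℕ.+ N ℕ.≤ j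
    minimal {j} 0<j gʲ≈ε with N ℕ.+ N ℕ.≤? j | N ℕ.≤? j
    ... | yes 2N≤j | _ = 2N≤j
    ... | no  2N≰j | no N≰j with j<N ← ℕ.≰⇒> N≰j
      with Fin.inject₁-injective (coord-injective fork _ _
        (≈ᴹ-trans (≈ᴹ-sym (power-cycle< g {w = w} next j<N)) (gʲ≈ε _)))
    ...   | eq = contradiction
      (≡.trans (≡.sym (Fin.toℕ-fromℕ< j<N)) (≡.cong toℕ eq)) (ℕ.>⇒≢ 0<j)
    minimal {j} 0<j gʲ≈ε | no 2N≰j | yes N≤j =
      contradiction w₀≈-wᵢ (coord≉neg fork zero (inject₁ (fromℕ< i<N)))
      where
      i<N : j ℕ.∸ N ℕ.< N
      i<N = ℕ.+-cancelʳ-< N _ _ (≡.subst (ℕ._< N ℕ.+ N) (≡.sym (ℕ.m∸n+n≡m N≤j)) (ℕ.≰⇒> 2N≰j))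
      w₀≈-wᵢ : w zero ≈ᴹ -ᴹ (w (fromℕ< i<N))
      w₀≈-wᵢ = ≈ᴹ.begin
        w zero                                                         ≈ᴹ.≈⟨ gʲ≈ε _ ⟨
        to (power (GL E) j g) (w zero)                                 ≈ᴹ.≈⟨ ≈ᴹ-reflexive (≡.cong (λ j → to (power (GL E) j g) (w zero)) (≡.sym (ℕ.m∸n+n≡m N≤j))) ⟩
        to (power (GL E) (j ℕ.∸ N ℕ.+ N) g) (w zero)                   ≈ᴹ.≈⟨ power-+ g (j ℕ.∸ N) N _ ⟩
        to (power (GL E) (j ℕ.∸ N) g) (to (power (GL E) N g) (w zero)) ≈ᴹ.≈⟨ power-cong g (j ℕ.∸ N) half ⟩
        to (power (GL E) (j ℕ.∸ N) g) (-ᴹ (w zero))                    ≈ᴹ.≈⟨ power-minus (j ℕ.∸ N) _ ⟩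
        -ᴹ (to (power (GL E) (j ℕ.∸ N) g) (w zero))                    ≈ᴹ.≈⟨ -ᴹ‿cong (power-cycle< g {w = w} next i<N) ⟩
        -ᴹ (w (fromℕ< i<N))                                            ≈ᴹ.∎

  -- Dynkin diagrams and their leaves

  fromℤ-2 : fromℤ (+ 2) ≈ 2#
  fromℤ-2 = +-congˡ (+-identityʳ 1#)

  fromℤ--1 : fromℤ ℤ.-1ℤ ≈ - 1#
  fromℤ--1 = -‿cong (+-identityʳ 1#)

  HasMatrix : ∀ {k} → Family k → (Fin k → Fin k → ℤ) → Set ℓ₁
  HasMatrix b C = ∀ i j → cartan E (b i) (b j) ≈ fromℤ (C i j)

  matrix-path : ∀ {k} {b : Family k} → HasMatrix b (cartanMatrix edgeA) → IsPath b
  matrix-path {zero}  mat = []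
  matrix-path {suc k} {b} mat = (trans (mat zero zero) fromℤ-2 , link) ,
    matrix-path (λ i j → mat (suc i) (suc j))
    where
    link : ∀ i → PathLink (b zero) (b ∘ suc) i
    link zero    = trans (mat 0F 1F) fromℤ--1 , trans (mat 1F 0F) fromℤ--1
    link (suc i) = mat zero (suc (suc i)) , mat (suc (suc i)) zero

  -- The tests in `edgeD` are unchanged when both indices and n drop by one, so removing node 0 is a
  -- matter of computation. For two and three nodes they describe D_2 and D_3.
  matrix-fork : ∀ {m} {b : Family (2 ℕ.+ m)} → HasMatrix b (cartanMatrix edgeD) → IsFork b
  matrix-fork {zero} mat = base (trans (mat 0F 0F) fromℤ-2) (trans (mat 1F 1F) fromℤ-2)
    (mat 0F 1F , mat 1F 0F)
  matrix-fork {suc m} {b} mat = (trans (mat zero zero) fromℤ-2 , link m mat) ,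
    matrix-fork (λ i j → mat (suc i) (suc j))
    where
    link : ∀ m {b : Family (3 ℕ.+ m)} → HasMatrix b (cartanMatrix edgeD) →
           ∀ i → ForkLink (b zero) (b ∘ suc) i
    link zero    mat 0F = trans (mat 0F 1F) fromℤ--1 , trans (mat 1F 0F) fromℤ--1
    link zero    mat 1F = trans (mat 0F (suc 1F)) fromℤ--1 , trans (mat (suc 1F) 0F) fromℤ--1
    -- In the transposed entry the test for the extra edge is stuck at a conjunction of an undecided
    -- condition with false.
    link (suc m) mat zero with p ← mat 1F 0F rewrite ∧-zeroʳ (0 ℕ.≡ᵇ m) =
      trans (mat 0F 1F) fromℤ--1 , trans p fromℤ--1
    link (suc m) mat (suc i) with p ← mat zero (suc (suc i)) | q ← mat (suc (suc i)) zero
      rewrite ∧-zeroʳ (suc (toℕ i) ℕ.≡ᵇ m) = p , q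

  path-adjacent : ∀ {k} {b : Family k} → IsPath b → ∀ i j → suc (toℕ i) ≡ toℕ j → Adj (b i) (b j)
  path-adjacent ((_ , link) , _) zero (suc zero) eq = link zero
  path-adjacent (_ , path) (suc i) (suc j) eq = path-adjacent path i j (ℕ.suc-injective eq)

  path-apart : ∀ {k} {b : Family k} → IsPath b → ∀ i j → suc (toℕ i) ℕ.< toℕ j → b i ⊥ b j
  path-apart _ zero (suc zero) (s≤s ())
  path-apart ((_ , link) , _) zero (suc (suc j)) lt = link (suc j)
  path-apart (_ , path) (suc i) (suc j) lt = path-apart path i j (ℕ.s<s⁻¹ lt)

  -- A description by the distance of indices survives reversal, while `IsPath` itself favours one
  -- end.
  path-intro : ∀ {k} {b : Family k} → Roots b →
               (∀ i j → suc (toℕ i) ≡ toℕ j → Adj (b i) (b j)) →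
               (∀ i j → suc (toℕ i) ℕ.< toℕ j → b i ⊥ b j) → IsPath b
  path-intro {zero}      roots adj apart = []
  path-intro {suc k} {b} roots adj apart = (roots zero , link) ,
    path-intro (roots ∘ suc) (λ i j → adj (suc i) (suc j) ∘ ≡.cong suc)
                             (λ i j → apart (suc i) (suc j) ∘ s≤s)
    where
    link : ∀ i → PathLink (b zero) (b ∘ suc) i
    link zero    = adj zero (suc zero) ≡.refl
    link (suc i) = apart zero (suc (suc i)) (s≤s (s≤s z≤n))

  toℕ-opposite : ∀ {k} (i : Fin k) → toℕ (Fin.opposite i) ℕ.+ suc (toℕ i) ≡ k
  toℕ-opposite {k} i = ≡.trans (≡.cong (ℕ._+ suc (toℕ i)) (Fin.opposite-prop i)) (ℕ.m∸n+n≡m (Fin.toℕ<n i))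

  path-reverse : ∀ {k} {b : Family k} → IsPath b → IsPath (b ∘ Fin.opposite)
  path-reverse {k} path = path-intro (path-roots path ∘ Fin.opposite)
    (λ i j eq → let p , q = path-adjacent path _ _ (adj i j eq) in q , p)
    (λ i j lt → ⊥-sym (path-apart path _ _ (apart i j lt)))
    where
    balance : ∀ (i j : Fin k) → toℕ (Fin.opposite i) ℕ.+ suc (toℕ i) ≡ toℕ (Fin.opposite j) ℕ.+ suc (toℕ j)
    balance i j = ≡.trans (toℕ-opposite i) (≡.sym (toℕ-opposite j))
    adj : ∀ (i j : Fin k) → suc (toℕ i) ≡ toℕ j → suc (toℕ (Fin.opposite j)) ≡ toℕ (Fin.opposite i)
    adj i j eq = ≡.sym (ℕ.+-cancelʳ-≡ (suc (toℕ i)) _ _ (≡.trans (balance i j)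
      (≡.trans (ℕ.+-suc _ _) (≡.cong (λ z → suc (toℕ (Fin.opposite j) ℕ.+ z)) (≡.sym eq)))))
    apart : ∀ (i j : Fin k) → suc (toℕ i) ℕ.< toℕ j → suc (toℕ (Fin.opposite j)) ℕ.< toℕ (Fin.opposite i)
    apart i j lt = ℕ.+-cancelʳ-< (suc (toℕ i)) _ _ (ℕ.<-≤-trans
      (≡.subst (suc (toℕ (Fin.opposite j)) ℕ.+ suc (toℕ i) ℕ.<_) (≡.sym (ℕ.+-suc _ _))
        (s≤s (ℕ.+-monoʳ-< (toℕ (Fin.opposite j)) lt)))
      (ℕ.≤-reflexive (≡.sym (balance i j))))

  fork-init : ∀ {m} {b : Family (2 ℕ.+ m)} → IsFork b → IsPath (b ∘ inject₁)
  fork-init (base r₀ _ _) = (r₀ , λ ()) , []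
  fork-init {suc m} {b} ((root , link) , fork) = (root , init m link) , fork-init fork
    where
    init : ∀ m {γ} {b : Family (2 ℕ.+ m)} → (∀ i → ForkLink γ b i) →
           ∀ i → PathLink γ (b ∘ inject₁) i
    init zero    link zero    = link zero
    init (suc m) link zero    = link zero
    init (suc m) link (suc i) = link (suc (inject₁ i))

  -- With n = m + 2 nodes the branch node is n - 3 = m - 1. Writing this with `suc` covers D_2,
  -- which has no branch node.
  fork-last : ∀ {m} {b : Family (2 ℕ.+ m)} → IsFork b → ∀ i →
              (suc (toℕ i) ≡ m × Adj (b (inject₁ i)) (b (fromℕ (suc m)))) ⊎
              (suc (toℕ i) ≢ m × b (inject₁ i) ⊥ b (fromℕ (suc m)))
  fork-last (base _ _ o) zero = inj₂ ((λ ()) , o)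
  fork-last {suc zero}    ((_ , link) , _) zero = inj₁ (≡.refl , link 1F)
  fork-last {suc (suc m)} ((_ , link) , _) zero = inj₂ ((λ ()) , link (fromℕ (2 ℕ.+ m)))
  fork-last {suc m} (_ , fork) (suc i) = Sum.map
    (λ (eq , x) → ≡.cong suc eq , x) (λ (neq , x) → neq ∘ ℕ.suc-injective , x) (fork-last fork i)

  Leaf : ∀ {k} → Family k → Fin k → Set ℓ₁
  Leaf b p = ∀ {i j} → Adj (b p) (b i) → Adj (b p) (b j) → i ≡ j

  leaf-tail : ∀ {k} {b : Family (suc k)} {p} → Leaf b (suc p) → Leaf (b ∘ suc) p
  leaf-tail leaf x y = Fin.suc-injective (leaf x y)

  Adj-sym : ∀ {β γ} → Adj β γ → Adj γ β
  Adj-sym (p , q) = q , p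

  path-leaf : ∀ {k} {b : Family (suc k)} → IsPath b → ∀ p → Leaf b p → p ≡ zero ⊎ p ≡ fromℕ k
  path-leaf path zero leaf = inj₁ ≡.refl
  path-leaf {suc zero} path (suc zero) leaf = inj₂ ≡.refl
  path-leaf {suc (suc k)} ((_ , link) , ((_ , link′) , _)) (suc zero) leaf
    with () ← leaf (Adj-sym (link zero)) (link′ zero)
  path-leaf {suc (suc k)} (_ , path) (suc (suc p)) leaf
    with inj₂ eq ← path-leaf path (suc p) (leaf-tail leaf) = inj₂ (≡.cong suc eq)

  fork-leaf : ∀ {m} {b : Family (3 ℕ.+ m)} → IsFork b → ∀ p → Leaf b (suc p) →
              suc p ≡ fromℕ (2 ℕ.+ m) ⊎ suc p ≡ inject₁ (fromℕ (1 ℕ.+ m))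
  fork-leaf {zero} _ zero       leaf = inj₂ ≡.refl
  fork-leaf {zero} _ (suc zero) leaf = inj₁ ≡.refl
  fork-leaf {suc m} ((_ , link) , fork) (suc p) leaf =
    Sum.map (≡.cong suc) (≡.cong suc) (fork-leaf fork p (leaf-tail leaf))
  fork-leaf {suc zero} ((_ , link) , ((_ , link′) , _)) zero leaf
    with () ← leaf (Adj-sym (link zero)) (link′ zero)
  fork-leaf {suc (suc m)} ((_ , link) , ((_ , link′) , _)) zero leaf
    with () ← leaf (Adj-sym (link zero)) (link′ zero)

  -- The diagram automorphism that exchanges the two tips; it carries one branch leaf to the other.
  fork-flip : ∀ {m} → Fin (2 ℕ.+ m) → Fin (2 ℕ.+ m)
  fork-flip {zero}  0F      = 1F
  fork-flip {zero}  1F      = 0F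
  fork-flip {suc m} zero    = zero
  fork-flip {suc m} (suc i) = suc (fork-flip i)

  fork-flip-involutive : ∀ {m} (i : Fin (2 ℕ.+ m)) → fork-flip (fork-flip i) ≡ i
  fork-flip-involutive {zero}  0F      = ≡.refl
  fork-flip-involutive {zero}  1F      = ≡.refl
  fork-flip-involutive {suc m} zero    = ≡.refl
  fork-flip-involutive {suc m} (suc i) = ≡.cong suc (fork-flip-involutive i)

  fork-flip-last : ∀ m → fork-flip (fromℕ (suc m)) ≡ inject₁ (fromℕ m)
  fork-flip-last zero    = ≡.refl
  fork-flip-last (suc m) = ≡.cong suc (fork-flip-last m)

  fork-flipped : ∀ {m} {b : Family (2 ℕ.+ m)} → IsFork b → IsFork (b ∘ fork-flip)
  fork-flipped (base r₀ r₁ o) = base r₁ r₀ (⊥-sym o)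
  fork-flipped {suc m} {b} ((root , link) , fork) = (root , flipped m link) , fork-flipped fork
    where
    flipped : ∀ m {γ} {b : Family (2 ℕ.+ m)} → (∀ i → ForkLink γ b i) →
              ∀ i → ForkLink γ (b ∘ fork-flip) i
    flipped zero    link i       = link (fork-flip i)
    flipped (suc m) link zero    = link zero
    flipped (suc m) link (suc i) = link (suc (fork-flip i))

  flip-permutation : ∀ m → Permutation′ (2 ℕ.+ m)
  flip-permutation m = Perm.permutation fork-flip fork-flip fork-flip-involutive fork-flip-involutive

  prod-cong : ∀ {k} {t u : Fin k → LinearAutomorphism E} → (∀ i → t i ≡ u i) →
              prod (GL E) t GL.≈ prod (GL E) u
  prod-cong {zero}  eq x = ≈ᴹ-refl
  prod-cong {suc k} {t} {u} eq x = ≈ᴹ-trans (≈ᴹ-reflexive (≡.cong (λ g → to g _) (eq zero)))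
    (to-cong (u zero) (prod-cong (eq ∘ suc) x))

  ⟪⟫≈0⇒cartan≈0 : ∀ {x β} → ⟪ x , β ⟫ ≈ 0# → cartan E x β ≈ 0#
  ⟪⟫≈0⇒cartan≈0 eq = trans (*-congʳ (trans (*-congˡ eq) (zeroʳ _))) (zeroˡ _)

  cartan≈0⇒⟪⟫≈0 : ∀ {x β} → Root β → cartan E x β ≈ 0# → ⟪ x , β ⟫ ≈ 0#
  cartan≈0⇒⟪⟫≈0 {x} {β} root eq = *-cancel-0 2≉0 (begin
    2# * ⟪ x , β ⟫                                ≈⟨ sym (*-identityʳ _) ⟩
    2# * ⟪ x , β ⟫ * 1#                           ≈⟨ *-congˡ (sym (trans (*-comm _ _) (⁻¹-inverseʳ (root≉0 root ∘ definite)))) ⟩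
    2# * ⟪ x , β ⟫ * (⟪ β , β ⟫ ⁻¹ * ⟪ β , β ⟫)   ≈⟨ sym (*-assoc _ _ _) ⟩
    cartan E x β * ⟪ β , β ⟫                      ≈⟨ *-congʳ eq ⟩
    0# * ⟪ β , β ⟫                                ≈⟨ zeroˡ _ ⟩
    0#                                            ∎)

  root-⟪⟫≉0 : ∀ {β} → Root β → ⟪ β , β ⟫ ≉ 0#
  root-⟪⟫≉0 root eq = 2≉0 (trans (sym root) (⟪⟫≈0⇒cartan≈0 eq))

  -1≉0 : - 1# ≉ 0#
  -1≉0 = <⇒≉ (neg<0 0<1)

  adj-⟪⟫≉0 : ∀ {β γ} → Adj β γ → ⟪ β , γ ⟫ ≉ 0#
  adj-⟪⟫≉0 (p , _) eq = -1≉0 (trans (sym p) (⟪⟫≈0⇒cartan≈0 eq))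

  -- From families of vectors to simple systems

  module _ {Φ : RootSystem E p} {k} (Π : SimpleSystem Φ k) where
    open SimpleSystem Π

    Numbering : Permutation′ k → Family k → Set v
    Numbering σ b = ∀ i → simple (σ ⟨$⟩ʳ i) ≡ b i

    coxeterNumber : ∀ h (σ : Permutation′ k) {b} → Numbering σ b →
      (∀ t → Realizes t b → ∀ (π : Permutation′ k) → HasOrder (GL E) (prod (GL E) (λ i → t (π ⟨$⟩ʳ i))) h) →
      IsCoxeterNumber Π h
    coxeterNumber h σ num order π =
      -- In the standard numbering σ, the ordering π of the simple roots is the one that sends i to
      -- the σ-preimage of π i.
      ~-order {h = h} (~-reflexive {prod (GL E) (λ i → s (σ ⟨$⟩ʳ (π ∘ₚ flip σ ⟨$⟩ʳ i)))} {coxeterElement Π π} (prod-cong {t = λ i → s (σ ⟨$⟩ʳ (π ∘ₚ flip σ ⟨$⟩ʳ i))} {λ i → s (π ⟨$⟩ʳ i)}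
                             (λ i → ≡.cong s (Perm.inverseʳ σ))))
        (order (λ i → s (σ ⟨$⟩ʳ i))
          (λ i x → ≈ᴹ-reflexive (≡.cong (λ β → reflect E β x) (num i))) (π ∘ₚ flip σ))

    module _ {ℓ} {X : Pred (Fin k) ℓ} {l} {d : Family l}
             (index : Fin l → Fin k) (d≡ : ∀ j → d j ≡ simple (index j))
             (outside : ∀ j → index j ∉ X) (cover : ∀ i → i ∉ X → ∃ λ j → i ≡ index j) where

      parabolic-cardinality : ∀ {n} → HasCardinality (GL E) (ReflectionGroup d) n →
                              HasCardinality (GL E) (W Π X) n
      parabolic-cardinality = cardinality-cong {G = GL E} RG⊆W W⊆RG
        where
        RG⊆W : ReflectionGroup d ⊆ W Π X
        RG⊆W = generated-⊆ {G = GL E} λ {g} (j , eq) → resp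
          (λ x → ≈ᴹ-sym (≈ᴹ-trans (eq x) (≈ᴹ-reflexive (≡.cong (λ β → reflect E β x) (d≡ j)))))
          (gen (index j , outside j , ≡.refl))
        W⊆RG : W Π X ⊆ ReflectionGroup d
        W⊆RG = generated-⊆ {G = GL E} λ { (i , i∉X , ≡.refl) → gen (member i (cover i i∉X)) }
          where
          member : ∀ i → (∃ λ j → i ≡ index j) → ∃ λ j → ∀ x → reflect E (simple i) x ≈ᴹ reflect E (d j) x
          member i (j , eq) = j , λ x →
            ≈ᴹ-reflexive (≡.cong (λ β → reflect E β x) (≡.trans (≡.cong simple eq) (≡.sym (d≡ j))))

    -- Lying outside `Ñ[_] Π α` is only a negative statement; the dichotomy, read off the diagram,
    -- turns it into an index.
    stabilizer-cardinality : ∀ {l n} {α} → Root (simple α) → (index : Fin l → Fin k) →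
      (∀ j → simple (index j) ⊥ simple α) →
      (∀ i → (∃ λ j → i ≡ index j) ⊎ ⟪ simple i , simple α ⟫ ≉ 0#) →
      HasCardinality (GL E) (ReflectionGroup (simple ∘ index)) n →
      HasCardinality (GL E) (W Π (Ñ[_] Π α)) n
    stabilizer-cardinality root index orth dichotomy = parabolic-cardinality index (λ _ → ≡.refl)
      (λ j ≉0 → ≉0 (cartan≈0⇒⟪⟫≈0 root (proj₁ (orth j))))
      (λ i i∉ → [ (λ j → j) , (λ ≉0 → contradiction ≉0 i∉) ]′ (dichotomy i))

    leaf-numbering : (σ : Permutation′ k) → ∀ {p} → IsLeaf Π (σ ⟨$⟩ʳ p) →
                     Roots (λ i → simple (σ ⟨$⟩ʳ i)) → Leaf (λ i → simple (σ ⟨$⟩ʳ i)) p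
    leaf-numbering σ leaf roots x y = ⟨$⟩ʳ-injective (leaf (adjacent x) (adjacent y))
      where
      ⟨$⟩ʳ-injective : ∀ {i j} → σ ⟨$⟩ʳ i ≡ σ ⟨$⟩ʳ j → i ≡ j
      ⟨$⟩ʳ-injective eq = ≡.trans (≡.sym (Perm.inverseˡ σ)) (≡.trans (≡.cong (σ ⟨$⟩ˡ_) eq) (Perm.inverseˡ σ))
      2≉-1 : 2# ≉ - 1#
      2≉-1 eq = <⇒≉ (<-trans (neg<0 0<1) (0<2)) (sym eq)
      adjacent : ∀ {p i} → Adj (simple (σ ⟨$⟩ʳ p)) (simple (σ ⟨$⟩ʳ i)) → Adjacent Π (σ ⟨$⟩ʳ p) (σ ⟨$⟩ʳ i)
      adjacent {p} {i} adj = distinct , adj-⟪⟫≉0 adj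
        where
        distinct : σ ⟨$⟩ʳ p ≢ σ ⟨$⟩ʳ i
        distinct eq with ≡.refl ← ⟨$⟩ʳ-injective eq = 2≉-1 (trans (sym (roots p)) (proj₁ adj))

    ⟨$⟩ʳ-injective : ∀ (σ : Permutation′ k) {i j} → σ ⟨$⟩ʳ i ≡ σ ⟨$⟩ʳ j → i ≡ j
    ⟨$⟩ʳ-injective σ eq = ≡.trans (≡.sym (Perm.inverseˡ σ)) (≡.trans (≡.cong (σ ⟨$⟩ˡ_) eq) (Perm.inverseˡ σ))

    module _ (σ : Permutation′ k) (i : Fin k) {l} (f : Fin l → Fin k) where

      node-cardinality : ∀ {n} → (∀ j → f j ≢ i) → (∀ p → p ≢ i → ∃ λ j → p ≡ f j) →
        HasCardinality (GL E) (ReflectionGroup (λ j → simple (σ ⟨$⟩ʳ f j))) n →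
        HasCardinality (GL E) (W Π (_≡ σ ⟨$⟩ʳ i)) n
      node-cardinality f≢ cover = parabolic-cardinality (λ j → σ ⟨$⟩ʳ f j) (λ _ → ≡.refl)
        (λ j eq → f≢ j (⟨$⟩ʳ-injective σ eq))
        (λ q q≢ → let j , eq = cover (σ ⟨$⟩ˡ q) (λ eq → q≢ (≡.trans (≡.sym (Perm.inverseʳ σ)) (≡.cong (σ ⟨$⟩ʳ_) eq)))
                  in j , ≡.trans (≡.sym (Perm.inverseʳ σ)) (≡.cong (σ ⟨$⟩ʳ_) eq))

      neighbours-cardinality : ∀ {n} → Root (simple (σ ⟨$⟩ʳ i)) →
        (∀ j → simple (σ ⟨$⟩ʳ f j) ⊥ simple (σ ⟨$⟩ʳ i)) →
        (∀ p → (∃ λ j → p ≡ f j) ⊎ ⟪ simple (σ ⟨$⟩ʳ p) , simple (σ ⟨$⟩ʳ i) ⟫ ≉ 0#) →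
        HasCardinality (GL E) (ReflectionGroup (λ j → simple (σ ⟨$⟩ʳ f j))) n →
        HasCardinality (GL E) (W Π (Ñ[_] Π (σ ⟨$⟩ʳ i))) n
      neighbours-cardinality root orth dichotomy =
        stabilizer-cardinality root (λ j → σ ⟨$⟩ʳ f j) orth λ q → Sum.map
          (λ (j , eq) → j , ≡.trans (≡.sym (Perm.inverseʳ σ)) (≡.cong (σ ⟨$⟩ʳ_) eq))
          (λ ≉0 eq → ≉0 (trans (⟪⟫-cong (≈ᴹ-reflexive (≡.cong simple (Perm.inverseʳ σ))) ≈ᴹ-refl) eq))
          (dichotomy (σ ⟨$⟩ˡ q))

  suc-cover : ∀ {k} (p : Fin (suc k)) → p ≢ zero → ∃ λ j → p ≡ suc j
  suc-cover zero    p≢0 = contradiction ≡.refl p≢0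
  suc-cover (suc j) _   = j , ≡.refl

  -- The identity at each kind of leaf

  module _ {Φ : RootSystem E p} {r} (Π : SimpleSystem Φ (suc r)) where
    open SimpleSystem Π

    Conclusion : Fin (suc r) → Set _
    Conclusion α = ∃₂ λ (h h′ : ℕ) → ∃₂ λ (a b : ℕ) → Σ[ b≢0 ∈ NonZero b ]
      IsCoxeterNumber Π h × IsCoxeterNumber (subsimple Π α) h′ ×
      HasCardinality (GL E) (W Π (_≡ α)) a ×
      HasCardinality (GL E) (W Π (Ñ[_] Π α)) b ×
      (+ (h ℕ.* suc r) ℤ.- + (h′ ℕ.* r)) / 1 ≡ (+ 2 / 1) ℚ.* _/_ (+ a) b {{b≢0}}

    conclusion : ∀ α {h h′ a b} → NonZero b → IsCoxeterNumber Π h → IsCoxeterNumber (subsimple Π α) h′ →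
      HasCardinality (GL E) (W Π (_≡ α)) a → HasCardinality (GL E) (W Π (Ñ[_] Π α)) b →
      h ℕ.* suc r ℕ.* b ≡ h′ ℕ.* r ℕ.* b ℕ.+ 2 ℕ.* a → Conclusion α
    conclusion _ {h} {h′} {a} {b} b≢0 cox cox′ card card′ eq = h , h′ , a , b , b≢0 , cox , cox′ , card , card′ ,
      coxeter-identity (h ℕ.* suc r) (h′ ℕ.* r) a b {{b≢0}} eq

    -- Here f is `punchIn i` in the form that suits the diagram, `suc` for the first node and
    -- `inject₁` for the last, so that the shape of the smaller family is already known.
    removed-coxeterNumber : ∀ h (σ : Permutation′ (suc r)) i (f : Fin r → Fin (suc r)) →
      (∀ j → Fin.punchIn i j ≡ f j) →
      (∀ t → Realizes t (λ j → simple (σ ⟨$⟩ʳ f j)) →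
        ∀ (π : Permutation′ r) → HasOrder (GL E) (prod (GL E) (λ i → t (π ⟨$⟩ʳ i))) h) →
      IsCoxeterNumber (subsimple Π (σ ⟨$⟩ʳ i)) h
    removed-coxeterNumber h σ i f punchIn≡f = coxeterNumber (subsimple Π (σ ⟨$⟩ʳ i)) h (Perm.remove i σ)
      (λ j → ≡.cong simple (≡.trans (≡.sym (Perm.punchIn-permute σ i j)) (≡.cong (σ ⟨$⟩ʳ_) (punchIn≡f j))))

  first-neighbours : ∀ {k} {b : Family (2 ℕ.+ k)} → Root (b zero) → Adj (b zero) (b (suc zero)) →
    ∀ p → (∃ λ j → p ≡ suc (suc j)) ⊎ ⟪ b p , b zero ⟫ ≉ 0#
  first-neighbours root adj zero          = inj₂ (root-⟪⟫≉0 root)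
  first-neighbours root adj (suc zero)    = inj₂ (adj-⟪⟫≉0 (Adj-sym adj))
  first-neighbours root adj (suc (suc j)) = inj₁ (j , ≡.refl)

  -- This and the next two identities are h N b = h′ (N - 1) b + 2 a, where N is the number of nodes
  -- and (h, h′, a / b) is (N + 1, N, N) on a path, (2 (N - 1), 2 (N - 2), 2 (N - 1)) at the tail of
  -- a fork and (2 (N - 1), N, N (N - 1) / 2) on a branch.
  path-identity : ∀ r n → (3 ℕ.+ r) ℕ.* (2 ℕ.+ r) ℕ.* n ≡
                  (2 ℕ.+ r) ℕ.* (1 ℕ.+ r) ℕ.* n ℕ.+ 2 ℕ.* ((2 ℕ.+ r) ℕ.* n)
  path-identity = solve-∀

  fork-tail-identity : ∀ m n → ((3 ℕ.+ m) ℕ.+ (3 ℕ.+ m)) ℕ.* (4 ℕ.+ m) ℕ.* n ≡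
    ((2 ℕ.+ m) ℕ.+ (2 ℕ.+ m)) ℕ.* (3 ℕ.+ m) ℕ.* n ℕ.+ 2 ℕ.* (((3 ℕ.+ m) ℕ.+ (3 ℕ.+ m)) ℕ.* n)
  fork-tail-identity = solve-∀

  fork-branch-identity : ∀ m n → ((3 ℕ.+ m) ℕ.+ (3 ℕ.+ m)) ℕ.* (4 ℕ.+ m) ℕ.* (2 ℕ.* n) ≡
    (4 ℕ.+ m) ℕ.* (3 ℕ.+ m) ℕ.* (2 ℕ.* n) ℕ.+ 2 ℕ.* ((4 ℕ.+ m) ℕ.* ((3 ℕ.+ m) ℕ.* n))
  fork-branch-identity = solve-∀

  punchIn-fromℕ : ∀ {k} (j : Fin k) → Fin.punchIn (fromℕ k) j ≡ inject₁ j
  punchIn-fromℕ zero    = ≡.refl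
  punchIn-fromℕ (suc j) = ≡.cong suc (punchIn-fromℕ j)

  -- With the nodes below the last one listed downwards, the neighbour of
  -- the last node is the node 1F.
  module _ {m} {b : Family (4 ℕ.+ m)} (fork : IsFork b) where
    private
      last : Carrierᴹ
      last = b (fromℕ (3 ℕ.+ m))

      below : Fin (2 ℕ.+ m) → Fin (4 ℕ.+ m)
      below j = inject₁ (Fin.opposite (Fin.punchIn 1F j))

    opposite≢1 : ∀ (j : Fin (2 ℕ.+ m)) → suc (toℕ (Fin.opposite (Fin.punchIn 1F j))) ≢ 2 ℕ.+ m
    opposite≢1 zero eq = ℕ.1+n≢n (≡.trans (≡.cong suc (≡.sym (Fin.opposite-prop {3 ℕ.+ m} zero))) eq)
    opposite≢1 (suc j) eq = ℕ.<⇒≢ (s≤s (s≤s (ℕ.m∸n≤m m (toℕ j))))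
      (≡.trans (≡.cong suc (≡.sym (Fin.opposite-prop {3 ℕ.+ m} (suc (suc j))))) eq)

    below-⊥ : ∀ j → b (below j) ⊥ last
    below-⊥ j = [ (λ (eq , _) → contradiction eq (opposite≢1 j)) , proj₂ ]′
                (fork-last fork (Fin.opposite (Fin.punchIn 1F j)))

    below-cover : ∀ p → (∃ λ j → p ≡ below j) ⊎ ⟪ b p , last ⟫ ≉ 0#
    below-cover p with view p
    ... | ‵fromℕ     = inj₂ (root-⟪⟫≉0 (fork-roots fork (fromℕ (3 ℕ.+ m))))
    ... | ‵inject₁ i with fork-last fork i
    ...   | inj₁ (_ , adj) = inj₂ (adj-⟪⟫≉0 adj)
    ...   | inj₂ (neq , _) = inj₁ (Fin.punchOut 1≢ , ≡.cong inject₁ (≡.sym (≡.trans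
              (≡.cong Fin.opposite (Fin.punchIn-punchOut 1≢)) (Fin.opposite-involutive i))))
      where
      1≢ : 1F ≢ Fin.opposite i
      1≢ eq = neq (≡.cong suc (≡.trans
        (≡.cong toℕ (≡.trans (≡.sym (Fin.opposite-involutive i)) (≡.cong Fin.opposite (≡.sym eq))))
        (Fin.opposite-prop {3 ℕ.+ m} 1F)))

    -- Listed downwards, the path below the last tip begins with the other tip and the branch node.
    -- Let n count the group of the nodes after these two: putting both back gives two steps in type
    -- A, putting back only the tip, now isolated, doubles n.
    below-finite : ∃ λ n → NonZero n ×
      HasCardinality (GL E) (ReflectionGroup (λ j → b (inject₁ (Fin.opposite j)))) ((4 ℕ.+ m) ℕ.* ((3 ℕ.+ m) ℕ.* n)) ×
      HasCardinality (GL E) (ReflectionGroup (λ j → b (below j))) (2 ℕ.* n)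
    below-finite with path@((_ , link) , path₁@(_ , path₂)) ← path-reverse (fork-init fork)
      with n , n≢0 , card ← path-finite path₂ =
      n , n≢0 , path-step path (path-step path₁ card) ,
      orthogonal-step {b = λ j → b (below j)} (λ j → path-roots path (Fin.punchIn 1F j))
        (λ i j → Sum.map₁ (Fin.punchIn-injective 1F i j) (path-laced path (Fin.punchIn 1F i) (Fin.punchIn 1F j)))
        (λ j → link (suc j)) card

  path-end : ∀ {Φ : RootSystem E p} {r} (Π : SimpleSystem Φ (suc r)) (σ : Permutation′ (suc r)) →
    IsPath (λ i → SimpleSystem.simple Π (σ ⟨$⟩ʳ i)) →
    ∀ {α} → σ ⟨$⟩ʳ zero ≡ α → Conclusion Π α
  path-end {r = zero} Π σ path@((root , _) , tail) ≡.refl =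
    let n , n≢0 , card = path-finite tail in
    conclusion Π (σ ⟨$⟩ʳ zero) { 2} {1} {n} {n} n≢0
      (coxeterNumber Π 2 σ (λ _ → ≡.refl) (path-order path))
      -- No simple reflection is left, so the Coxeter element is the identity, of order 1; in the
      -- identity this is multiplied by r = 0.
      (removed-coxeterNumber Π 1 σ zero suc (λ _ → ≡.refl) (path-order tail))
      (node-cardinality Π σ zero suc (λ _ ()) (suc-cover) card)
      (neighbours-cardinality Π σ zero suc root (λ ()) (λ { zero → inj₂ (root-⟪⟫≉0 root) }) card)
      ≡.refl
  path-end {r = suc r} Π σ path@((root , link) , tail@(_ , tail₂)) ≡.refl =
    let n , n≢0 , card = path-finite tail₂ in
    conclusion Π (σ ⟨$⟩ʳ zero) { 3 ℕ.+ r} {2 ℕ.+ r} {(2 ℕ.+ r) ℕ.* n} {n} n≢0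
      (coxeterNumber Π (3 ℕ.+ r) σ (λ _ → ≡.refl) (path-order path))
      (removed-coxeterNumber Π (2 ℕ.+ r) σ zero suc (λ _ → ≡.refl) (path-order tail))
      (node-cardinality Π σ zero suc (λ _ ()) (suc-cover) (path-step tail card))
      (neighbours-cardinality Π σ zero (λ j → suc (suc j)) root (λ j → ⊥-sym (link (suc j)))
        (first-neighbours root (link zero)) card)
      (path-identity r n)

  -- For four nodes the tail is D_3, whose Coxeter number 4 follows the formula 2 (N - 1) of the
  -- larger forks, and the nodes off `Ñ[_] Π α` form D_2.
  fork-end : ∀ {Φ : RootSystem E p} {m} (Π : SimpleSystem Φ (suc (suc (suc (suc m))))) (σ : Permutation′ (suc (suc (suc (suc m))))) →
    IsFork (λ i → SimpleSystem.simple Π (σ ⟨$⟩ʳ i)) →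
    ∀ {α} → σ ⟨$⟩ʳ zero ≡ α → Conclusion Π α
  fork-end {m = m} Π σ fork@((root , link) , tail@(_ , tail₂)) ≡.refl =
    let n , n≢0 , card = fork-finite tail₂ in
    conclusion Π (σ ⟨$⟩ʳ zero) {(3 ℕ.+ m) ℕ.+ (3 ℕ.+ m)} {(2 ℕ.+ m) ℕ.+ (2 ℕ.+ m)}
      {((3 ℕ.+ m) ℕ.+ (3 ℕ.+ m)) ℕ.* n} {n} n≢0
      (coxeterNumber Π ((3 ℕ.+ m) ℕ.+ (3 ℕ.+ m)) σ {λ i → SimpleSystem.simple Π (σ ⟨$⟩ʳ i)} (λ _ → ≡.refl) (fork-order {m = 1 ℕ.+ m} fork))
      (removed-coxeterNumber Π ((2 ℕ.+ m) ℕ.+ (2 ℕ.+ m)) σ zero suc (λ _ → ≡.refl) (fork-order {m = m} tail))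
      (node-cardinality Π σ zero suc (λ _ ()) (suc-cover) (fork-step tail card))
      (neighbours-cardinality Π σ zero (λ j → suc (suc j)) root (λ j → ⊥-sym (link (suc j)))
        (first-neighbours root (link zero)) card)
      (fork-tail-identity m n)

  inject₁-cover : ∀ {k} (p : Fin (suc k)) → p ≢ fromℕ k → ∃ λ j → p ≡ inject₁ (Fin.opposite j)
  inject₁-cover p p≢ with view p
  ... | ‵fromℕ     = contradiction ≡.refl p≢
  ... | ‵inject₁ i = Fin.opposite i , ≡.cong inject₁ (≡.sym (Fin.opposite-involutive i))

  fork-branch : ∀ {Φ : RootSystem E p} {m} (Π : SimpleSystem Φ (suc (suc (suc (suc m))))) (σ : Permutation′ (suc (suc (suc (suc m))))) →
    IsFork (λ i → SimpleSystem.simple Π (σ ⟨$⟩ʳ i)) →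
    ∀ {α} → σ ⟨$⟩ʳ fromℕ (suc (suc (suc m))) ≡ α → Conclusion Π α
  fork-branch {m = m} Π σ fork ≡.refl =
    let n , n≢0 , card , card₂ = below-finite fork in
    conclusion Π (σ ⟨$⟩ʳ fromℕ (suc (suc (suc m)))) {(3 ℕ.+ m) ℕ.+ (3 ℕ.+ m)} {4 ℕ.+ m}
      {(4 ℕ.+ m) ℕ.* ((3 ℕ.+ m) ℕ.* n)} {2 ℕ.* n} (ℕ.m*n≢0 2 n {{_}} {{n≢0}})
      (coxeterNumber Π ((3 ℕ.+ m) ℕ.+ (3 ℕ.+ m)) σ {λ i → SimpleSystem.simple Π (σ ⟨$⟩ʳ i)} (λ _ → ≡.refl) (fork-order {m = 1 ℕ.+ m} fork))
      (removed-coxeterNumber Π (4 ℕ.+ m) σ (fromℕ (suc (suc (suc m)))) inject₁ (punchIn-fromℕ) (path-order (fork-init fork)))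
      (node-cardinality Π σ (fromℕ (suc (suc (suc m)))) (λ j → inject₁ (Fin.opposite j))
        (λ j eq → Fin.fromℕ≢inject₁ (≡.sym eq)) inject₁-cover card)
      (neighbours-cardinality Π σ (fromℕ (suc (suc (suc m)))) (λ j → inject₁ (Fin.opposite (Fin.punchIn 1F j)))
        (fork-roots fork (fromℕ (suc (suc (suc m))))) (below-⊥ fork) (below-cover fork) card₂)
      (fork-branch-identity m n)

  position-leaf : ∀ {Φ : RootSystem E p} {k} (Π : SimpleSystem Φ k) (σ : Permutation′ k) {α} → IsLeaf Π α →
    Roots (λ i → SimpleSystem.simple Π (σ ⟨$⟩ʳ i)) →
    Leaf (λ i → SimpleSystem.simple Π (σ ⟨$⟩ʳ i)) (σ ⟨$⟩ˡ α)
  position-leaf Π σ leaf = leaf-numbering Π σ (≡.subst (IsLeaf Π) (≡.sym (Perm.inverseʳ σ)) leaf)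

  position-≡ : ∀ {k} (σ : Permutation′ k) {α i} → σ ⟨$⟩ˡ α ≡ i → σ ⟨$⟩ʳ i ≡ α
  position-≡ σ eq = ≡.trans (≡.cong (σ ⟨$⟩ʳ_) (≡.sym eq)) (Perm.inverseʳ σ)

  path-conclusion : ∀ {Φ : RootSystem E p} {r} (Π : SimpleSystem Φ (suc r)) (σ : Permutation′ (suc r)) {α} →
    IsLeaf Π α → IsPath (λ i → SimpleSystem.simple Π (σ ⟨$⟩ʳ i)) → Conclusion Π α
  path-conclusion Π σ {α} leaf path =
    [ (λ eq → path-end Π σ path {α} (position-≡ σ eq))
    , (λ eq → path-end Π (Perm.reverse ∘ₚ σ) (path-reverse path) {α} (position-≡ σ eq))
    ]′ (path-leaf path (σ ⟨$⟩ˡ α) (position-leaf Π σ leaf (path-roots path)))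

  fork-leaves : ∀ {m} {b : Family (4 ℕ.+ m)} → IsFork b → ∀ p → Leaf b p →
    p ≡ zero ⊎ p ≡ fromℕ (3 ℕ.+ m) ⊎ p ≡ fork-flip (fromℕ (3 ℕ.+ m))
  fork-leaves fork zero    leaf = inj₁ ≡.refl
  fork-leaves {m} fork (suc p) leaf = inj₂ (Sum.map₂
    (λ eq → ≡.trans eq (≡.sym (fork-flip-last (2 ℕ.+ m)))) (fork-leaf fork p leaf))

  fork-conclusion : ∀ {Φ : RootSystem E p} {m} (Π : SimpleSystem Φ (suc (suc (suc (suc m)))))
    (σ : Permutation′ (suc (suc (suc (suc m))))) {α} → IsLeaf Π α →
    IsFork (λ i → SimpleSystem.simple Π (σ ⟨$⟩ʳ i)) → Conclusion Π α
  fork-conclusion {m = m} Π σ {α} leaf fork =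
    [ (λ eq → fork-end Π σ fork {α} (position-≡ σ eq))
    , [ (λ eq → fork-branch Π σ fork {α} (position-≡ σ eq))
      , (λ eq → fork-branch Π (flip-permutation (suc (suc m)) ∘ₚ σ) (fork-flipped fork) {α} (position-≡ σ eq))
      ]′
    ]′ (fork-leaves fork (σ ⟨$⟩ˡ α) (position-leaf Π σ leaf (fork-roots fork)))

corollary8p3 :
  {c ℓ₁ ℓ₂ v ℓv p : Level}
  {K : OrderedField c ℓ₁ ℓ₂} {E : EuclideanSpace K v ℓv}
  (Φ : RootSystem E p) (r : ℕ) → let n = suc r in
  (Π : SimpleSystem Φ n) → TypeA Π ⊎ TypeD Π →
  (α : Fin n) → IsLeaf Π α →
  ∃₂ λ (h h′ : ℕ) → ∃₂ λ (a b : ℕ) → Σ[ b≢0 ∈ NonZero b ]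
    IsCoxeterNumber Π h × IsCoxeterNumber (subsimple Π α) h′ ×
    HasCardinality (GL E) (W Π (_≡ α)) a ×
    HasCardinality (GL E) (W Π (Ñ[_] Π α)) b ×
    (+ (h ℕ.* n) ℤ.- + (h′ ℕ.* r)) / 1 ≡ (+ 2 / 1) ℚ.* _/_ (+ a) b {{b≢0}}
corollary8p3 {E = E} Φ r Π (inj₁ (_ , σ , matrix)) α leaf =
  path-conclusion E Π σ leaf (matrix-path E matrix)
corollary8p3 {E = E} Φ _ Π (inj₂ (s≤s (s≤s (s≤s (s≤s z≤n))) , σ , matrix)) α leaf =
  fork-conclusion E Π σ leaf (matrix-fork E matrix)
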